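{- Let $R$ be a noetherian commutative ring, $S$ a multiplicative set of $R$ consisting of non-zero-divisors, and assume there is an integer $d(R)$ such that $\mathrm{Ext}^i_R(M,R)=0$ for all $i>d(R)$ and all finitely generated $R$-modules $M$. Let $\mathcal{F}=\mathrm{Fitt}_R:\mathcal{C}\to\Omega$. Then for every $M\in\mathcal{C}$, \[ \mathcal{F}^{\langle-2\rangle}(M)=\mathcal{F}(M^*). \]
   Context: $\mathcal M$ is the category of finitely generated $S$-torsion $R$-modules; $\mathcal C=\{M\in\mathcal M\mid\mathrm{Ext}^i_R(M,R)=0\text{ for all }i\ge2\}$; $\mathcal P=\{P\in\mathcal M\mid\mathrm{pd}_R(P)\le1\}$. $M^*=\mathrm{Ext}^1_R(M,R)$, which lies in $\mathcal C$ for $M\in\mathcal C$. $\mathrm{Fitt}_R$ is the initial Fitting ideal, and $\Omega$ is the commutative monoid of finitely generated $R$-submodules of $S^{ -1}R$ under multiplication; $\mathcal F(P)$ is invertible in $\Omega$ for $P\in\mathcal P$. For $M\in\mathcal C$, $\mathcal F^{\langle-2\rangle}(M)$ is defined by taking an exact sequence $0\to M\to P_2\to P_1\to N\to0$ with $N\in\mathcal C$, $P_1,P_2\in\mathcal P$ (and image of $P_2\to P_1$ in $\mathcal C$) and putting $\mathcal F^{\langle-2\rangle}(M)=\mathcal F(P_1)^{ -1}\mathcal F(P_2)\mathcal F(N)$; such a sequence exists and the value is independent of its choice. -}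

module Defs where

open import Level using (Level; _⊔_; Lift; lower) renaming (suc to lsuc)
open import Algebra.Bundles using (CommutativeRing; CommutativeMonoid; Semiring)
open import Algebra.Module.Bundles using (Module)
open import Algebra.Module.Construct.TensorUnit using (⟨module⟩)
import Algebra.Module.Construct.Zero as Zero
open import Algebra.Module.Morphism.Structures using (IsModuleHomomorphism)
open import Algebra.Module.Structures using (IsModule)
open import Algebra.Module.Structures.Biased using (IsModuleFromLeft)
import Algebra.Properties.Group as GroupProperties
import Algebra.Properties.AbelianGroup as AbelianGroupProperties
import Algebra.Properties.CommutativeSemigroup as CommutativeSemigroupProperties
import Algebra.Properties.Ring as RingProperties
import Algebra.Properties.Monoid.Sum as Sum
import Algebra.Definitions.RawSemiring as SemiringDefinitions
open import Data.Nat.Base as ℕ using (ℕ; zero; suc; _≤_; _<_)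
open import Data.Integer.Base as ℤ using (ℤ)
open import Data.Fin.Base using (Fin; zero; suc; toℕ; punchIn; splitAt; join; combine; remQuot)
open import Data.Fin.Properties using (splitAt-join; remQuot-combine)
open import Data.Product.Base using (Σ; ∃; _×_; _,_; proj₁; proj₂)
open import Data.Sum.Base using (_⊎_; inj₁; inj₂; [_,_]′)
open import Function.Base using (id; _∘_)
open import Function.Definitions using (Injective; StrictlySurjective)
open import Relation.Binary.Core using (Rel)
open import Relation.Binary.Structures using (IsEquivalence)
open import Relation.Binary.PropositionalEquality.Core as ≡ using (_≡_)
import Relation.Binary.Reasoning.Setoid as SetoidReasoning

module Modules {ℓ : Level} (R : CommutativeRing ℓ ℓ) where

  open CommutativeRing R using (Carrier; _≈_; _+_; _*_; 0#; 1#)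
  private module R = CommutativeRing R

  Mod : Set (lsuc ℓ)
  Mod = Module R ℓ ℓ

  ⟨R⟩ : Mod
  ⟨R⟩ = ⟨module⟩ {R = R}

  ⟨0⟩ : Mod
  ⟨0⟩ = Zero.⟨module⟩

  ∣_∣ : Mod → Set ℓ
  ∣ M ∣ = Module.Carrierᴹ M

  IsZero : Mod → Set ℓ
  IsZero M = ∀ x → x ≈ᴹ 0ᴹ where open Module M

  record ModuleOps : Set (lsuc ℓ) where
    field
      Elem : Set ℓ
      eq   : Rel Elem ℓ
      add  : Elem → Elem → Elem
      nil  : Elem
      neg  : Elem → Elem
      act  : Carrier → Elem → Elem

  -- The module axioms without the redundant ones of IsModule.  Proofs of laws
  -- are kept abstract throughout so that conversion never unfolds them.
  record ModuleLaws (O : ModuleOps) : Set ℓ where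
    open ModuleOps O
    field
      equiv     : IsEquivalence eq
      add-cong  : ∀ {x x′ y y′} → eq x x′ → eq y y′ → eq (add x y) (add x′ y′)
      neg-cong  : ∀ {x x′} → eq x x′ → eq (neg x) (neg x′)
      act-cong  : ∀ {r r′ x x′} → r ≈ r′ → eq x x′ → eq (act r x) (act r′ x′)
      add-assoc : ∀ x y z → eq (add (add x y) z) (add x (add y z))
      add-comm  : ∀ x y → eq (add x y) (add y x)
      add-nil   : ∀ x → eq (add nil x) x
      add-neg   : ∀ x → eq (add (neg x) x) nil
      act-add   : ∀ r x y → eq (act r (add x y)) (add (act r x) (act r y))
      add-act   : ∀ x r s → eq (act (r + s) x) (add (act r x) (act s x))
      act-assoc : ∀ r s x → eq (act (r * s) x) (act r (act s x))
      act-1     : ∀ x → eq (act 1# x) x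

    open IsEquivalence equiv using (refl; sym; trans)

    idem⇒nil : ∀ x → eq (add x x) x → eq x nil
    idem⇒nil x e = trans (sym (add-nil x)) (trans (add-cong (sym (add-neg x)) refl)
      (trans (add-assoc (neg x) x x) (trans (add-cong refl e) (add-neg x))))

    abstract
      isModule : IsModule R eq add nil neg act (λ x r → act r x)
      isModule = IsModuleFromLeft.isModule {commutativeRing = R} (record
        { isLeftModule = record
          { isLeftSemimodule = record
            { +ᴹ-isCommutativeMonoid = record
              { isMonoid = record
                { isSemigroup = record
                  { isMagma = record { isEquivalence = equiv ; ∙-cong = add-cong }
                  ; assoc = add-assoc }
                ; identity = add-nil , λ x → trans (add-comm x nil) (add-nil x) }
              ; comm = add-comm }
            ; isPreleftSemimodule = record
              { *ₗ-cong = act-cong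
              ; *ₗ-zeroˡ = λ x → idem⇒nil _
                  (trans (sym (add-act x 0# 0#)) (act-cong (R.+-identityˡ 0#) refl))
              ; *ₗ-distribʳ = add-act
              ; *ₗ-identityˡ = act-1
              ; *ₗ-assoc = act-assoc
              ; *ₗ-zeroʳ = λ r → idem⇒nil _
                  (trans (sym (act-add r nil nil)) (act-cong R.refl (add-nil nil)))
              ; *ₗ-distribˡ = act-add } }
          ; -ᴹ‿cong = neg-cong
          ; -ᴹ‿inverse = add-neg , λ x → trans (add-comm x (neg x)) (add-neg x) } })

  mkModule : (O : ModuleOps) → ModuleLaws O → Mod
  mkModule O L = record
    { Carrierᴹ = O.Elem ; _≈ᴹ_ = O.eq ; _+ᴹ_ = O.add ; _*ₗ_ = O.act ; _*ᵣ_ = λ x r → O.act r x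
    ; 0ᴹ = O.nil ; -ᴹ_ = O.neg ; isModule = ModuleLaws.isModule L }
    where module O = ModuleOps O

  infix 3 _⟶_
  infixr 9 _⊚_

  record _⟶_ (M N : Mod) : Set ℓ where
    private
      module M = Module M
      module N = Module N
    field
      ⟦_⟧ : ∣ M ∣ → ∣ N ∣
      isModuleHomomorphism : IsModuleHomomorphism M.rawModule N.rawModule ⟦_⟧
    open IsModuleHomomorphism isModuleHomomorphism public
      using (⟦⟧-cong; +ᴹ-homo; *ₗ-homo; 0ᴹ-homo; -ᴹ-homo)

  open _⟶_ public using (⟦_⟧)

  module _ {M N : Mod} where
    private
      module M = Module M
      module N = Module N
      open GroupProperties N.+ᴹ-group using (identityʳ-unique; inverseˡ-unique)

    module _ (f : ∣ M ∣ → ∣ N ∣)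
             (cong : ∀ {x y} → x M.≈ᴹ y → f x N.≈ᴹ f y)
             (add : ∀ x y → f (x M.+ᴹ y) N.≈ᴹ f x N.+ᴹ f y)
             (scale : ∀ r x → f (r M.*ₗ x) N.≈ᴹ r N.*ₗ f x) where

      abstract
        isHom : IsModuleHomomorphism M.rawModule N.rawModule f
        isHom = record { isBimoduleHomomorphism = record
          { +ᴹ-isGroupHomomorphism = record
            { isMonoidHomomorphism = record
              { isMagmaHomomorphism = record
                { isRelHomomorphism = record { cong = cong }
                ; homo = add }
              ; ε-homo = f0 }
            ; ⁻¹-homo = λ x → inverseˡ-unique (f (M.-ᴹ x)) (f x)
                (N.≈ᴹ-trans (N.≈ᴹ-sym (add (M.-ᴹ x) x))
                  (N.≈ᴹ-trans (cong (M.-ᴹ‿inverseˡ x)) f0)) }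
          ; *ₗ-homo = scale
          ; *ᵣ-homo = λ r x → N.≈ᴹ-trans (cong (M.≈ᴹ-sym (M.*ₗ-*ᵣ-coincident r x)))
              (N.≈ᴹ-trans (scale r x) (N.*ₗ-*ᵣ-coincident r (f x))) } }
          where
          f0 : f M.0ᴹ N.≈ᴹ N.0ᴹ
          f0 = identityʳ-unique (f M.0ᴹ) (f M.0ᴹ)
            (N.≈ᴹ-trans (N.≈ᴹ-sym (add M.0ᴹ M.0ᴹ)) (cong (M.+ᴹ-identityˡ M.0ᴹ)))

      mkHom : M ⟶ N
      mkHom = record { ⟦_⟧ = f ; isModuleHomomorphism = isHom }

  _⊚_ : {L M N : Mod} → M ⟶ N → L ⟶ M → L ⟶ N
  _⊚_ {N = N} g f = mkHom (⟦ g ⟧ ∘ ⟦ f ⟧) (g.⟦⟧-cong ∘ f.⟦⟧-cong)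
    (λ x y → trans (g.⟦⟧-cong (f.+ᴹ-homo x y)) (g.+ᴹ-homo _ _))
    (λ r x → trans (g.⟦⟧-cong (f.*ₗ-homo r x)) (g.*ₗ-homo r _))
    where
    module g = _⟶_ g
    module f = _⟶_ f
    open Module N using () renaming (≈ᴹ-trans to trans)

  0-hom : {M N : Mod} → M ⟶ N
  0-hom {N = N} = mkHom (λ _ → 0ᴹ) (λ _ → ≈ᴹ-refl)
    (λ _ _ → ≈ᴹ-sym (+ᴹ-identityˡ 0ᴹ)) (λ r _ → ≈ᴹ-sym (*ₗ-zeroʳ r))
    where open Module N

  IsInjective : {M N : Mod} → M ⟶ N → Set ℓ
  IsInjective {M} {N} f = Injective (Module._≈ᴹ_ M) (Module._≈ᴹ_ N) ⟦ f ⟧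

  IsSurjective : {M N : Mod} → M ⟶ N → Set ℓ
  IsSurjective {N = N} f = StrictlySurjective (Module._≈ᴹ_ N) ⟦ f ⟧

  IsExact : {L M N : Mod} → L ⟶ M → M ⟶ N → Set ℓ
  IsExact {L} {M} {N} f g =
    (∀ x → ⟦ g ⟧ (⟦ f ⟧ x) N.≈ᴹ N.0ᴹ) ×
    (∀ y → ⟦ g ⟧ y N.≈ᴹ N.0ᴹ → ∃ λ x → ⟦ f ⟧ x M.≈ᴹ y)
    where
    module M = Module M
    module N = Module N

  IsProjective : Mod → Set (lsuc ℓ)
  IsProjective P = {M N : Mod} (g : M ⟶ N) → IsSurjective g → (f : P ⟶ N) →
    Σ (P ⟶ M) λ h → ∀ x → Module._≈ᴹ_ N (⟦ g ⟧ (⟦ h ⟧ x)) (⟦ f ⟧ x)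

  record Submodule (M : Mod) : Set (lsuc ℓ) where
    open Module M
    field
      member : ∣ M ∣ → Set ℓ
      ∈-resp : ∀ {x y} → x ≈ᴹ y → member x → member y
      0∈     : member 0ᴹ
      +∈     : ∀ {x y} → member x → member y → member (x +ᴹ y)
      *∈     : ∀ r {x} → member x → member (r *ₗ x)

    -∈ : ∀ {x} → member x → member (-ᴹ x)
    -∈ {x} p = ∈-resp -1·x (*∈ (R.- 1#) p)
      where
      open GroupProperties +ᴹ-group using (inverseˡ-unique)
      -1·x : (R.- 1#) *ₗ x ≈ᴹ -ᴹ x
      -1·x = inverseˡ-unique _ x (begin
        (R.- 1#) *ₗ x +ᴹ x        ≈⟨ +ᴹ-congˡ (≈ᴹ-sym (*ₗ-identityˡ x)) ⟩
        (R.- 1#) *ₗ x +ᴹ 1# *ₗ x  ≈⟨ ≈ᴹ-sym (*ₗ-distribʳ x _ _) ⟩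
        (R.- 1# + 1#) *ₗ x        ≈⟨ *ₗ-congʳ (R.-‿inverseˡ 1#) ⟩
        0# *ₗ x                   ≈⟨ *ₗ-zeroˡ x ⟩
        0ᴹ ∎)
        where open SetoidReasoning ≈ᴹ-setoid

    asOps : ModuleOps
    asOps .ModuleOps.Elem = Σ ∣ M ∣ member
    asOps .ModuleOps.eq = λ x y → proj₁ x ≈ᴹ proj₁ y
    asOps .ModuleOps.add = λ x y → proj₁ x +ᴹ proj₁ y , +∈ (proj₂ x) (proj₂ y)
    asOps .ModuleOps.nil = 0ᴹ , 0∈
    asOps .ModuleOps.neg = λ x → -ᴹ proj₁ x , -∈ (proj₂ x)
    asOps .ModuleOps.act = λ r x → r *ₗ proj₁ x , *∈ r (proj₂ x)

    abstract
      asLaws : ModuleLaws asOps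
      asLaws .ModuleLaws.equiv = record { refl = ≈ᴹ-refl ; sym = ≈ᴹ-sym ; trans = ≈ᴹ-trans }
      asLaws .ModuleLaws.add-cong = +ᴹ-cong
      asLaws .ModuleLaws.neg-cong = -ᴹ‿cong
      asLaws .ModuleLaws.act-cong = *ₗ-cong
      asLaws .ModuleLaws.add-assoc = λ x y z → +ᴹ-assoc _ _ _
      asLaws .ModuleLaws.add-comm = λ x y → +ᴹ-comm _ _
      asLaws .ModuleLaws.add-nil = λ x → +ᴹ-identityˡ _
      asLaws .ModuleLaws.add-neg = λ x → -ᴹ‿inverseˡ _
      asLaws .ModuleLaws.act-add = λ r x y → *ₗ-distribˡ r _ _
      asLaws .ModuleLaws.add-act = λ x r s → *ₗ-distribʳ _ r s
      asLaws .ModuleLaws.act-assoc = λ r s x → *ₗ-assoc r s _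
      asLaws .ModuleLaws.act-1 = λ x → *ₗ-identityˡ _

    asModule : Mod
    asModule = mkModule asOps asLaws

  infix 4 _∈_
  _∈_ : {M : Mod} → ∣ M ∣ → Submodule M → Set ℓ
  x ∈ N = Submodule.member N x

  kernel : {M N : Mod} → M ⟶ N → Submodule M
  kernel {M} {N} f = record
    { member = λ x → ⟦ f ⟧ x ≈ᴹ 0ᴹ
    ; ∈-resp = λ e p → ≈ᴹ-trans (≈ᴹ-sym (⟦⟧-cong e)) p
    ; 0∈ = 0ᴹ-homo
    ; +∈ = λ p q → ≈ᴹ-trans (+ᴹ-homo _ _) (≈ᴹ-trans (+ᴹ-cong p q) (+ᴹ-identityˡ _))
    ; *∈ = λ r p → ≈ᴹ-trans (*ₗ-homo r _) (≈ᴹ-trans (*ₗ-congˡ p) (*ₗ-zeroʳ r)) }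
    where
    open Module N
    open _⟶_ f hiding (⟦_⟧)

  map : {M M′ : Mod} → M ⟶ M′ → Submodule M → Submodule M′
  map {M} {M′} f N = record
    { member = λ y → ∃ λ x → x ∈ N × ⟦ f ⟧ x ≈ᴹ y
    ; ∈-resp = λ e (x , p , q) → x , p , ≈ᴹ-trans q e
    ; 0∈ = _ , 0∈ , 0ᴹ-homo
    ; +∈ = λ (x , p , q) (x′ , p′ , q′) → _ , +∈ p p′ , ≈ᴹ-trans (+ᴹ-homo x x′) (+ᴹ-cong q q′)
    ; *∈ = λ r (x , p , q) → _ , *∈ r p , ≈ᴹ-trans (*ₗ-homo r x) (*ₗ-congˡ q) }
    where
    open Module M′
    open Submodule N
    open _⟶_ f hiding (⟦_⟧)

  preimage : {M M′ : Mod} → M ⟶ M′ → Submodule M′ → Submodule M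
  preimage {M} {M′} f N = record
    { member = λ x → ⟦ f ⟧ x ∈ N
    ; ∈-resp = λ e → ∈-resp (⟦⟧-cong e)
    ; 0∈ = ∈-resp (≈ᴹ-sym 0ᴹ-homo) 0∈
    ; +∈ = λ p q → ∈-resp (≈ᴹ-sym (+ᴹ-homo _ _)) (+∈ p q)
    ; *∈ = λ r p → ∈-resp (≈ᴹ-sym (*ₗ-homo r _)) (*∈ r p) }
    where
    open Module M′
    open Submodule N
    open _⟶_ f hiding (⟦_⟧)

  image : {M N : Mod} → M ⟶ N → Submodule N
  image {M} {N} f = record
    { member = λ y → ∃ λ x → ⟦ f ⟧ x ≈ᴹ y
    ; ∈-resp = λ e (x , q) → x , ≈ᴹ-trans q e
    ; 0∈ = _ , 0ᴹ-homo
    ; +∈ = λ (x , q) (x′ , q′) → _ , ≈ᴹ-trans (+ᴹ-homo x x′) (+ᴹ-cong q q′)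
    ; *∈ = λ r (x , q) → _ , ≈ᴹ-trans (*ₗ-homo r x) (*ₗ-congˡ q) }
    where
    open Module N
    open _⟶_ f hiding (⟦_⟧)

  data Span {i : Level} (M : Mod) {I : Set i} (g : I → ∣ M ∣) : ∣ M ∣ → Set (i ⊔ ℓ) where
    gen  : ∀ i → Span M g (g i)
    zero : Span M g (Module.0ᴹ M)
    add  : ∀ {x y} → Span M g x → Span M g y → Span M g (Module._+ᴹ_ M x y)
    mul  : ∀ r {x} → Span M g x → Span M g (Module._*ₗ_ M r x)
    resp : ∀ {x y} → Module._≈ᴹ_ M x y → Span M g x → Span M g y

  span : (M : Mod) {I : Set ℓ} → (I → ∣ M ∣) → Submodule M
  span M g = record
    { member = Span M g ; ∈-resp = resp ; 0∈ = zero ; +∈ = add ; *∈ = mul }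

  finSpan : (M : Mod) {n : ℕ} → (Fin n → ∣ M ∣) → Submodule M
  finSpan M g = record
    { member = Span M g ; ∈-resp = resp ; 0∈ = zero ; +∈ = add ; *∈ = mul }

  record FinitelyGenerated (M : Mod) : Set ℓ where
    field
      size       : ℕ
      generators : Fin size → ∣ M ∣
      generates  : ∀ x → Span M generators x

  record FG {M : Mod} (N : Submodule M) : Set ℓ where
    field
      size       : ℕ
      generators : Fin size → ∣ M ∣
      contained  : ∀ i → generators i ∈ N
      generates  : ∀ {x} → x ∈ N → Span M generators x

  Ideal : Set (lsuc ℓ)
  Ideal = Submodule ⟨R⟩

  -- Ideals are arbitrary Set ℓ-valued predicates.
  IsNoetherian : Set (lsuc ℓ)
  IsNoetherian = (I : Ideal) → FG I

  Span⊆ : ∀ {i} {M : Mod} {I : Set i} {g : I → ∣ M ∣} (N : Submodule M) →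
          (∀ i → g i ∈ N) → ∀ {x} → Span M g x → x ∈ N
  Span⊆ N h (gen i)    = h i
  Span⊆ N h zero       = Submodule.0∈ N
  Span⊆ N h (add p q)  = Submodule.+∈ N (Span⊆ N h p) (Span⊆ N h q)
  Span⊆ N h (mul r p)  = Submodule.*∈ N r (Span⊆ N h p)
  Span⊆ N h (resp e p) = Submodule.∈-resp N e (Span⊆ N h p)

  Span-map : ∀ {i j} {M N : Mod} {I : Set i} {J : Set j} {g : I → ∣ M ∣} {h : J → ∣ N ∣}
             (f : M ⟶ N) → (∀ i → Span N h (⟦ f ⟧ (g i))) →
             ∀ {x} → Span M g x → Span N h (⟦ f ⟧ x)
  Span-map f k (gen i) = k i
  Span-map {N = N} f k zero = resp (Module.≈ᴹ-sym N (_⟶_.0ᴹ-homo f)) zero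
  Span-map {N = N} f k (add p q) =
    resp (Module.≈ᴹ-sym N (_⟶_.+ᴹ-homo f _ _)) (add (Span-map f k p) (Span-map f k q))
  Span-map {N = N} f k (mul r p) =
    resp (Module.≈ᴹ-sym N (_⟶_.*ₗ-homo f r _)) (mul r (Span-map f k p))
  Span-map f k (resp e p) = resp (_⟶_.⟦⟧-cong f e) (Span-map f k p)

  module _ {L M N : Mod} (f : L ⟶ M) (g : M ⟶ N) where
    private
      K = Submodule.asModule (kernel g)
      module K = Module K
      module L = Module L
      module f = _⟶_ f
      open Module M
      open SetoidReasoning ≈ᴹ-setoid
      open AbelianGroupProperties +ᴹ-abelianGroup using (⁻¹-∙-comm)
      open CommutativeSemigroupProperties (CommutativeMonoid.commutativeSemigroup +ᴹ-commutativeMonoid)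
        using (interchange)
      fromEq : ∀ {x y : ∣ M ∣} → x ≈ᴹ y → ∃ λ a → x ≈ᴹ y +ᴹ ⟦ f ⟧ a
      fromEq e = L.0ᴹ , ≈ᴹ-trans e (≈ᴹ-trans (≈ᴹ-sym (+ᴹ-identityʳ _)) (+ᴹ-congˡ (≈ᴹ-sym f.0ᴹ-homo)))

    homologyOps : ModuleOps
    homologyOps .ModuleOps.Elem = ∣ K ∣
    homologyOps .ModuleOps.eq = λ x y → ∃ λ a → proj₁ x ≈ᴹ proj₁ y +ᴹ ⟦ f ⟧ a
    homologyOps .ModuleOps.add = K._+ᴹ_
    homologyOps .ModuleOps.nil = K.0ᴹ
    homologyOps .ModuleOps.neg = K.-ᴹ_
    homologyOps .ModuleOps.act = K._*ₗ_

    abstract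
      homologyLaws : ModuleLaws homologyOps
      homologyLaws .ModuleLaws.equiv = record
        { refl = fromEq ≈ᴹ-refl
        ; sym = λ {x} {y} → λ (a , e) → L.-ᴹ a , (begin
            proj₁ y                                       ≈⟨ +ᴹ-identityʳ _ ⟨
            proj₁ y +ᴹ 0ᴹ                                 ≈⟨ +ᴹ-congˡ (-ᴹ‿inverseʳ _) ⟨
            proj₁ y +ᴹ (⟦ f ⟧ a +ᴹ -ᴹ ⟦ f ⟧ a)            ≈⟨ +ᴹ-assoc _ _ _ ⟨
            (proj₁ y +ᴹ ⟦ f ⟧ a) +ᴹ -ᴹ ⟦ f ⟧ a            ≈⟨ +ᴹ-cong e (f.-ᴹ-homo a) ⟨
            proj₁ x +ᴹ ⟦ f ⟧ (L.-ᴹ a)                     ∎)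
        ; trans = λ {x} {y} {z} → λ (a , e) (b , e′) → b L.+ᴹ a , (begin
            proj₁ x                                       ≈⟨ e ⟩
            proj₁ y +ᴹ ⟦ f ⟧ a                            ≈⟨ +ᴹ-congʳ e′ ⟩
            (proj₁ z +ᴹ ⟦ f ⟧ b) +ᴹ ⟦ f ⟧ a               ≈⟨ +ᴹ-assoc _ _ _ ⟩
            proj₁ z +ᴹ (⟦ f ⟧ b +ᴹ ⟦ f ⟧ a)               ≈⟨ +ᴹ-congˡ (f.+ᴹ-homo b a) ⟨
            proj₁ z +ᴹ ⟦ f ⟧ (b L.+ᴹ a)                   ∎) }
      homologyLaws .ModuleLaws.add-cong {x} {x′} {y} {y′} (a , e) (b , e′) = a L.+ᴹ b , (begin
            proj₁ x +ᴹ proj₁ y                            ≈⟨ +ᴹ-cong e e′ ⟩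
            (proj₁ x′ +ᴹ ⟦ f ⟧ a) +ᴹ (proj₁ y′ +ᴹ ⟦ f ⟧ b)  ≈⟨ interchange _ _ _ _ ⟩
            (proj₁ x′ +ᴹ proj₁ y′) +ᴹ (⟦ f ⟧ a +ᴹ ⟦ f ⟧ b)  ≈⟨ +ᴹ-congˡ (f.+ᴹ-homo a b) ⟨
            (proj₁ x′ +ᴹ proj₁ y′) +ᴹ ⟦ f ⟧ (a L.+ᴹ b)      ∎)
      homologyLaws .ModuleLaws.neg-cong {x} {x′} (a , e) = L.-ᴹ a , (begin
            -ᴹ proj₁ x                                    ≈⟨ -ᴹ‿cong e ⟩
            -ᴹ (proj₁ x′ +ᴹ ⟦ f ⟧ a)                      ≈⟨ ⁻¹-∙-comm _ _ ⟨
            -ᴹ proj₁ x′ +ᴹ -ᴹ ⟦ f ⟧ a                     ≈⟨ +ᴹ-congˡ (f.-ᴹ-homo a) ⟨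
            -ᴹ proj₁ x′ +ᴹ ⟦ f ⟧ (L.-ᴹ a)                 ∎)
      homologyLaws .ModuleLaws.act-cong {r} {r′} {x} {x′} er (a , e) = r L.*ₗ a , (begin
            r *ₗ proj₁ x                                  ≈⟨ *ₗ-congˡ e ⟩
            r *ₗ (proj₁ x′ +ᴹ ⟦ f ⟧ a)                    ≈⟨ *ₗ-distribˡ _ _ _ ⟩
            r *ₗ proj₁ x′ +ᴹ r *ₗ ⟦ f ⟧ a                 ≈⟨ +ᴹ-cong (*ₗ-congʳ er) (≈ᴹ-sym (f.*ₗ-homo r a)) ⟩
            r′ *ₗ proj₁ x′ +ᴹ ⟦ f ⟧ (r L.*ₗ a)            ∎)
      homologyLaws .ModuleLaws.add-assoc = λ x y z → fromEq (+ᴹ-assoc _ _ _)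
      homologyLaws .ModuleLaws.add-comm = λ x y → fromEq (+ᴹ-comm _ _)
      homologyLaws .ModuleLaws.add-nil = λ x → fromEq (+ᴹ-identityˡ _)
      homologyLaws .ModuleLaws.add-neg = λ x → fromEq (-ᴹ‿inverseˡ _)
      homologyLaws .ModuleLaws.act-add = λ r x y → fromEq (*ₗ-distribˡ r _ _)
      homologyLaws .ModuleLaws.add-act = λ x r s → fromEq (*ₗ-distribʳ _ r s)
      homologyLaws .ModuleLaws.act-assoc = λ r s x → fromEq (*ₗ-assoc r s _)
      homologyLaws .ModuleLaws.act-1 = λ x → fromEq (*ₗ-identityˡ _)

    -- ker g / (im f ∩ ker g); only used when g ⊚ f vanishes.
    homology : Mod
    homology = mkModule homologyOps homologyLaws

    class : Submodule.asModule (kernel g) ⟶ homology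
    class = mkHom id fromEq (λ _ _ → fromEq ≈ᴹ-refl) (λ _ _ → fromEq ≈ᴹ-refl)

  homology-FG : {L M N : Mod} (f : L ⟶ M) (g : M ⟶ N) → let open Module M in
    {n : ℕ} (z : Fin n → ∣ M ∣) → (∀ i → z i ∈ kernel g) →
    (∀ {x} → x ∈ kernel g → ∃ λ y → Span M z y × ∃ λ a → x ≈ᴹ y +ᴹ ⟦ f ⟧ a) →
    FinitelyGenerated (homology f g)
  homology-FG {L} {M} {N} f g z z∈ approx = record { generators = cls ; generates = generated }
    where
    K = Submodule.asModule (kernel g)
    H = homology f g
    cls : Fin _ → ∣ H ∣
    cls i = z i , z∈ i

    inside : ∀ {x} → Span M z x → Σ (x ∈ kernel g) λ q → Span K cls (x , q)
    inside (gen i) = z∈ i , gen i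
    inside zero = Submodule.0∈ (kernel g) , zero
    inside (add p q) = _ , add (proj₂ (inside p)) (proj₂ (inside q))
    inside (mul r p) = _ , mul r (proj₂ (inside p))
    inside (resp e p) = Submodule.∈-resp (kernel g) e (proj₁ (inside p)) , resp e (proj₂ (inside p))

    generated : ∀ x → Span H cls x
    generated (x , x∈) with approx x∈
    ... | y , y∈ , a , e with inside y∈
    ... | q , y∈′ = resp (Module.≈ᴹ-sym H {x , x∈} {y , q} (a , e)) (Span-map (class f g) gen y∈′)

  module _ (M N : Mod) where
    private
      open Module N
      open _⟶_ using (⟦⟧-cong; +ᴹ-homo; *ₗ-homo)
      open AbelianGroupProperties +ᴹ-abelianGroup using (⁻¹-∙-comm; inverseˡ-unique)
      open CommutativeSemigroupProperties (CommutativeMonoid.commutativeSemigroup +ᴹ-commutativeMonoid)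
        using (interchange)
      neg-* : ∀ r x → -ᴹ (r *ₗ x) ≈ᴹ r *ₗ (-ᴹ x)
      neg-* r x = ≈ᴹ-sym (inverseˡ-unique _ _
        (≈ᴹ-trans (≈ᴹ-sym (*ₗ-distribˡ r _ _)) (≈ᴹ-trans (*ₗ-congˡ (-ᴹ‿inverseˡ x)) (*ₗ-zeroʳ r))))

    HomOps : ModuleOps
    HomOps .ModuleOps.Elem = M ⟶ N
    HomOps .ModuleOps.eq = λ f g → ∀ x → ⟦ f ⟧ x ≈ᴹ ⟦ g ⟧ x
    HomOps .ModuleOps.add = λ f g → mkHom (λ x → ⟦ f ⟧ x +ᴹ ⟦ g ⟧ x)
        (λ e → +ᴹ-cong (⟦⟧-cong f e) (⟦⟧-cong g e))
        (λ x y → ≈ᴹ-trans (+ᴹ-cong (+ᴹ-homo f x y) (+ᴹ-homo g x y)) (interchange _ _ _ _))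
        (λ r x → ≈ᴹ-trans (+ᴹ-cong (*ₗ-homo f r x) (*ₗ-homo g r x)) (≈ᴹ-sym (*ₗ-distribˡ r _ _)))
    HomOps .ModuleOps.nil = 0-hom
    HomOps .ModuleOps.neg = λ f → mkHom (λ x → -ᴹ ⟦ f ⟧ x)
        (λ e → -ᴹ‿cong (⟦⟧-cong f e))
        (λ x y → ≈ᴹ-trans (-ᴹ‿cong (+ᴹ-homo f x y)) (≈ᴹ-sym (⁻¹-∙-comm _ _)))
        (λ r x → ≈ᴹ-trans (-ᴹ‿cong (*ₗ-homo f r x)) (neg-* r _))
    HomOps .ModuleOps.act = λ r f → mkHom (λ x → r *ₗ ⟦ f ⟧ x)
        (λ e → *ₗ-congˡ (⟦⟧-cong f e))
        (λ x y → ≈ᴹ-trans (*ₗ-congˡ (+ᴹ-homo f x y)) (*ₗ-distribˡ r _ _))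
        (λ s x → ≈ᴹ-trans (*ₗ-congˡ (*ₗ-homo f s x)) (*ₗ-comm r s _))

    abstract
      HomLaws : ModuleLaws HomOps
      HomLaws .ModuleLaws.equiv = record
        { refl = λ _ → ≈ᴹ-refl
        ; sym = λ e x → ≈ᴹ-sym (e x)
        ; trans = λ e e′ x → ≈ᴹ-trans (e x) (e′ x) }
      HomLaws .ModuleLaws.add-cong = λ e e′ x → +ᴹ-cong (e x) (e′ x)
      HomLaws .ModuleLaws.neg-cong = λ e x → -ᴹ‿cong (e x)
      HomLaws .ModuleLaws.act-cong = λ er e x → *ₗ-cong er (e x)
      HomLaws .ModuleLaws.add-assoc = λ f g h x → +ᴹ-assoc _ _ _
      HomLaws .ModuleLaws.add-comm = λ f g x → +ᴹ-comm _ _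
      HomLaws .ModuleLaws.add-nil = λ f x → +ᴹ-identityˡ _
      HomLaws .ModuleLaws.add-neg = λ f x → -ᴹ‿inverseˡ _
      HomLaws .ModuleLaws.act-add = λ r f g x → *ₗ-distribˡ r _ _
      HomLaws .ModuleLaws.add-act = λ f r s x → *ₗ-distribʳ _ r s
      HomLaws .ModuleLaws.act-assoc = λ r s f x → *ₗ-assoc r s _
      HomLaws .ModuleLaws.act-1 = λ f x → *ₗ-identityˡ _

    Hom : Mod
    Hom = mkModule HomOps HomLaws

  precompose : {L M : Mod} → L ⟶ M → (N : Mod) → Hom M N ⟶ Hom L N
  precompose {L} {M} f N = mkHom (_⊚ f) (λ e x → e (⟦ f ⟧ x)) (λ _ _ _ → ≈ᴹ-refl) (λ _ _ _ → ≈ᴹ-refl)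
    where open Module N

  -- The free module on the bare set X: formal linear combinations modulo the
  -- module axioms.  No equality on X is imposed, which is what makes it
  -- projective for setoid surjections.
  module _ (X : Set ℓ) where

    data Term : Set ℓ where
      η    : X → Term
      _⊕_  : Term → Term → Term
      𝟎    : Term
      ⊖_   : Term → Term
      _•_  : Carrier → Term → Term

    data _∼_ : Term → Term → Set ℓ where
      refl    : ∀ {t} → t ∼ t
      sym     : ∀ {t u} → t ∼ u → u ∼ t
      trans   : ∀ {t u v} → t ∼ u → u ∼ v → t ∼ v
      ⊕-cong  : ∀ {t t′ u u′} → t ∼ t′ → u ∼ u′ → (t ⊕ u) ∼ (t′ ⊕ u′)
      ⊖-cong  : ∀ {t t′} → t ∼ t′ → (⊖ t) ∼ (⊖ t′)
      •-cong  : ∀ {r r′ t t′} → r ≈ r′ → t ∼ t′ → (r • t) ∼ (r′ • t′)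
      ⊕-assoc : ∀ t u v → ((t ⊕ u) ⊕ v) ∼ (t ⊕ (u ⊕ v))
      ⊕-comm  : ∀ t u → (t ⊕ u) ∼ (u ⊕ t)
      ⊕-idˡ   : ∀ t → (𝟎 ⊕ t) ∼ t
      ⊖-invˡ  : ∀ t → ((⊖ t) ⊕ t) ∼ 𝟎
      •-distˡ : ∀ r t u → (r • (t ⊕ u)) ∼ ((r • t) ⊕ (r • u))
      •-distʳ : ∀ t r s → ((r + s) • t) ∼ ((r • t) ⊕ (s • t))
      •-assoc : ∀ r s t → ((r * s) • t) ∼ (r • (s • t))
      •-id    : ∀ t → (1# • t) ∼ t

    FreeOps : ModuleOps
    FreeOps .ModuleOps.Elem = Term
    FreeOps .ModuleOps.eq = _∼_
    FreeOps .ModuleOps.add = _⊕_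
    FreeOps .ModuleOps.nil = 𝟎
    FreeOps .ModuleOps.neg = ⊖_
    FreeOps .ModuleOps.act = _•_

    abstract
      FreeLaws : ModuleLaws FreeOps
      FreeLaws .ModuleLaws.equiv = record { refl = refl ; sym = sym ; trans = trans }
      FreeLaws .ModuleLaws.add-cong = ⊕-cong
      FreeLaws .ModuleLaws.neg-cong = ⊖-cong
      FreeLaws .ModuleLaws.act-cong = •-cong
      FreeLaws .ModuleLaws.add-assoc = ⊕-assoc
      FreeLaws .ModuleLaws.add-comm = ⊕-comm
      FreeLaws .ModuleLaws.add-nil = ⊕-idˡ
      FreeLaws .ModuleLaws.add-neg = ⊖-invˡ
      FreeLaws .ModuleLaws.act-add = •-distˡ
      FreeLaws .ModuleLaws.add-act = •-distʳ
      FreeLaws .ModuleLaws.act-assoc = •-assoc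
      FreeLaws .ModuleLaws.act-1 = •-id

    Free : Mod
    Free = mkModule FreeOps FreeLaws

  module _ {X : Set ℓ} {M : Mod} (f : X → ∣ M ∣) where
    open Module M

    private
      ev : Term X → ∣ M ∣
      ev (η x)   = f x
      ev (t ⊕ u) = ev t +ᴹ ev u
      ev 𝟎       = 0ᴹ
      ev (⊖ t)   = -ᴹ ev t
      ev (r • t) = r *ₗ ev t

      ev-cong : ∀ {t u} → _∼_ X t u → ev t ≈ᴹ ev u
      ev-cong refl = ≈ᴹ-refl
      ev-cong (sym e) = ≈ᴹ-sym (ev-cong e)
      ev-cong (trans e e′) = ≈ᴹ-trans (ev-cong e) (ev-cong e′)
      ev-cong (⊕-cong e e′) = +ᴹ-cong (ev-cong e) (ev-cong e′)
      ev-cong (⊖-cong e) = -ᴹ‿cong (ev-cong e)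
      ev-cong (•-cong er e) = *ₗ-cong er (ev-cong e)
      ev-cong (⊕-assoc t u v) = +ᴹ-assoc _ _ _
      ev-cong (⊕-comm t u) = +ᴹ-comm _ _
      ev-cong (⊕-idˡ t) = +ᴹ-identityˡ _
      ev-cong (⊖-invˡ t) = -ᴹ‿inverseˡ _
      ev-cong (•-distˡ r t u) = *ₗ-distribˡ _ _ _
      ev-cong (•-distʳ t r s) = *ₗ-distribʳ _ _ _
      ev-cong (•-assoc r s t) = *ₗ-assoc _ _ _
      ev-cong (•-id t) = *ₗ-identityˡ _

    lift : Free X ⟶ M
    lift = mkHom ev ev-cong (λ _ _ → ≈ᴹ-refl) (λ _ _ → ≈ᴹ-refl)

  lift-unique : {X : Set ℓ} {M : Mod} (f g : Free X ⟶ M) →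
                (∀ x → Module._≈ᴹ_ M (⟦ f ⟧ (η x)) (⟦ g ⟧ (η x))) →
                ∀ t → Module._≈ᴹ_ M (⟦ f ⟧ t) (⟦ g ⟧ t)
  lift-unique {M = M} f g e = go
    where
    open Module M
    module f = _⟶_ f
    module g = _⟶_ g
    go : ∀ t → ⟦ f ⟧ t ≈ᴹ ⟦ g ⟧ t
    go (η x) = e x
    go (t ⊕ u) = ≈ᴹ-trans (f.+ᴹ-homo t u) (≈ᴹ-trans (+ᴹ-cong (go t) (go u)) (≈ᴹ-sym (g.+ᴹ-homo t u)))
    go 𝟎 = ≈ᴹ-trans f.0ᴹ-homo (≈ᴹ-sym g.0ᴹ-homo)
    go (⊖ t) = ≈ᴹ-trans (f.-ᴹ-homo t) (≈ᴹ-trans (-ᴹ‿cong (go t)) (≈ᴹ-sym (g.-ᴹ-homo t)))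
    go (r • t) = ≈ᴹ-trans (f.*ₗ-homo r t) (≈ᴹ-trans (*ₗ-congˡ (go t)) (≈ᴹ-sym (g.*ₗ-homo r t)))

  Free-projective : (X : Set ℓ) → IsProjective (Free X)
  Free-projective X {M} {N} g surj f = h ,
    lift-unique (g ⊚ h) f (λ x → proj₂ (surj (⟦ f ⟧ (η x))))
    where
    h : Free X ⟶ M
    h = lift (λ x → proj₁ (surj (⟦ f ⟧ (η x))))

  record ProjectiveResolution (M : Mod) : Set (lsuc ℓ) where
    field
      P          : ℕ → Mod
      projective : ∀ n → IsProjective (P n)
      d          : ∀ n → P (suc n) ⟶ P n
      ε          : P 0 ⟶ M
      ε-surj     : IsSurjective ε
      exact-ε    : IsExact (d 0) ε
      exact-d    : ∀ n → IsExact (d (suc n)) (d n)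

  ProjDim≤ : ℕ → Mod → Set (lsuc ℓ)
  ProjDim≤ n M = Σ (ProjectiveResolution M) λ P• →
    ∀ i → n < i → IsZero (ProjectiveResolution.P P• i)

  module _ {M : Mod} (P• : ProjectiveResolution M) (N : Mod) where
    open ProjectiveResolution P•

    private
      -- Cⁱ⁻¹, with C⁻¹ = 0.
      predecessor : ℕ → Mod
      predecessor zero    = ⟨0⟩
      predecessor (suc i) = Hom (P i) N

    -- The differentials of 0 → Hom(P₀,N) → Hom(P₁,N) → …
    δ : ∀ i → predecessor i ⟶ Hom (P i) N
    δ zero    = 0-hom {⟨0⟩} {Hom (P 0) N}
    δ (suc i) = precompose {P (suc i)} {P i} (d i) N

    ExtVia : ℕ → Mod
    ExtVia i = homology {predecessor i} {Hom (P i) N} {Hom (P (suc i)) N} (δ i) (δ (suc i))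

    ExtVia-FG : ∀ i → let open Module (Hom (P i) N) in {n : ℕ} (z : Fin n → ∣ Hom (P i) N ∣) →
      (∀ j → z j ∈ kernel (δ (suc i))) →
      (∀ {x} → x ∈ kernel (δ (suc i)) →
        ∃ λ y → Span (Hom (P i) N) z y × ∃ λ a → x ≈ᴹ y +ᴹ ⟦ δ i ⟧ a) →
      FinitelyGenerated (ExtVia i)
    ExtVia-FG i = homology-FG {predecessor i} {Hom (P i) N} {Hom (P (suc i)) N} (δ i) (δ (suc i))

  -- P₀ is free on (the underlying set of) M, and Pₙ₊₁ is free on the kernel
  -- of the map out of Pₙ.
  module _ (M : Mod) where

    private
      record Stage : Set (lsuc ℓ) where
        constructor stage
        field
          basis    : Set ℓ
          target   : Mod
          boundary : Free basis ⟶ target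

      open Stage

      cover : (A : Mod) {B : Mod} (f : A ⟶ B) → Free ∣ Submodule.asModule (kernel f) ∣ ⟶ A
      cover A f = lift proj₁

      stages : ℕ → Stage
      stages zero = stage ∣ M ∣ M (lift id)
      stages (suc n) = stage _ (Free (basis (stages n))) (cover _ (boundary (stages n)))

      cover-exact : {A B : Mod} (f : A ⟶ B) → IsExact (cover A f) f
      cover-exact {A} f =
        lift-unique (f ⊚ cover A f) 0-hom proj₂ ,
        λ y p → η (y , p) , Module.≈ᴹ-refl A

    standardResolution : ProjectiveResolution M
    standardResolution = record
      { P = λ n → Free (basis (stages n))
      ; projective = λ n → Free-projective (basis (stages n))
      ; d = λ n → boundary (stages (suc n))
      ; ε = boundary (stages 0)
      ; ε-surj = λ x → η x , Module.≈ᴹ-refl M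
      ; exact-ε = cover-exact (boundary (stages 0))
      ; exact-d = λ n → cover-exact (boundary (stages (suc n))) }

  Ext : ℕ → Mod → Mod → Mod
  Ext i M N = ExtVia (standardResolution M) N i

  infix 25 _∩_
  _∩_ : {M : Mod} → Submodule M → Submodule M → Submodule M
  N ∩ N′ = record
    { member = λ x → x ∈ N × x ∈ N′
    ; ∈-resp = λ e (p , p′) → N.∈-resp e p , N′.∈-resp e p′
    ; 0∈ = N.0∈ , N′.0∈
    ; +∈ = λ (p , p′) (q , q′) → N.+∈ p q , N′.+∈ p′ q′
    ; *∈ = λ r (p , p′) → N.*∈ r p , N′.*∈ r p′ }
    where
    module N = Submodule N
    module N′ = Submodule N′

  module _ {M : Mod} where
    open Module M

    private
      reindex : ∀ {a b} (u : Fin a → ∣ M ∣) (v : Fin b → ∣ M ∣) →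
                Fin (a ℕ.+ b) → ∣ M ∣
      reindex {a} u v i = [ u , v ]′ (splitAt a i)

      reindex-inj : ∀ {a b} (u : Fin a → ∣ M ∣) (v : Fin b → ∣ M ∣) (i : Fin a ⊎ Fin b) →
                    Span M (reindex u v) ([ u , v ]′ i)
      reindex-inj {a} {b} u v i = ≡.subst (λ j → Span M (reindex u v) ([ u , v ]′ j))
        (splitAt-join a b i) (gen (join a b i))

      reindex-∈ : ∀ {a b} (u : Fin a → ∣ M ∣) (v : Fin b → ∣ M ∣) (N : Submodule M) →
                  (∀ i → u i ∈ N) → (∀ j → v j ∈ N) → ∀ i → reindex u v i ∈ N
      reindex-∈ {a} u v N p q i with splitAt a i
      ... | inj₁ j = p j
      ... | inj₂ j = q j

      Spanˡ : ∀ {a b} (u : Fin a → ∣ M ∣) (v : Fin b → ∣ M ∣) {x} → Span M u x → Span M (reindex u v) x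
      Spanˡ u v = Span⊆ (finSpan M (reindex u v)) (reindex-inj u v ∘ inj₁)

      Spanʳ : ∀ {a b} (u : Fin a → ∣ M ∣) (v : Fin b → ∣ M ∣) {x} → Span M v x → Span M (reindex u v) x
      Spanʳ u v = Span⊆ (finSpan M (reindex u v)) (reindex-inj u v ∘ inj₂)

      w+[x-w] : ∀ w x → w +ᴹ (x +ᴹ -ᴹ w) ≈ᴹ x
      w+[x-w] w x = ≈ᴹ-trans (≈ᴹ-sym (+ᴹ-assoc w x (-ᴹ w))) (xyx⁻¹≈y w x)
        where open AbelianGroupProperties +ᴹ-abelianGroup using (xyx⁻¹≈y)

      [a+m]-[a+m′] : ∀ a m m′ → (a +ᴹ m) +ᴹ -ᴹ (a +ᴹ m′) ≈ᴹ m +ᴹ -ᴹ m′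
      [a+m]-[a+m′] a m m′ = begin
        (a +ᴹ m) +ᴹ -ᴹ (a +ᴹ m′)          ≈⟨ +ᴹ-congˡ (⁻¹-∙-comm a m′) ⟨
        (a +ᴹ m) +ᴹ (-ᴹ a +ᴹ -ᴹ m′)       ≈⟨ interchange a m _ _ ⟩
        (a +ᴹ -ᴹ a) +ᴹ (m +ᴹ -ᴹ m′)       ≈⟨ +ᴹ-congʳ (-ᴹ‿inverseʳ a) ⟩
        0ᴹ +ᴹ (m +ᴹ -ᴹ m′)                ≈⟨ +ᴹ-identityˡ _ ⟩
        m +ᴹ -ᴹ m′                        ∎
        where
        open SetoidReasoning ≈ᴹ-setoid
        open AbelianGroupProperties +ᴹ-abelianGroup using (⁻¹-∙-comm)
        open CommutativeSemigroupProperties (CommutativeMonoid.commutativeSemigroup +ᴹ-commutativeMonoid)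
          using (interchange)

      -- The coefficients of a occurring in elements of N.
      leading : ∣ M ∣ → Submodule M → Submodule M → Ideal
      leading a T N = record
        { member = λ r → ∃ λ m → m ∈ T × r *ₗ a +ᴹ m ∈ N
        ; ∈-resp = λ e (m , p , q) → m , p , N.∈-resp (+ᴹ-congʳ (*ₗ-congʳ e)) q
        ; 0∈ = 0ᴹ , T.0∈ , N.∈-resp
            (≈ᴹ-sym (≈ᴹ-trans (+ᴹ-identityʳ _) (*ₗ-zeroˡ a))) N.0∈
        ; +∈ = λ (m , p , q) (m′ , p′ , q′) → m +ᴹ m′ , T.+∈ p p′ , N.∈-resp
            (≈ᴹ-trans (interchange _ m _ m′) (+ᴹ-congʳ (≈ᴹ-sym (*ₗ-distribʳ a _ _)))) (N.+∈ q q′)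
        ; *∈ = λ r (m , p , q) → r *ₗ m , T.*∈ r p , N.∈-resp
            (≈ᴹ-trans (*ₗ-distribˡ r _ m) (+ᴹ-congʳ (≈ᴹ-sym (*ₗ-assoc r _ a)))) (N.*∈ r q) }
        where
        module T = Submodule T
        module N = Submodule N
        open CommutativeSemigroupProperties (CommutativeMonoid.commutativeSemigroup +ᴹ-commutativeMonoid)
          using (interchange)

    noetherian⇒FG : IsNoetherian → ∀ n (g : Fin n → ∣ M ∣) (N : Submodule M) →
                    (∀ {x} → x ∈ N → Span M g x) → FG N
    noetherian⇒FG noeth zero g N h = record
      { size = 0 ; generators = g ; contained = λ () ; generates = h }
    noetherian⇒FG noeth (suc n) g N h = record
      { generators = reindex u Z.generators
      ; contained = reindex-∈ u Z.generators N (λ i → proj₂ (proj₂ (I.contained i)))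
          (λ j → proj₁ (Z.contained j))
      ; generates = generates }
      where
      a = g zero
      T = finSpan M (g ∘ suc)
      module T = Submodule T
      module N = Submodule N
      module I = FG (noeth (leading a T N))
      u : Fin I.size → ∣ M ∣
      u i = I.generators i *ₗ a +ᴹ proj₁ (I.contained i)
      module Z = FG (noetherian⇒FG noeth n (g ∘ suc) (N ∩ T) proj₂)

      decompose : ∀ {x} → Span M g x → ∃ λ r → ∃ λ m → m ∈ T × x ≈ᴹ r *ₗ a +ᴹ m
      decompose (gen zero) = 1# , 0ᴹ , zero ,
        ≈ᴹ-sym (≈ᴹ-trans (+ᴹ-identityʳ _) (*ₗ-identityˡ a))
      decompose (gen (suc i)) = 0# , _ , gen i ,
        ≈ᴹ-sym (≈ᴹ-trans (+ᴹ-congʳ (*ₗ-zeroˡ a)) (+ᴹ-identityˡ _))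
      decompose zero = 0# , 0ᴹ , zero ,
        ≈ᴹ-sym (≈ᴹ-trans (+ᴹ-congʳ (*ₗ-zeroˡ a)) (+ᴹ-identityˡ _))
      decompose (add p q) with decompose p | decompose q
      ... | r , m , t , e | r′ , m′ , t′ , e′ = r + r′ , m +ᴹ m′ , add t t′ ,
        ≈ᴹ-trans (+ᴹ-cong e e′) (≈ᴹ-trans (interchange _ m _ m′) (+ᴹ-congʳ (≈ᴹ-sym (*ₗ-distribʳ a _ _))))
        where
        open CommutativeSemigroupProperties (CommutativeMonoid.commutativeSemigroup +ᴹ-commutativeMonoid)
          using (interchange)
      decompose (mul s p) with decompose p
      ... | r , m , t , e = s * r , s *ₗ m , mul s t ,
        ≈ᴹ-trans (*ₗ-congˡ e) (≈ᴹ-trans (*ₗ-distribˡ s _ m) (+ᴹ-congʳ (≈ᴹ-sym (*ₗ-assoc s r a))))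
      decompose (resp e p) with decompose p
      ... | r , m , t , e′ = r , m , t , ≈ᴹ-trans (≈ᴹ-sym e) e′

      generates : ∀ {x} → x ∈ N → Span M (reindex u Z.generators) x
      generates {x} x∈N with decompose (h x∈N)
      ... | r , m , m∈T , e
        with Span⊆ (leading a T (finSpan M u)) (λ i → _ , proj₁ (proj₂ (I.contained i)) , gen i)
               (I.generates (m , m∈T , N.∈-resp e x∈N))
      ... | m′ , m′∈T , y∈ = resp (w+[x-w] y x)
              (add (Spanˡ u Z.generators y∈) (Spanʳ u Z.generators (Z.generates (x-y∈N , x-y∈T))))
        where
        y = r *ₗ a +ᴹ m′
        x-y∈N : (x +ᴹ -ᴹ y) ∈ N
        x-y∈N = N.+∈ x∈N (N.-∈ (Span⊆ N (λ i → proj₂ (proj₂ (I.contained i))) y∈))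
        x-y∈T : (x +ᴹ -ᴹ y) ∈ T
        x-y∈T = T.∈-resp (≈ᴹ-sym (≈ᴹ-trans (+ᴹ-congʳ e) ([a+m]-[a+m′] _ m m′)))
          (T.+∈ m∈T (T.-∈ m′∈T))

    -- Up to finitely many linear forms, every submodule is finitely generated.
    formwiseFG : IsNoetherian → ∀ k (φ : Fin k → M ⟶ ⟨R⟩) (N : Submodule M) →
      Σ ℕ λ n → Σ (Fin n → ∣ M ∣) λ z → (∀ i → z i ∈ N) ×
      (∀ {x} → x ∈ N → ∃ λ y → Span M z y × (∀ j → ⟦ φ j ⟧ x ≈ ⟦ φ j ⟧ y))
    formwiseFG noeth zero φ N = 0 , (λ ()) , (λ ()) , λ _ → 0ᴹ , zero , λ ()
    formwiseFG noeth (suc k) φ N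
      with formwiseFG noeth k (φ ∘ suc) (N ∩ kernel (φ zero))
    ... | n , z , z∈ , approx = _ , reindex w z , reindex-∈ w z N w∈ (proj₁ ∘ z∈) , result
      where
      module N = Submodule N
      module I = FG (noeth (map (φ zero) N))
      module φ₀ = _⟶_ (φ zero)
      w : Fin I.size → ∣ M ∣
      w i = proj₁ (I.contained i)
      w∈ : ∀ i → w i ∈ N
      w∈ i = proj₁ (proj₂ (I.contained i))

      result : ∀ {x} → x ∈ N →
               ∃ λ y → Span M (reindex w z) y × (∀ j → ⟦ φ j ⟧ x ≈ ⟦ φ j ⟧ y)
      result {x} x∈N
        with Span⊆ (map (φ zero) (finSpan M w)) (λ i → w i , gen i , proj₂ (proj₂ (I.contained i)))
               (I.generates (x , x∈N , R.refl))
      ... | v , v∈ , φ₀v≈φ₀x with approx (x-v∈N , x-v∈ker)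
        where
        x-v∈N : (x +ᴹ -ᴹ v) ∈ N
        x-v∈N = N.+∈ x∈N (N.-∈ (Span⊆ N w∈ v∈))
        x-v∈ker : ⟦ φ zero ⟧ (x +ᴹ -ᴹ v) ≈ 0#
        x-v∈ker = R.trans (φ₀.+ᴹ-homo x (-ᴹ v)) (R.trans
          (R.+-cong (R.sym φ₀v≈φ₀x) (φ₀.-ᴹ-homo v)) (R.-‿inverseʳ _))
      ... | y , y∈ , agree = v +ᴹ y , add (Spanˡ w z v∈) (Spanʳ w z y∈) , forms
        where
        forms : ∀ j → ⟦ φ j ⟧ x ≈ ⟦ φ j ⟧ (v +ᴹ y)
        forms zero = R.sym (R.trans (φ₀.+ᴹ-homo v y) (R.trans
          (R.+-cong φ₀v≈φ₀x (proj₂ (Span⊆ (N ∩ kernel (φ zero)) z∈ y∈))) (R.+-identityʳ _)))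
        forms (suc j) = begin
          ⟦ φ (suc j) ⟧ x                                    ≈⟨ φⱼ.⟦⟧-cong (w+[x-w] v x) ⟨
          ⟦ φ (suc j) ⟧ (v +ᴹ (x +ᴹ -ᴹ v))                   ≈⟨ φⱼ.+ᴹ-homo v _ ⟩
          ⟦ φ (suc j) ⟧ v + ⟦ φ (suc j) ⟧ (x +ᴹ -ᴹ v)        ≈⟨ R.+-congˡ (agree j) ⟩
          ⟦ φ (suc j) ⟧ v + ⟦ φ (suc j) ⟧ y                  ≈⟨ φⱼ.+ᴹ-homo v y ⟨
          ⟦ φ (suc j) ⟧ (v +ᴹ y)                             ∎
          where
          module φⱼ = _⟶_ (φ (suc j))
          open SetoidReasoning R.setoid

  infix 9 _⋆
  _⋆ : Mod → Mod
  M ⋆ = Ext 1 M ⟨R⟩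

  module _ (noeth : IsNoetherian) (M : Mod) (fg : FinitelyGenerated M) where
    private
      open FinitelyGenerated fg
      module M = Module M
      open ProjectiveResolution (standardResolution M) using (P; d; ε; exact-ε)
      module P₀ = Module (P 0)
      module P₁ = Module (P 1)
      module d₀ = _⟶_ (d 0)

      A : Mod
      A = Free (Lift ℓ (Fin size))

      basis : Fin size → ∣ A ∣
      basis i = η (Level.lift i)

      γ : A ⟶ M
      γ = lift (generators ∘ lower)

      G : A ⟶ P 0
      G = lift (η ∘ generators ∘ lower)

      ε-G : ∀ t → ⟦ ε ⟧ (⟦ G ⟧ t) M.≈ᴹ ⟦ γ ⟧ t
      ε-G = lift-unique (ε ⊚ G) γ (λ _ → M.≈ᴹ-refl)

      coefficients : ∀ x → ∃ λ t → ⟦ γ ⟧ t M.≈ᴹ x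
      coefficients x = Span⊆ (image γ) (λ i → basis i , M.≈ᴹ-refl) (generates x)

      c : P 0 ⟶ A
      c = lift (proj₁ ∘ coefficients)

      γ-c : ∀ t → ⟦ γ ⟧ (⟦ c ⟧ t) M.≈ᴹ ⟦ ε ⟧ t
      γ-c = lift-unique (γ ⊚ c) ε (proj₂ ∘ coefficients)

      A-span : ∀ t → Span A basis t
      A-span (η (Level.lift i)) = gen i
      A-span (t ⊕ u) = add (A-span t) (A-span u)
      A-span 𝟎 = zero
      A-span (⊖ t) = Submodule.-∈ (finSpan A basis) (A-span t)
      A-span (r • t) = mul r (A-span t)

      module L = FG (noetherian⇒FG noeth size basis (kernel γ) (λ {t} _ → A-span t))

      κ : Fin L.size → ∣ Submodule.asModule (kernel ε) ∣
      κ j = ⟦ G ⟧ (L.generators j) , M.≈ᴹ-trans (ε-G (L.generators j)) (L.contained j)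

      C¹ : Mod
      C¹ = Hom (P 1) ⟨R⟩

      cocycles : Submodule C¹
      cocycles = kernel (δ (standardResolution M) ⟨R⟩ 2)

      evaluate : Fin L.size → C¹ ⟶ ⟨R⟩
      evaluate j = mkHom (λ f → ⟦ f ⟧ (η (κ j))) (λ e → e _) (λ _ _ → R.refl) (λ _ _ → R.refl)

      module _ {ψ : P 1 ⟶ ⟨R⟩} (cocycle : ψ ∈ cocycles) (vanish : ∀ j → ⟦ ψ ⟧ (η (κ j)) ≈ 0#) where
        private
          module ψ = _⟶_ ψ

        ψ-cong : ∀ {u u′} → ⟦ d 0 ⟧ u P₀.≈ᴹ ⟦ d 0 ⟧ u′ → ⟦ ψ ⟧ u ≈ ⟦ ψ ⟧ u′
        ψ-cong {u} {u′} e = x∙y⁻¹≈ε⇒x≈y _ _ (R.trans (R.+-congˡ (R.sym (ψ.-ᴹ-homo u′)))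
          (R.trans (R.sym (ψ.+ᴹ-homo u (P₁.-ᴹ u′))) (cocycle (η (u P₁.+ᴹ P₁.-ᴹ u′ , closed)))))
          where
          open GroupProperties R.+-group using (x∙y⁻¹≈ε⇒x≈y)
          closed : ⟦ d 0 ⟧ (u P₁.+ᴹ P₁.-ᴹ u′) P₀.≈ᴹ P₀.0ᴹ
          closed = P₀.≈ᴹ-trans (d₀.+ᴹ-homo u (P₁.-ᴹ u′)) (P₀.≈ᴹ-trans
            (P₀.+ᴹ-cong e (d₀.-ᴹ-homo u′)) (P₀.-ᴹ‿inverseʳ _))

        residue : ∀ x → ∣ Submodule.asModule (kernel ε) ∣
        residue x = η x ⊕ (⊖ ⟦ G ⟧ (⟦ c ⟧ (η x))) , (begin
          x M.+ᴹ M.-ᴹ ⟦ ε ⟧ (⟦ G ⟧ (⟦ c ⟧ (η x)))  ≈⟨ M.+ᴹ-congˡ (M.-ᴹ‿cong (M.≈ᴹ-trans (ε-G (⟦ c ⟧ (η x))) (γ-c (η x)))) ⟩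
          x M.+ᴹ M.-ᴹ x                            ≈⟨ M.-ᴹ‿inverseʳ x ⟩
          M.0ᴹ                                     ∎)
          where open SetoidReasoning M.≈ᴹ-setoid

        ρ : P 0 ⟶ P 1
        ρ = lift (η ∘ residue)

        d-ρ : ∀ t → ⟦ d 0 ⟧ (⟦ ρ ⟧ t) P₀.+ᴹ ⟦ G ⟧ (⟦ c ⟧ t) P₀.≈ᴹ t
        d-ρ = lift-unique (Module._+ᴹ_ (Hom (P 0) (P 0)) (d 0 ⊚ ρ) (G ⊚ c))
          (mkHom id id (λ _ _ → P₀.≈ᴹ-refl) (λ _ _ → P₀.≈ᴹ-refl))
          (λ x → trans (⊕-assoc _ _ _) (trans (⊕-cong refl (⊖-invˡ _)) (P₀.+ᴹ-identityʳ _)))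

        small : ∀ w → w ∈ kernel γ → ∃ λ v → ⟦ ψ ⟧ v ≈ 0# × ⟦ d 0 ⟧ v P₀.≈ᴹ ⟦ G ⟧ w
        small w w∈ = Span⊆ (preimage G (map (d 0) (kernel ψ)))
          (λ j → η (κ j) , vanish j , P₀.≈ᴹ-refl) (L.generates {w} w∈)

        factors : ∀ u → ⟦ ψ ⟧ u ≈ ⟦ ψ ⟧ (⟦ ρ ⟧ (⟦ d 0 ⟧ u))
        factors u with small (⟦ c ⟧ (⟦ d 0 ⟧ u)) (M.≈ᴹ-trans (γ-c (⟦ d 0 ⟧ u)) (proj₁ exact-ε u))
        ... | v , ψv≈0 , dv = R.trans
          (ψ-cong {u} {⟦ ρ ⟧ (⟦ d 0 ⟧ u) P₁.+ᴹ v} (P₀.≈ᴹ-sym (P₀.≈ᴹ-trans (d₀.+ᴹ-homo (⟦ ρ ⟧ (⟦ d 0 ⟧ u)) v) (P₀.≈ᴹ-trans (P₀.+ᴹ-congˡ dv) (d-ρ (⟦ d 0 ⟧ u))))))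
          (R.trans (ψ.+ᴹ-homo (⟦ ρ ⟧ (⟦ d 0 ⟧ u)) v) (R.trans (R.+-congˡ ψv≈0) (R.+-identityʳ _)))

      C¹-lemma : ∀ {n} {z : Fin n → ∣ C¹ ∣} → (∀ i → z i ∈ cocycles) → ∀ f → f ∈ cocycles →
        (∃ λ g → Span C¹ z g × (∀ j → ⟦ evaluate j ⟧ f ≈ ⟦ evaluate j ⟧ g)) →
        ∃ λ g → Span C¹ z g × ∃ λ h → ∀ u → ⟦ f ⟧ u ≈ ⟦ g ⟧ u + ⟦ h ⟧ (⟦ d 0 ⟧ u)
      C¹-lemma z∈ f f∈ (g , g∈ , agree) = g , g∈ , ψ ⊚ ρ {ψ} ψ∈ vanish , cohomologous
        where
        module C¹ = Module C¹
        module cocycles = Submodule cocycles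
        ψ : P 1 ⟶ ⟨R⟩
        ψ = f C¹.+ᴹ C¹.-ᴹ g
        ψ∈ : ψ ∈ cocycles
        ψ∈ = cocycles.+∈ {f} {C¹.-ᴹ g} f∈ (cocycles.-∈ {g} (Span⊆ cocycles z∈ g∈))
        vanish : ∀ j → ⟦ ψ ⟧ (η (κ j)) ≈ 0#
        vanish j = R.trans (R.+-congʳ (agree j)) (R.-‿inverseʳ _)
        cohomologous : ∀ u → ⟦ f ⟧ u ≈ ⟦ g ⟧ u + ⟦ ψ ⟧ (⟦ ρ {ψ} ψ∈ vanish ⟧ (⟦ d 0 ⟧ u))
        cohomologous u = R.sym (R.trans
          (R.+-congˡ (R.sym (factors {ψ} ψ∈ vanish u)))
          (R.trans (R.sym (R.+-assoc _ _ _)) (xyx⁻¹≈y _ _)))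
          where open AbelianGroupProperties R.+-abelianGroup using (xyx⁻¹≈y)

      z : Σ ℕ λ n → Σ (Fin n → ∣ C¹ ∣) λ z → (∀ i → z i ∈ cocycles) ×
          (∀ {f} → f ∈ cocycles → ∃ λ g → Span C¹ z g × (∀ j → ⟦ evaluate j ⟧ f ≈ ⟦ evaluate j ⟧ g))
      z = formwiseFG noeth L.size evaluate cocycles

      approx : ∀ {f} → f ∈ cocycles →
        ∃ λ g → Span C¹ (proj₁ (proj₂ z)) g × ∃ λ h → ∀ u → ⟦ f ⟧ u ≈ ⟦ g ⟧ u + ⟦ h ⟧ (⟦ d 0 ⟧ u)
      approx {f} f∈ = C¹-lemma (proj₁ (proj₂ (proj₂ z))) f f∈ (proj₂ (proj₂ (proj₂ z)) {f} f∈)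

    ⋆-FG : FinitelyGenerated (M ⋆)
    ⋆-FG = ExtVia-FG (standardResolution M) ⟨R⟩ 1
      (proj₁ (proj₂ z)) (proj₁ (proj₂ (proj₂ z))) (λ {f} → approx {f})

  HasExtBound : Set (lsuc ℓ)
  HasExtBound = Σ ℤ λ d → (M : Mod) → FinitelyGenerated M →
    ∀ i → d ℤ.< ℤ.+ i → IsZero (Ext i M ⟨R⟩)

  module _ where
    open Sum R.+-monoid using (sum)
    open SemiringDefinitions (Semiring.rawSemiring R.semiring) using (_^_)

    det : ∀ {n} → (Fin n → Fin n → Carrier) → Carrier
    det {zero}  a = 1#
    det {suc n} a = sum λ j → (R.- 1#) ^ toℕ j * a zero j * det λ i k → a (suc i) (punchIn j k)

  Relations : {M : Mod} → FinitelyGenerated M → Set ℓ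
  Relations {M} fg = Σ (Fin size → Fin size → Carrier) λ a → ∀ i → sum (λ j → a i j *ₗ generators j) ≈ᴹ 0ᴹ
    where
    open Module M
    open FinitelyGenerated fg
    open Sum +ᴹ-monoid using (sum)

  -- The maximal minors of the presentation R^(J) → Rⁿ → M → 0 in which J
  -- consists of all relations between the given n generators.
  fittingIdeal : {M : Mod} → FinitelyGenerated M → Ideal
  fittingIdeal fg = span ⟨R⟩ {Relations fg} (λ (a , _) → det a)

  record MultiplicativeSet : Set (lsuc ℓ) where
    field
      member : Carrier → Set ℓ
      ∈-resp : ∀ {r s} → r ≈ s → member r → member s
      1∈     : member 1#
      *-∈    : ∀ {r s} → member r → member s → member (r * s)

  IsNonZeroDivisor : Carrier → Set ℓ
  IsNonZeroDivisor s = ∀ r → s * r ≈ 0# → r ≈ 0#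

  ConsistsOfNonZeroDivisors : MultiplicativeSet → Set ℓ
  ConsistsOfNonZeroDivisors S = ∀ s → MultiplicativeSet.member S s → IsNonZeroDivisor s

  module Localisation (S : MultiplicativeSet) where
    open MultiplicativeSet S using (1∈; *-∈)

    infix 4 _∈S
    _∈S : Carrier → Set ℓ
    _∈S = MultiplicativeSet.member S

    IsTorsion : Mod → Set ℓ
    IsTorsion M = ∀ x → ∃ λ s → s ∈S × s *ₗ x ≈ᴹ 0ᴹ where open Module M

    infix 8 _/_[_]
    record Fraction : Set ℓ where
      constructor _/_[_]
      field
        num   : Carrier
        den   : Carrier
        den∈S : den ∈S

    infix 4 _≃_
    record _≃_ (x y : Fraction) : Set ℓ where
      constructor cross
      private
        module x = Fraction x
        module y = Fraction y
      field
        factor   : Carrier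
        factor∈S : factor ∈S
        equal    : factor * (x.num * y.den) ≈ factor * (y.num * x.den)

    private
      open import Algebra.Solver.Ring.NaturalCoefficients.Default R.commutativeSemiring
        using (solve; _:=_; _:+_; _:*_; con)

      strict : ∀ {x y} → Fraction.num x * Fraction.den y ≈ Fraction.num y * Fraction.den x → x ≃ y
      strict e = cross 1# 1∈ (R.*-congˡ e)

      ≃-refl : ∀ {x} → x ≃ x
      ≃-refl = strict R.refl

      ≃-trans : ∀ {x y z} → x ≃ y → y ≃ z → x ≃ z
      ≃-trans {a / s [ _ ]} {b / t [ t∈ ]} {c / w [ _ ]} (cross u u∈ e) (cross v v∈ f) =
        cross (u * v * t) (*-∈ (*-∈ u∈ v∈) t∈) (begin
          u * v * t * (a * w)      ≈⟨ solve 5 (λ u v t a w →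
                                      u :* v :* t :* (a :* w) := u :* (a :* t) :* (v :* w)) R.refl u v t a w ⟩
          u * (a * t) * (v * w)    ≈⟨ R.*-congʳ e ⟩
          u * (b * s) * (v * w)    ≈⟨ solve 5 (λ u v b s w →
                                      u :* (b :* s) :* (v :* w) := v :* (b :* w) :* (u :* s)) R.refl u v b s w ⟩
          v * (b * w) * (u * s)    ≈⟨ R.*-congʳ f ⟩
          v * (c * t) * (u * s)    ≈⟨ solve 5 (λ u v t c s →
                                      v :* (c :* t) :* (u :* s) := u :* v :* t :* (c :* s)) R.refl u v t c s ⟩
          u * v * t * (c * s)      ∎)
        where open SetoidReasoning R.setoid

      ≃-equiv : IsEquivalence _≃_
      ≃-equiv = record
        { refl = ≃-refl
        ; sym = λ (cross u u∈ e) → cross u u∈ (R.sym e)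
        ; trans = ≃-trans }

    infixl 6 _+ᶠ_
    infixl 7 _*ᶠ_
    infix 8 -ᶠ_
    _+ᶠ_ _*ᶠ_ : Fraction → Fraction → Fraction
    a / s [ s∈ ] +ᶠ b / t [ t∈ ] = (a * t + b * s) / s * t [ *-∈ s∈ t∈ ]
    a / s [ s∈ ] *ᶠ b / t [ t∈ ] = (a * b) / s * t [ *-∈ s∈ t∈ ]

    -ᶠ_ : Fraction → Fraction
    -ᶠ (a / s [ s∈ ]) = (R.- a) / s [ s∈ ]

    fromR : Carrier → Fraction
    fromR r = r / 1# [ 1∈ ]

    private
      +ᶠ-cong : ∀ {x x′ y y′} → x ≃ x′ → y ≃ y′ → (x +ᶠ y) ≃ (x′ +ᶠ y′)
      +ᶠ-cong {a / s [ _ ]} {a′ / s′ [ _ ]} {b / t [ _ ]} {b′ / t′ [ _ ]} (cross u u∈ e) (cross v v∈ f) =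
        cross (u * v) (*-∈ u∈ v∈) (begin
          u * v * ((a * t + b * s) * (s′ * t′))                      ≈⟨ split u v a t b s s′ t′ ⟩
          u * (a * s′) * (v * t * t′) + v * (b * t′) * (u * s * s′)  ≈⟨ R.+-cong (R.*-congʳ e) (R.*-congʳ f) ⟩
          u * (a′ * s) * (v * t * t′) + v * (b′ * t) * (u * s * s′)
            ≈⟨ R.+-cong (R.*-congˡ (swap v t t′)) (R.*-congˡ (swap u s s′)) ⟩
          u * (a′ * s) * (v * t′ * t) + v * (b′ * t) * (u * s′ * s)  ≈⟨ split u v a′ t′ b′ s′ s t ⟨
          u * v * ((a′ * t′ + b′ * s′) * (s * t))                    ∎)
        where
        open SetoidReasoning R.setoid
        swap : ∀ x y z → x * y * z ≈ x * z * y
        swap = solve 3 (λ x y z → x :* y :* z := x :* z :* y) R.refl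
        split : ∀ u v a t b s s′ t′ → u * v * ((a * t + b * s) * (s′ * t′)) ≈
                u * (a * s′) * (v * t * t′) + v * (b * t′) * (u * s * s′)
        split = solve 8 (λ u v a t b s s′ t′ → u :* v :* ((a :* t :+ b :* s) :* (s′ :* t′)) :=
                u :* (a :* s′) :* (v :* t :* t′) :+ v :* (b :* t′) :* (u :* s :* s′)) R.refl

      *ᶠ-cong : ∀ {x x′ y y′} → x ≃ x′ → y ≃ y′ → (x *ᶠ y) ≃ (x′ *ᶠ y′)
      *ᶠ-cong {a / s [ _ ]} {a′ / s′ [ _ ]} {b / t [ _ ]} {b′ / t′ [ _ ]} (cross u u∈ e) (cross v v∈ f) =
        cross (u * v) (*-∈ u∈ v∈) (begin
          u * v * ((a * b) * (s′ * t′))    ≈⟨ split u v a b s′ t′ ⟩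
          (u * (a * s′)) * (v * (b * t′))  ≈⟨ R.*-cong e f ⟩
          (u * (a′ * s)) * (v * (b′ * t))  ≈⟨ split u v a′ b′ s t ⟨
          u * v * ((a′ * b′) * (s * t))    ∎)
        where
        open SetoidReasoning R.setoid
        split : ∀ u v a b s t → u * v * ((a * b) * (s * t)) ≈ (u * (a * s)) * (v * (b * t))
        split = solve 6 (λ u v a b s t →
          u :* v :* ((a :* b) :* (s :* t)) := (u :* (a :* s)) :* (v :* (b :* t))) R.refl

      -ᶠ-cong : ∀ {x x′} → x ≃ x′ → (-ᶠ x) ≃ (-ᶠ x′)
      -ᶠ-cong {a / s [ _ ]} {a′ / s′ [ _ ]} (cross u u∈ e) = cross u u∈ (begin
          u * (R.- a * s′)   ≈⟨ R.*-congˡ (-‿distribˡ-* a s′) ⟨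
          u * R.- (a * s′)   ≈⟨ -‿distribʳ-* u (a * s′) ⟨
          R.- (u * (a * s′)) ≈⟨ R.-‿cong e ⟩
          R.- (u * (a′ * s)) ≈⟨ -‿distribʳ-* u (a′ * s) ⟩
          u * R.- (a′ * s)   ≈⟨ R.*-congˡ (-‿distribˡ-* a′ s) ⟩
          u * (R.- a′ * s)   ∎)
        where
        open SetoidReasoning R.setoid
        open RingProperties R.ring using (-‿distribˡ-*; -‿distribʳ-*)

      +ᶠ-comm : ∀ x y → (x +ᶠ y) ≃ (y +ᶠ x)
      +ᶠ-comm (a / s [ _ ]) (b / t [ _ ]) = strict (solve 4 (λ a s b t →
        (a :* t :+ b :* s) :* (t :* s) := (b :* s :+ a :* t) :* (s :* t)) R.refl a s b t)

      +ᶠ-identityˡ : ∀ x → (fromR 0# +ᶠ x) ≃ x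
      +ᶠ-identityˡ (a / s [ _ ]) = strict (solve 2 (λ a s →
        (con 0 :* s :+ a :* con 1) :* s := a :* (con 1 :* s)) R.refl a s)

      +ᶠ-inverseˡ : ∀ x → ((-ᶠ x) +ᶠ x) ≃ fromR 0#
      +ᶠ-inverseˡ (a / s [ _ ]) = strict (R.trans (R.*-congʳ
        (R.trans (R.sym (R.distribʳ s _ _)) (R.trans (R.*-congʳ (R.-‿inverseˡ a)) (R.zeroˡ s))))
        (R.trans (R.zeroˡ _) (R.sym (R.zeroˡ _))))

      *ᶠ-comm : ∀ x y → (x *ᶠ y) ≃ (y *ᶠ x)
      *ᶠ-comm (a / s [ _ ]) (b / t [ _ ]) = strict (solve 4 (λ a s b t →
        (a :* b) :* (t :* s) := (b :* a) :* (s :* t)) R.refl a s b t)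

      *ᶠ-identityˡ : ∀ x → (fromR 1# *ᶠ x) ≃ x
      *ᶠ-identityˡ (a / s [ _ ]) = strict (solve 2 (λ a s →
        (con 1 :* a) :* s := a :* (con 1 :* s)) R.refl a s)

      distribˡᶠ : ∀ x y z → (x *ᶠ (y +ᶠ z)) ≃ ((x *ᶠ y) +ᶠ (x *ᶠ z))
      distribˡᶠ (a / s [ _ ]) (b / t [ _ ]) (c / w [ _ ]) = strict (solve 6 (λ a s b t c w →
        (a :* (b :* w :+ c :* t)) :* ((s :* t) :* (s :* w)) :=
        ((a :* b) :* (s :* w) :+ (a :* c) :* (s :* t)) :* (s :* (t :* w))) R.refl a s b t c w)

    S⁻¹R : CommutativeRing ℓ ℓ
    S⁻¹R = record
      { Carrier = Fraction ; _≈_ = _≃_ ; _+_ = _+ᶠ_ ; _*_ = _*ᶠ_ ; -_ = -ᶠ_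
      ; 0# = fromR 0# ; 1# = fromR 1#
      ; isCommutativeRing = record
        { isRing = record
          { +-isAbelianGroup = record
            { isGroup = record
              { isMonoid = record
                { isSemigroup = record
                  { isMagma = record { isEquivalence = ≃-equiv ; ∙-cong = +ᶠ-cong }
                  ; assoc = λ (a / s [ _ ]) (b / t [ _ ]) (c / w [ _ ]) → strict (solve 6 (λ a s b t c w →
                      ((a :* t :+ b :* s) :* w :+ c :* (s :* t)) :* (s :* (t :* w)) :=
                      (a :* (t :* w) :+ (b :* w :+ c :* t) :* s) :* ((s :* t) :* w)) R.refl a s b t c w) }
                ; identity = +ᶠ-identityˡ ,
                    λ x → ≃-trans (+ᶠ-comm x (fromR 0#)) (+ᶠ-identityˡ x) }
              ; inverse = +ᶠ-inverseˡ , λ x → ≃-trans (+ᶠ-comm x (-ᶠ x)) (+ᶠ-inverseˡ x)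
              ; ⁻¹-cong = -ᶠ-cong }
            ; comm = +ᶠ-comm }
          ; *-cong = *ᶠ-cong
          ; *-assoc = λ (a / s [ _ ]) (b / t [ _ ]) (c / w [ _ ]) → strict (solve 6 (λ a s b t c w →
              ((a :* b) :* c) :* (s :* (t :* w)) := (a :* (b :* c)) :* ((s :* t) :* w)) R.refl a s b t c w)
          ; *-identity = *ᶠ-identityˡ , λ x → ≃-trans (*ᶠ-comm x (fromR 1#)) (*ᶠ-identityˡ x)
          ; distrib = distribˡᶠ , λ x y z → ≃-trans (*ᶠ-comm (y +ᶠ z) x)
              (≃-trans (distribˡᶠ x y z) (+ᶠ-cong (*ᶠ-comm x y) (*ᶠ-comm x z))) }
        ; *-comm = *ᶠ-comm } }

    private module S⁻¹R = CommutativeRing S⁻¹R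

    private
      fromR-cong : ∀ {r s} → r ≈ s → fromR r ≃ fromR s
      fromR-cong e = strict (R.*-congʳ e)

      fromR-+ : ∀ r s → fromR (r + s) ≃ (fromR r +ᶠ fromR s)
      fromR-+ r s = strict (solve 2 (λ r s →
        (r :+ s) :* (con 1 :* con 1) := (r :* con 1 :+ s :* con 1) :* con 1) R.refl r s)

      fromR-* : ∀ r s → fromR (r * s) ≃ (fromR r *ᶠ fromR s)
      fromR-* r s = strict (solve 2 (λ r s →
        (r :* s) :* (con 1 :* con 1) := (r :* s) :* con 1) R.refl r s)

    LocOps : ModuleOps
    LocOps .ModuleOps.Elem = Fraction
    LocOps .ModuleOps.eq = _≃_
    LocOps .ModuleOps.add = _+ᶠ_
    LocOps .ModuleOps.nil = fromR 0#
    LocOps .ModuleOps.neg = -ᶠ_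
    LocOps .ModuleOps.act r x = fromR r *ᶠ x

    abstract
      LocLaws : ModuleLaws LocOps
      LocLaws .ModuleLaws.equiv = ≃-equiv
      LocLaws .ModuleLaws.add-cong = +ᶠ-cong
      LocLaws .ModuleLaws.neg-cong = -ᶠ-cong
      LocLaws .ModuleLaws.act-cong er e = *ᶠ-cong (fromR-cong er) e
      LocLaws .ModuleLaws.add-assoc = S⁻¹R.+-assoc
      LocLaws .ModuleLaws.add-comm = +ᶠ-comm
      LocLaws .ModuleLaws.add-nil = +ᶠ-identityˡ
      LocLaws .ModuleLaws.add-neg = +ᶠ-inverseˡ
      LocLaws .ModuleLaws.act-add r x y = distribˡᶠ (fromR r) x y
      LocLaws .ModuleLaws.add-act x r s =
        ≃-trans (*ᶠ-cong (fromR-+ r s) (≃-refl {x})) (S⁻¹R.distribʳ x (fromR r) (fromR s))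
      LocLaws .ModuleLaws.act-assoc r s x =
        ≃-trans (*ᶠ-cong (fromR-* r s) (≃-refl {x})) (S⁻¹R.*-assoc (fromR r) (fromR s) x)
      LocLaws .ModuleLaws.act-1 = *ᶠ-identityˡ

    ⟨S⁻¹R⟩ : Mod
    ⟨S⁻¹R⟩ = mkModule LocOps LocLaws

    ι : ⟨R⟩ ⟶ ⟨S⁻¹R⟩
    ι = mkHom fromR fromR-cong fromR-+ fromR-*

    private
      timesʳ : Fraction → ⟨S⁻¹R⟩ ⟶ ⟨S⁻¹R⟩
      timesʳ y = mkHom (_*ᶠ y) (λ e → *ᶠ-cong e (≃-refl {y})) (S⁻¹R.distribʳ y)
        (λ r x → S⁻¹R.*-assoc (fromR r) x y)

      timesˡ : Fraction → ⟨S⁻¹R⟩ ⟶ ⟨S⁻¹R⟩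
      timesˡ x = mkHom (x *ᶠ_) (*ᶠ-cong (≃-refl {x})) (distribˡᶠ x)
        (λ r y → ≃-trans (S⁻¹R.sym (S⁻¹R.*-assoc x (fromR r) y))
          (≃-trans (*ᶠ-cong (*ᶠ-comm x (fromR r)) (≃-refl {y})) (S⁻¹R.*-assoc (fromR r) x y)))

    infixl 7 _·_
    infix 4 _≈Ω_

    record Ω : Set (lsuc ℓ) where
      field
        submodule : Submodule ⟨S⁻¹R⟩
        fg        : FG submodule

    open Ω

    _≈Ω_ : Rel Ω ℓ
    I ≈Ω J = ∀ x → (x ∈ submodule I → x ∈ submodule J) × (x ∈ submodule J → x ∈ submodule I)

    _·_ : Ω → Ω → Ω
    (I · J) .submodule =
      span ⟨S⁻¹R⟩ {∣ Submodule.asModule (submodule I) ∣ × ∣ Submodule.asModule (submodule J) ∣}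
        λ ((x , _) , (y , _)) → x *ᶠ y
    (I · J) .fg = record
      { generators = gens
      ; contained = λ k → gen ((_ , I.contained _) , (_ , J.contained _))
      ; generates = Span⊆ (finSpan ⟨S⁻¹R⟩ gens) λ ((x , x∈) , (y , y∈)) →
          Span⊆ (preimage (timesʳ y) (finSpan ⟨S⁻¹R⟩ gens))
            (λ i → Span⊆ (preimage (timesˡ (I.generators i)) (finSpan ⟨S⁻¹R⟩ gens)) (each i)
              (J.generates y∈))
            (I.generates x∈) }
      where
      module I = FG (fg I)
      module J = FG (fg J)
      at : Fin I.size × Fin J.size → Fraction
      at (i , j) = I.generators i *ᶠ J.generators j
      gens : Fin (I.size ℕ.* J.size) → Fraction
      gens k = at (remQuot J.size k)
      each : ∀ i j → Span ⟨S⁻¹R⟩ gens (at (i , j))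
      each i j = ≡.subst (λ k → Span ⟨S⁻¹R⟩ gens (at k)) (remQuot-combine i j) (gen (combine i j))

    extend : (I : Ideal) → FG I → Ω
    extend I fgI .submodule = map ι I
    extend I fgI .fg = record
      { generators = fromR ∘ generators
      ; contained = λ i → _ , contained i , ≃-refl
      ; generates = λ (r , r∈ , e) → resp e (Span-map ι gen (generates r∈)) }
      where open FG fgI

    1Ω : Ω
    1Ω .submodule = image ι
    1Ω .fg = record
      { generators = one
      ; contained = λ _ → 1# , ≃-refl
      ; generates = λ {x} (r , e) → resp
          (≃-trans (S⁻¹R.*-identityʳ (fromR r)) e) (mul r (gen {g = one} zero)) }
      where
      one : Fin 1 → Fraction
      one _ = fromR 1#

    private
      ·⊆ : ∀ I J (N : Submodule ⟨S⁻¹R⟩) →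
           (∀ {x y} → x ∈ submodule I → y ∈ submodule J → (x *ᶠ y) ∈ N) →
           ∀ {z} → z ∈ submodule (I · J) → z ∈ N
      ·⊆ I J N h = Span⊆ N λ ((x , x∈) , (y , y∈)) → h x∈ y∈

      *∈· : ∀ I J {x y} → x ∈ submodule I → y ∈ submodule J → (x *ᶠ y) ∈ submodule (I · J)
      *∈· I J x∈ y∈ = gen ((_ , x∈) , (_ , y∈))

    Ω-commutativeMonoid : CommutativeMonoid (lsuc ℓ) ℓ
    Ω-commutativeMonoid = record
      { Carrier = Ω ; _≈_ = _≈Ω_ ; _∙_ = _·_ ; ε = 1Ω
      ; isCommutativeMonoid = record
        { isMonoid = record
          { isSemigroup = record
            { isMagma = record
              { isEquivalence = record
                { refl = λ _ → id , id
                ; sym = λ e x → proj₂ (e x) , proj₁ (e x)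
                ; trans = λ {I} {J} {K} → Ω-trans {I} {J} {K} }
              ; ∙-cong = λ {I} {I′} {J} {J′} e f z →
                  ·⊆ I J (submodule (I′ · J′)) (λ p q → *∈· I′ J′ (proj₁ (e _) p) (proj₁ (f _) q)) ,
                  ·⊆ I′ J′ (submodule (I · J)) (λ p q → *∈· I J (proj₂ (e _) p) (proj₂ (f _) q)) }
            ; assoc = λ I J K z → assoc₁ I J K , assoc₂ I J K }
          ; identity = (λ I z → idˡ I , idˡ⁻ I) ,
              λ I → Ω-trans {I · 1Ω} {1Ω · I} {I} (λ z → comm I 1Ω , comm 1Ω I) (λ z → idˡ I , idˡ⁻ I) }
        ; comm = λ I J z → comm I J , comm J I } }
      where
      Ω-trans : ∀ {I J K} → I ≈Ω J → J ≈Ω K → I ≈Ω K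
      Ω-trans e f x = (λ p → proj₁ (f x) (proj₁ (e x) p)) , (λ p → proj₂ (e x) (proj₂ (f x) p))
      comm : ∀ I J {z} → z ∈ submodule (I · J) → z ∈ submodule (J · I)
      comm I J = ·⊆ I J (submodule (J · I)) (λ {x} {y} p q → resp (*ᶠ-comm y x) (*∈· J I q p))
      idˡ : ∀ I {z} → z ∈ submodule (1Ω · I) → z ∈ submodule I
      idˡ I = ·⊆ 1Ω I (submodule I) (λ {x} {y} (r , e) q →
        Submodule.∈-resp (submodule I) (*ᶠ-cong e (≃-refl {y})) (Submodule.*∈ (submodule I) r q))
      idˡ⁻ : ∀ I {z} → z ∈ submodule I → z ∈ submodule (1Ω · I)
      idˡ⁻ I {z} p = resp (*ᶠ-identityˡ z) (*∈· 1Ω I (1# , ≃-refl) p)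
      assoc₁ : ∀ I J K {z} → z ∈ submodule (I · J · K) → z ∈ submodule (I · (J · K))
      assoc₁ I J K = ·⊆ (I · J) K (submodule (I · (J · K))) (λ {_} {w} p q →
        ·⊆ I J (preimage (timesʳ w) (submodule (I · (J · K))))
          (λ {x} {y} p q′ → resp (S⁻¹R.sym (S⁻¹R.*-assoc x y w)) (*∈· I (J · K) p (*∈· J K q′ q))) p)
      assoc₂ : ∀ I J K {z} → z ∈ submodule (I · (J · K)) → z ∈ submodule (I · J · K)
      assoc₂ I J K = ·⊆ I (J · K) (submodule (I · J · K)) (λ {w} p q →
        ·⊆ J K (preimage (timesˡ w) (submodule (I · J · K)))
          (λ {x} {y} q′ r → resp (S⁻¹R.*-assoc w x y) (*∈· (I · J) K (*∈· I J p q′) r)) q)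

    record 𝓜 (M : Mod) : Set ℓ where
      field
        fg      : FinitelyGenerated M
        torsion : IsTorsion M

    record 𝓒 (M : Mod) : Set ℓ where
      field
        M∈𝓜 : 𝓜 M
        Ext≥2 : ∀ i → 2 ≤ i → IsZero (Ext i M ⟨R⟩)

    record 𝓟 (P : Mod) : Set (lsuc ℓ) where
      field
        P∈𝓜 : 𝓜 P
        pd≤1 : ProjDim≤ 1 P

    -- 0 → M → P₂ → P₁ → N → 0
    record Coresolution (M : Mod) : Set (lsuc ℓ) where
      field
        P₂ P₁ N   : Mod
        α         : M ⟶ P₂
        β         : P₂ ⟶ P₁
        γ         : P₁ ⟶ N
        α-inj     : IsInjective α
        exact-P₂  : IsExact α β
        exact-P₁  : IsExact β γ
        γ-surj    : IsSurjective γ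
        P₂∈𝓟     : 𝓟 P₂
        P₁∈𝓟     : 𝓟 P₁
        N∈𝓒      : 𝓒 N
        image∈𝓒  : 𝓒 (Submodule.asModule (image β))

    Inverse : Ω → Set (lsuc ℓ)
    Inverse I = Σ Ω λ J → J · I ≈Ω 1Ω

    module _ (noeth : IsNoetherian) where

      -- The extension to S⁻¹R of the initial Fitting ideal, computed from the
      -- given generators of M; as an ideal it does not depend on them.
      Fitt : (M : Mod) → FinitelyGenerated M → Ω
      Fitt M fgM = extend (fittingIdeal fgM) (noeth (fittingIdeal fgM))

      𝓕 : {M : Mod} → 𝓜 M → Ω
      𝓕 {M} M∈𝓜 = Fitt M (𝓜.fg M∈𝓜)

      module _ {M : Mod} (s : Coresolution M) where
        open Coresolution s

        𝓕P₁ : Ω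
        𝓕P₁ = 𝓕 (𝓟.P∈𝓜 P₁∈𝓟)

        -- 𝓕(P₁)⁻¹ 𝓕(P₂) 𝓕(N); it depends neither on the sequence nor on the
        -- choice of the (unique) inverse.
        𝓕⟨-2⟩ : Inverse 𝓕P₁ → Ω
        𝓕⟨-2⟩ (𝓕P₁⁻¹ , _) = 𝓕P₁⁻¹ · 𝓕 (𝓟.P∈𝓜 P₂∈𝓟) · 𝓕 (𝓒.M∈𝓜 N∈𝓒)

-- Write P₂ = Rᵐ/K₂ and P₁ = Rⁿ/K₁. As pd ≤ 1, K₂ and K₁ are projective, so each has a finite dual
-- basis; as P₂ and P₁ are torsion, the coordinate forms are vectors over S⁻¹R. Let C : Rᵐ → Rⁿ lift
-- P₂ → P₁. Then N = Rⁿ/(K₁ + C Rᵐ), and since Ext² of N and of the image of P₂ → P₁ vanishes, M* is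
-- the quotient of Hom(K₂, R) by the functionals c + ψ ∘ C with c : Rᵐ → R and ψ : K₁ → R.
-- If K₂ and K₁ are free with square matrices B₂ and B₁, put E = C B₁⁻¹ (rows are vectors): the
-- maximal minors for N are det B₁ times minors of (1; E), those for M* are det B₂ times minors of
-- (1 | E), and both families consist of all minors of E, whence 𝓕(P₂) 𝓕(N) = 𝓕(P₁) 𝓕(M*).
-- In general the same identity follows, without localising, from block matrices over S⁻¹R: their
-- determinants factor by Schur complements, while expanding along rows with entries in R and the
-- Cauchy–Binet formula place them in products of Fitting ideals.
module Submission where

open import Defs
open import Level as Level using (Level)
open import Algebra.Bundles using (CommutativeRing; CommutativeMonoid; Semiring)
open import Algebra.Module.Bundles using (Module)
import Algebra.Module.Construct.DirectProduct as DirectProduct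
open import Algebra.Morphism.Structures using (IsRingHomomorphism)
import Algebra.Definitions.RawSemiring as SemiringDefinitions
import Algebra.Properties.CommutativeMonoid.Sum as CommutativeMonoidSum
import Algebra.Properties.CommutativeSemigroup as CommutativeSemigroupProperties
import Algebra.Properties.Group as GroupProperties
import Algebra.Properties.Ring as RingProperties
import Algebra.Properties.Semiring.Sum as SemiringSum
open import Data.Nat.Base as ℕ using (ℕ; zero; suc; z≤n; s≤s)
import Data.Nat.Properties as ℕ
open import Data.Fin.Base using (Fin; zero; suc; toℕ; punchIn; splitAt; _↑ˡ_; _↑ʳ_)
open import Data.Fin.Properties using (splitAt-↑ˡ; splitAt-↑ʳ; toℕ-↑ˡ)
open import Data.Product.Base using (Σ; ∃; _×_; _,_; proj₁; proj₂)
open import Data.Sum.Base using (inj₁; inj₂; [_,_]′)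
open import Data.Unit.Polymorphic.Base using (⊤; tt)
open import Data.Vec.Functional using (_∷_; _++_)
open import Function.Base using (id; _∘_)
open import Relation.Binary.PropositionalEquality.Core as ≡ using (_≡_)
import Relation.Binary.Reasoning.Setoid as SetoidReasoning

-- The obstacle is that `K₂` and `K₁` are merely projective: a dual basis of `K₂` consists of `b`
-- vectors of `Rᵐ` with `b` possibly larger than `m`, and a square matrix `B₂` need not exist. Its
-- substitute is a pair `κ` (`b` by `m`, over `R`) and `Ĥ` (`m` by `b`, over `S⁻¹R`) with `Ĥ κ = 1`.
-- The entries of the opposite product `κ Ĥ` are the values of the coordinate forms on the vectors,
-- so they lie in `R`, but `κ Ĥ` is only idempotent. The defect `W = 1 - κ Ĥ`, zero for a basis, is
-- also over `R`, is annihilated by `Ĥ` from the left, and its columns are relations between the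
-- coordinate forms. Denominators decide what may be expanded. An element of `R` maps every product
-- of Fitting ideals into itself, so rows or columns over `R` can be removed by Laplace expansion.
-- `Ĥ` has denominators, and Schur complements serve to bring it into products over `R`, such as
-- `κ Ĥ`, or `Γ Φ` where the rows of `Γ` lie in `K₁` and `Φ` is the analogue of `Ĥ` for `K₁`.

module Determinants {ℓ} (A : CommutativeRing ℓ ℓ) where
  open CommutativeRing A hiding (zero)
  open Modules A using (det)
  open SemiringDefinitions (Semiring.rawSemiring semiring) using (_^_)
  open SemiringSum semiring using (sum; sum-cong-≋; ∑-distrib-+; ∑-comm; *-distribˡ-sum; *-distribʳ-sum)
  open RingProperties ring using (-‿+-comm; -‿distribˡ-*; -‿distribʳ-*; -1*x≈-x; -‿involutive; -0#≈0#)
  open SetoidReasoning setoid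
  open import Algebra.Solver.Ring.NaturalCoefficients.Default commutativeSemiring
    using (solve; _:=_; _:+_; _:*_; con)

  -- Laplace expansion and alternating multilinear forms.

  Mat : ℕ → ℕ → Set ℓ
  Mat n k = Fin n → Fin k → Carrier

  infix 4 _≋_
  _≋_ : ∀ {n k} → Mat n k → Mat n k → Set ℓ
  M ≋ N = ∀ i j → M i j ≈ N i j

  sgn : ∀ {n} → Fin n → Carrier
  sgn j = (- 1#) ^ toℕ j

  sum-0 : ∀ {n} {f : Fin n → Carrier} → (∀ i → f i ≈ 0#) → sum f ≈ 0#
  sum-0 {zero}  h = refl
  sum-0 {suc n} h = trans (+-cong (h zero) (sum-0 (h ∘ suc))) (+-identityˡ 0#)

  sum-++ : ∀ n {m} (f : Fin (n ℕ.+ m) → Carrier) →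
           sum f ≈ sum (λ i → f (i ↑ˡ m)) + sum (λ i → f (n ↑ʳ i))
  sum-++ zero    f = sym (+-identityˡ _)
  sum-++ (suc n) f = trans (+-congˡ (sum-++ n (f ∘ suc))) (sym (+-assoc _ _ _))

  sum-pull : ∀ {n} c (f : Fin n → Carrier) {g : Fin n → Carrier} → (∀ i → g i ≈ c * f i) → sum g ≈ c * sum f
  sum-pull c f h = trans (sum-cong-≋ h) (sym (*-distribˡ-sum c f))

  sum-linear : ∀ {n} c d (f g : Fin n → Carrier) {h : Fin n → Carrier} →
    (∀ i → h i ≈ c * f i + d * g i) → sum h ≈ c * sum f + d * sum g
  sum-linear c d f g e = trans (sum-cong-≋ e) (trans (∑-distrib-+ (λ i → c * f i) (λ i → d * g i))
    (+-cong (sym (*-distribˡ-sum c f)) (sym (*-distribˡ-sum d g))))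

  det-cong : ∀ {n} {M N : Mat n n} → M ≋ N → det M ≈ det N
  det-cong {zero}  e = refl
  det-cong {suc n} e = sum-cong-≋ λ j →
    *-cong (*-congˡ {sgn j} (e zero j)) (det-cong λ i k → e (suc i) (punchIn j k))

  private
    -1·-1 : (- 1#) * (- 1#) ≈ 1#
    -1·-1 = trans (-1*x≈-x (- 1#)) (-‿involutive 1#)

    x+-1x : ∀ x → x + (- 1#) * x ≈ 0#
    x+-1x x = trans (+-congˡ (-1*x≈-x x)) (-‿inverseʳ x)

    -- The terms of the double Laplace expansion of a matrix with two equal rows cancel in pairs.
    double-expansion : ∀ n (a : Fin (2 ℕ.+ n) → Carrier) (D : (Fin n → Fin (2 ℕ.+ n)) → Carrier) →
      (∀ {h h′} → (∀ l → h l ≡ h′ l) → D h ≈ D h′) →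
      sum (λ j → sgn j * a j * sum λ k → sgn k * a (punchIn j k) * D λ l → punchIn j (punchIn k l)) ≈ 0#
    double-expansion n a D D-cong = begin
      -- The term with `j = zero` and column `k`, and the term with `j = suc k` and the first
      -- column, choose the same two columns; their signs differ by one factor `- 1#`.
      1# * a zero * sum P + sum (λ j → sgn (suc j) * a (suc j) * (1# * a zero * D (λ l → suc (punchIn j l)) + I j))
        ≈⟨ +-congˡ (sum-linear (- 1# * a zero) 1# P (λ j → sgn (suc j) * a (suc j) * I j) λ j →
             solve 6 (λ e s x y d i → e :* s :* x :* (con 1 :* y :* d :+ i) :=
                e :* y :* (s :* x :* d) :+ con 1 :* (e :* s :* x :* i)) refl
                (- 1#) (sgn j) (a (suc j)) (a zero) (D (λ l → suc (punchIn j l))) (I j)) ⟩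
      1# * a zero * sum P + (- 1# * a zero * sum P + 1# * sum (λ j → sgn (suc j) * a (suc j) * I j))
        ≈⟨ solve 4 (λ e x p q → con 1 :* x :* p :+ (e :* x :* p :+ con 1 :* q) :=
              x :* p :+ e :* (x :* p) :+ q) refl (- 1#) (a zero) (sum P) _ ⟩
      a zero * sum P + - 1# * (a zero * sum P) + sum (λ j → sgn (suc j) * a (suc j) * I j)
        ≈⟨ +-cong (x+-1x (a zero * sum P)) (rest n a D D-cong) ⟩
      0# + 0# ≈⟨ +-identityˡ 0# ⟩
      0# ∎
      where
      P : Fin (suc n) → Carrier
      P k = sgn k * a (suc k) * D (λ l → suc (punchIn k l))
      I : Fin (suc n) → Carrier
      I j = sum λ k → sgn (suc k) * a (punchIn (suc j) (suc k)) * D λ l → punchIn (suc j) (punchIn (suc k) l)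

      rest : ∀ n (a : Fin (2 ℕ.+ n) → Carrier) (D : (Fin n → Fin (2 ℕ.+ n)) → Carrier) →
        (∀ {h h′} → (∀ l → h l ≡ h′ l) → D h ≈ D h′) →
        sum (λ j → sgn (suc j) * a (suc j) *
          sum λ k → sgn (suc k) * a (punchIn (suc j) (suc k)) * D λ l → punchIn (suc j) (punchIn (suc k) l)) ≈ 0#
      rest zero a D D-cong = sum-0 {1} λ j → zeroʳ (sgn (suc j) * a (suc j))
      rest (suc n) a D D-cong = trans (sum-cong-≋ eq)
        (double-expansion n (a ∘ suc) (λ h → D (lift h)) (λ e → D-cong λ { zero → ≡.refl ; (suc l) → ≡.cong suc (e l) }))
        where
        -- Here neither chosen column is the first, so the first column always leads the remaining
        -- ones; absorbing it into `D` shortens `a` by one entry.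
        lift : (Fin n → Fin (2 ℕ.+ n)) → Fin (suc n) → Fin (3 ℕ.+ n)
        lift h = zero ∷ (suc ∘ h)
        eq : ∀ j → sgn (suc j) * a (suc j) *
             sum (λ k → sgn (suc k) * a (punchIn (suc j) (suc k)) * D λ l → punchIn (suc j) (punchIn (suc k) l)) ≈
             sgn j * a (suc j) * sum (λ k → sgn k * a (suc (punchIn j k)) * D (lift λ l → punchIn j (punchIn k l)))
        eq j = trans (*-congˡ (sum-pull (- 1#) (λ k → sgn k * a (suc (punchIn j k)) * D (lift λ l → punchIn j (punchIn k l)))
            λ k → trans (*-congˡ (D-cong {λ l → punchIn (suc j) (punchIn (suc k) l)}
                {lift λ l → punchIn j (punchIn k l)} λ { zero → ≡.refl ; (suc l) → ≡.refl }))
              (solve 4 (λ e s x d → e :* s :* x :* d := e :* (s :* x :* d)) refl (- 1#) (sgn k) _ _)))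
          (trans (solve 4 (λ e s x t → e :* s :* x :* (e :* t) := e :* e :* (s :* x :* t)) refl (- 1#) (sgn j) (a (suc j)) _)
          (trans (*-congʳ -1·-1) (*-identityˡ _)))

  -- The conditions on the i-th row are imposed after fixing the rows before it.
  Multilinear : ∀ n {k} → (Mat n k → Carrier) → Set ℓ
  Multilinear zero    f = ⊤
  Multilinear (suc n) {k} f =
    (∀ c d u v t → f ((λ j → c * u j + d * v j) ∷ t) ≈ c * f (u ∷ t) + d * f (v ∷ t)) ×
    (∀ u → Multilinear n (λ t → f (u ∷ t)))

  -- Only neighbouring equal rows are tested. A row further down is reached by moving it to the
  -- front with `swap`.
  Repeating : ∀ n {k} → (Mat n k → Carrier) → Set ℓ
  Repeating zero          f = ⊤
  Repeating (suc zero)    f = ⊤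
  Repeating (suc (suc n)) f =
    (∀ u t → f (u ∷ u ∷ t) ≈ 0#) × (∀ u → Repeating (suc n) (λ t → f (u ∷ t)))

  -- `cong` belongs to the structure because matrices are functions: a matrix and its reassembly
  -- from rows by `∷` agree only pointwise.
  record Alternating n {k} (f : Mat n k → Carrier) : Set ℓ where
    field
      cong        : ∀ {M N} → M ≋ N → f M ≈ f N
      multilinear : Multilinear n f
      repeating   : Repeating n f

  ∷-cong : ∀ {n k} {u v : Fin k → Carrier} {M N : Mat n k} →
    (∀ j → u j ≈ v j) → M ≋ N → (u ∷ M) ≋ (v ∷ N)
  ∷-cong e e′ zero    = e
  ∷-cong e e′ (suc i) = e′ i

  ≋-refl : ∀ {n k} {M : Mat n k} → M ≋ M
  ≋-refl i j = refl

  ∷-η : ∀ {n k} (M : Mat (suc n) k) → M ≋ (M zero ∷ (M ∘ suc))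
  ∷-η M zero    j = refl
  ∷-η M (suc i) j = refl

  fix : ∀ {n k} {f : Mat (suc n) k → Carrier} → Alternating (suc n) f → ∀ u → Alternating n (λ t → f (u ∷ t))
  fix {zero} alt u = record
    { cong = λ e → alt.cong (∷-cong (λ _ → refl) e) ; multilinear = tt ; repeating = tt }
    where module alt = Alternating alt
  fix {suc n} alt u = record
    { cong = λ e → alt.cong (∷-cong (λ _ → refl) e)
    ; multilinear = proj₂ alt.multilinear u ; repeating = proj₂ alt.repeating u }
    where module alt = Alternating alt

  build : ∀ {n k} {f : Mat (suc (suc n)) k → Carrier} →
    (∀ {M N} → M ≋ N → f M ≈ f N) →
    (∀ c d u v t → f ((λ j → c * u j + d * v j) ∷ t) ≈ c * f (u ∷ t) + d * f (v ∷ t)) →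
    (∀ u t → f (u ∷ u ∷ t) ≈ 0#) → (∀ u → Alternating (suc n) (λ t → f (u ∷ t))) →
    Alternating (suc (suc n)) f
  build c l r t = record
    { cong = c ; multilinear = l , λ u → Alternating.multilinear (t u)
    ; repeating = r , λ u → Alternating.repeating (t u) }

  alternating-resp : ∀ {n k} {f g : Mat n k → Carrier} → (∀ M → f M ≈ g M) → Alternating n f → Alternating n g
  alternating-resp {zero} e alt = record
    { cong = λ p → trans (sym (e _)) (trans (Alternating.cong alt p) (e _)) ; multilinear = tt ; repeating = tt }
  alternating-resp {suc zero} e alt = record
    { cong = λ p → trans (sym (e _)) (trans (Alternating.cong alt p) (e _))
    ; multilinear = (λ c d u v t → trans (sym (e _)) (trans (proj₁ (Alternating.multilinear alt) c d u v t)
        (+-cong (*-congˡ (e _)) (*-congˡ (e _))))) , λ _ → tt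
    ; repeating = tt }
  alternating-resp {suc (suc n)} e alt = build
    (λ p → trans (sym (e _)) (trans (Alternating.cong alt p) (e _)))
    (λ c d u v t → trans (sym (e _)) (trans (proj₁ (Alternating.multilinear alt) c d u v t)
        (+-cong (*-congˡ (e _)) (*-congˡ (e _)))))
    (λ u t → trans (sym (e _)) (proj₁ (Alternating.repeating alt) u t))
    (λ u → alternating-resp (λ t → e (u ∷ t)) (fix alt u))

  alternating-sum : ∀ {n k p} (c : Fin p → Carrier) {F : Fin p → Mat n k → Carrier} →
    (∀ j → Alternating n (F j)) → Alternating n (λ t → sum λ j → c j * F j t)
  alternating-sum {n} c {F} alt = record
    { cong = λ e → sum-cong-≋ λ j → *-congˡ (Alternating.cong (alt j) e)
    ; multilinear = ml n c F (Alternating.multilinear ∘ alt)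
    ; repeating = rep n c F (Alternating.repeating ∘ alt) }
    where
    ml : ∀ n {k p} (c : Fin p → Carrier) (F : Fin p → Mat n k → Carrier) →
         (∀ j → Multilinear n (F j)) → Multilinear n (λ t → sum λ j → c j * F j t)
    ml zero c F m = tt
    ml (suc n) c F m =
      (λ a b u v t → sum-linear a b _ _ λ j → trans (*-congˡ (proj₁ (m j) a b u v t))
        (solve 5 (λ a b x y z → z :* (a :* x :+ b :* y) := a :* (z :* x) :+ b :* (z :* y)) refl a b _ _ (c j))) ,
      λ u → ml n c (λ j t → F j (u ∷ t)) (λ j → proj₂ (m j) u)
    rep : ∀ n {k p} (c : Fin p → Carrier) (F : Fin p → Mat n k → Carrier) →
          (∀ j → Repeating n (F j)) → Repeating n (λ t → sum λ j → c j * F j t)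
    rep zero c F r = tt
    rep (suc zero) c F r = tt
    rep (suc (suc n)) c F r =
      (λ u t → sum-0 λ j → trans (*-congˡ (proj₁ (r j) u t)) (zeroʳ (c j))) ,
      λ u → rep (suc n) c (λ j t → F j (u ∷ t)) (λ j → proj₂ (r j) u)

  record Linear {k l} (L : (Fin k → Carrier) → Fin l → Carrier) : Set ℓ where
    field
      cong   : ∀ {u v} → (∀ j → u j ≈ v j) → ∀ j → L u j ≈ L v j
      linear : ∀ c d u v j → L (λ i → c * u i + d * v i) j ≈ c * L u j + d * L v j

  alternating-∘ : ∀ {n k l} {L : (Fin k → Carrier) → Fin l → Carrier} {f : Mat n l → Carrier} →
    Linear L → Alternating n f → Alternating n (λ t → f (L ∘ t))
  alternating-∘ {L = L} lin alt = go _ alt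
    where
    module L = Linear lin
    ∘-∷ : ∀ {n} u (t : Mat n _) → (L ∘ (u ∷ t)) ≋ (L u ∷ (L ∘ t))
    ∘-∷ u t zero    j = refl
    ∘-∷ u t (suc i) j = refl
    ≋-sym : ∀ {n k} {M N : Mat n k} → M ≋ N → N ≋ M
    ≋-sym e i j = sym (e i j)
    linear₁ : ∀ {n} {f : Mat (suc n) _ → Carrier} → Alternating (suc n) f → ∀ c d u v t →
      f (L ∘ ((λ j → c * u j + d * v j) ∷ t)) ≈ c * f (L ∘ (u ∷ t)) + d * f (L ∘ (v ∷ t))
    linear₁ alt c d u v t = trans (alt.cong (λ { zero → L.linear c d u v ; (suc i) j → refl }))
      (trans (proj₁ alt.multilinear c d (L u) (L v) (L ∘ t))
        (+-cong (*-congˡ (alt.cong (≋-sym (∘-∷ u t)))) (*-congˡ (alt.cong (≋-sym (∘-∷ v t))))))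
      where module alt = Alternating alt
    go : ∀ n {f} → Alternating n f → Alternating n (λ t → f (L ∘ t))
    go zero alt = record { cong = λ e → Alternating.cong alt (λ ()) ; multilinear = tt ; repeating = tt }
    go (suc zero) alt = record
      { cong = λ e → Alternating.cong alt (λ i → L.cong (e i))
      ; multilinear = linear₁ alt , λ _ → tt ; repeating = tt }
    go (suc (suc n)) alt = build (λ e → Alternating.cong alt (λ i → L.cong (e i))) (linear₁ alt)
      (λ u t → trans (Alternating.cong alt λ { zero j → refl ; (suc zero) j → refl ; (suc (suc i)) j → refl })
        (proj₁ (Alternating.repeating alt) (L u) (L ∘ t)))
      (λ u → alternating-resp (λ t → Alternating.cong alt (≋-sym (∘-∷ u t))) (go (suc n) (fix alt (L u))))

  reindex-linear : ∀ {k l} (σ : Fin l → Fin k) → Linear (λ u → u ∘ σ)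
  reindex-linear σ = record { cong = λ e j → e (σ j) ; linear = λ _ _ _ _ _ → refl }

  -- Induction on the size. Once the first row is fixed, the Laplace expansion is a linear
  -- combination of smaller determinants in the other rows; two equal leading rows are the case of
  -- `double-expansion`.
  det-alternating : ∀ n → Alternating n (det {n})
  det-alternating zero = record { cong = λ _ → refl ; multilinear = tt ; repeating = tt }
  det-alternating (suc n) = top n (det-alternating n)
    where
    head-linear : ∀ {n} c d u v (t : Mat n (suc n)) →
      det ((λ j → c * u j + d * v j) ∷ t) ≈ c * det (u ∷ t) + d * det (v ∷ t)
    head-linear c d u v t = sum-linear c d _ _ λ j →
      solve 6 (λ c d u v s x → s :* (c :* u :+ d :* v) :* x := c :* (s :* u :* x) :+ d :* (s :* v :* x))
        refl c d (u j) (v j) (sgn j) (det λ i l → t i (punchIn j l))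
    tail-alternating : ∀ n → Alternating n (det {n}) → ∀ u → Alternating n (λ t → det {suc n} (u ∷ t))
    tail-alternating n alt u = alternating-sum (λ j → sgn j * u j) λ j →
      alternating-∘ (reindex-linear (punchIn j)) alt
    top : ∀ n → Alternating n (det {n}) → Alternating (suc n) (det {suc n})
    top zero alt = record
      { cong = det-cong ; multilinear = head-linear , λ _ → tt ; repeating = tt }
    top (suc n) alt = build det-cong head-linear
      (λ u t → double-expansion n u (λ h → det λ i l → t i (h l))
        (λ e → det-cong λ i l → reflexive (≡.cong (t i) (e l))))
      (tail-alternating (suc n) alt)

  ∷-linear : ∀ {n k} {f : Mat (suc n) k → Carrier} → Alternating (suc n) f →
    ∀ c u v t → f ((λ j → c * u j + v j) ∷ t) ≈ f (v ∷ t) + c * f (u ∷ t)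
  ∷-linear {f = f} alt c u v t = begin
    f ((λ j → c * u j + v j) ∷ t)       ≈⟨ alt.cong (∷-cong (λ j → +-congˡ (sym (*-identityˡ (v j)))) ≋-refl) ⟩
    f ((λ j → c * u j + 1# * v j) ∷ t)  ≈⟨ proj₁ alt.multilinear c 1# u v t ⟩
    c * f (u ∷ t) + 1# * f (v ∷ t)      ≈⟨ trans (+-comm _ _) (+-congʳ (*-identityˡ _)) ⟩
    f (v ∷ t) + c * f (u ∷ t)           ∎
    where module alt = Alternating alt

  -- Polarisation: `f` vanishes with `w` in both leading rows, and so do the two terms in which `u`
  -- or `v` is repeated.
  swap : ∀ {n k} {f : Mat (suc (suc n)) k → Carrier} → Alternating (suc (suc n)) f →
    ∀ u v t → f (u ∷ v ∷ t) ≈ - 1# * f (v ∷ u ∷ t)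
  swap {f = f} alt u v t = trans (inverseʳ-unique _ _ (trans (+-comm _ _) antisymmetric)) (sym (-1*x≈-x _))
    where
    module alt = Alternating alt
    open GroupProperties +-group using (inverseʳ-unique)
    w : Fin _ → Carrier
    w j = 1# * u j + v j
    antisymmetric : f (u ∷ v ∷ t) + f (v ∷ u ∷ t) ≈ 0#
    antisymmetric = begin
      f (u ∷ v ∷ t) + f (v ∷ u ∷ t)
        ≈⟨ solve 2 (λ x y → x :+ y := con 0 :+ con 1 :* y :+ con 1 :* (x :+ con 1 :* con 0)) refl _ _ ⟩
      0# + 1# * f (v ∷ u ∷ t) + 1# * (f (u ∷ v ∷ t) + 1# * 0#)
        ≈⟨ +-cong (+-congʳ (proj₁ alt.repeating v t)) (*-congˡ (+-congˡ (*-congˡ (proj₁ alt.repeating u t)))) ⟨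
      f (v ∷ v ∷ t) + 1# * f (v ∷ u ∷ t) + 1# * (f (u ∷ v ∷ t) + 1# * f (u ∷ u ∷ t))
        ≈⟨ +-cong (∷-linear (fix alt v) 1# u v t) (*-congˡ (∷-linear (fix alt u) 1# u v t)) ⟨
      f (v ∷ w ∷ t) + 1# * f (u ∷ w ∷ t)
        ≈⟨ ∷-linear alt 1# u v (w ∷ t) ⟨
      f (w ∷ w ∷ t)
        ≈⟨ proj₁ alt.repeating w t ⟩
      0# ∎

  -- Expansion of alternating forms in minors, and the Cauchy-Binet formula.

  module _ {k} (e : Fin k → Carrier) where

    shift : ∀ {n} → (Fin n → Carrier) → Mat n k → Mat n k
    shift c x i j = c i * e j + x i j

    -- Terms that take `e` from two rows vanish, so at most one row contributes it, and moving it to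
    -- the front costs `sgn i`. The induction runs jointly with `absorb`, the case in which `e`
    -- already stands in front.
    expand-rows : ∀ {n} {f : Mat (suc n) k → Carrier} → Alternating (suc n) f → ∀ c x →
      f (shift c x) ≈ f x + sum λ i → sgn i * c i * f (e ∷ (x ∘ punchIn i))

    absorb : ∀ {n} {f : Mat (suc n) k → Carrier} → Alternating (suc n) f → ∀ c x →
      f (e ∷ shift c x) ≈ f (e ∷ x)
    absorb {zero} alt c x = Alternating.cong alt (∷-cong (λ _ → refl) λ ())
    absorb {suc n} {f} alt c x = trans (expand-rows (fix alt e) c x) (trans
      (+-congˡ (sum-0 {f = λ i → sgn i * c i * f (e ∷ e ∷ (x ∘ punchIn i))} λ i →
        trans (*-congˡ (proj₁ (Alternating.repeating alt) e (x ∘ punchIn i))) (zeroʳ _)))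
      (+-identityʳ _))

    private
      expand-head : ∀ {n} {f : Mat (suc n) k → Carrier} → Alternating (suc n) f → ∀ c x →
        f (shift c x) ≈ f (x zero ∷ shift (c ∘ suc) (x ∘ suc)) + c zero * f (e ∷ (x ∘ suc))
      expand-head alt c x = trans (Alternating.cong alt (∷-η (shift c x)))
        (trans (∷-linear alt (c zero) e (x zero) (shift (c ∘ suc) (x ∘ suc)))
          (+-congˡ (*-congˡ (absorb alt (c ∘ suc) (x ∘ suc)))))

    expand-rows {zero} {f} alt c x = trans (expand-head alt c x)
      (+-cong (Alternating.cong alt λ { zero j → refl })
        (trans (*-congˡ (Alternating.cong alt (∷-cong (λ _ → refl) λ ())))
          (solve 2 (λ c x → c :* x := con 1 :* c :* x :+ con 0) refl (c zero) (f (e ∷ (x ∘ punchIn zero))))))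
    expand-rows {suc n} {f} alt c x = begin
      f (shift c x)
        ≈⟨ expand-head alt c x ⟩
      f (x zero ∷ shift (c ∘ suc) (x ∘ suc)) + c zero * f (e ∷ (x ∘ suc))
        ≈⟨ +-congʳ (expand-rows (fix alt (x zero)) (c ∘ suc) (x ∘ suc)) ⟩
      f (x zero ∷ (x ∘ suc)) + sum (λ i → sgn i * c (suc i) * f (x zero ∷ e ∷ (x ∘ suc ∘ punchIn i))) + c zero * f (e ∷ (x ∘ suc))
        ≈⟨ +-congʳ (+-cong (alt.cong λ { zero j → refl ; (suc i) j → refl }) (sum-cong-≋ term)) ⟩
      f x + sum (λ i → sgn (suc i) * c (suc i) * f (e ∷ (x ∘ punchIn (suc i)))) + c zero * f (e ∷ (x ∘ suc))
        ≈⟨ solve 4 (λ a b c d → a :+ b :+ c :* d := a :+ (con 1 :* c :* d :+ b)) refl (f x) _ (c zero) (f (e ∷ (x ∘ suc))) ⟩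
      f x + (sum λ i → sgn i * c i * f (e ∷ (x ∘ punchIn i))) ∎
      where
      module alt = Alternating alt
      term : ∀ i → sgn i * c (suc i) * f (x zero ∷ e ∷ (x ∘ suc ∘ punchIn i)) ≈
                   sgn (suc i) * c (suc i) * f (e ∷ (x ∘ punchIn (suc i)))
      term i = trans (*-congˡ (swap alt (x zero) e (x ∘ suc ∘ punchIn i)))
        (trans (*-congˡ (*-congˡ (alt.cong (∷-cong (λ _ → refl) λ { zero j → refl ; (suc l) j → refl }))))
          (solve 4 (λ m s c d → s :* c :* (m :* d) := m :* s :* c :* d) refl (- 1#) (sgn i) (c (suc i)) _))

  -- The sum over the increasing maps Fin n → Fin a.
  sumInc : ∀ a n → ((Fin n → Fin a) → Carrier) → Carrier
  sumInc a       zero    g = g (λ ())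
  sumInc zero    (suc n) g = 0#
  sumInc (suc a) (suc n) g = sumInc a (suc n) (λ I → g (suc ∘ I)) + sumInc a n (λ I → g (zero ∷ (suc ∘ I)))

  sumInc-cong : ∀ a n {g h : (Fin n → Fin a) → Carrier} → (∀ I → g I ≈ h I) → sumInc a n g ≈ sumInc a n h
  sumInc-cong a       zero    e = e _
  sumInc-cong zero    (suc n) e = refl
  sumInc-cong (suc a) (suc n) e = +-cong (sumInc-cong a (suc n) (λ I → e _)) (sumInc-cong a n (λ I → e _))

  sum-sumInc : ∀ a n {p} (c : Fin p → Carrier) (g : Fin p → (Fin n → Fin a) → Carrier) →
    sum (λ i → c i * sumInc a n (g i)) ≈ sumInc a n (λ I → sum λ i → c i * g i I)
  sum-sumInc a       zero    c g = refl
  sum-sumInc zero    (suc n) c g = sum-0 λ i → zeroʳ (c i)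
  sum-sumInc (suc a) (suc n) c g = trans (sum-cong-≋ λ i → distribˡ (c i) _ _)
    (trans (∑-distrib-+ (λ i → c i * sumInc a (suc n) λ I → g i (suc ∘ I)) λ i → c i * sumInc a n λ I → g i (zero ∷ (suc ∘ I)))
      (+-cong (sum-sumInc a (suc n) c _) (sum-sumInc a n c _)))

  sumInc-closed : ∀ {p} (N : Carrier → Set p) → N 0# → (∀ {x y} → N x → N y → N (x + y)) →
    ∀ a n {g} → (∀ I → N (g I)) → N (sumInc a n g)
  sumInc-closed N N0 N+ a       zero    h = h _
  sumInc-closed N N0 N+ zero    (suc n) h = N0
  sumInc-closed N N0 N+ (suc a) (suc n) h =
    N+ (sumInc-closed N N0 N+ a (suc n) λ I → h _) (sumInc-closed N N0 N+ a n λ I → h _)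

  sumInc-* : ∀ a n c {g h : (Fin n → Fin a) → Carrier} → (∀ I → h I ≈ c * g I) → sumInc a n h ≈ c * sumInc a n g
  sumInc-* a       zero    c e = e _
  sumInc-* zero    (suc n) c e = sym (zeroʳ c)
  sumInc-* (suc a) (suc n) c e = trans (+-cong (sumInc-* a (suc n) c λ I → e _) (sumInc-* a n c λ I → e _)) (sym (distribˡ c _ _))

  sumInc-empty : ∀ a n → a ℕ.< n → ∀ g → sumInc a n g ≈ 0#
  sumInc-empty zero    (suc n) _ g = refl
  sumInc-empty (suc a) (suc n) (ℕ.s≤s p) g = trans (+-cong (sumInc-empty a (suc n) (ℕ.m<n⇒m<1+n p) _)
    (sumInc-empty a n p _)) (+-identityˡ 0#)

  -- The identity is the only increasing map of `Fin n` to itself, but `sumInc` builds it by consing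
  -- and reaches it only pointwise; hence the congruence hypothesis.
  sumInc-full : ∀ n {g : (Fin n → Fin n) → Carrier} → (∀ {I J} → (∀ i → I i ≡ J i) → g I ≈ g J) → sumInc n n g ≈ g id
  sumInc-full zero    h = h λ ()
  sumInc-full (suc n) h = trans (+-cong (sumInc-empty n (suc n) (ℕ.n<1+n n) _)
    (sumInc-full n λ e → h λ { zero → ≡.refl ; (suc i) → ≡.cong suc (e i) }))
    (trans (+-identityˡ _) (h λ { zero → ≡.refl ; (suc i) → ≡.refl }))

  δ : ∀ {n} → Mat n n
  δ zero    zero    = 1#
  δ zero    (suc j) = 0#
  δ (suc i) zero    = 0#
  δ (suc i) (suc j) = δ i j

  _ᵀ : ∀ {n k} → Mat n k → Mat k n
  (M ᵀ) i j = M j i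

  prepend-0 : ∀ {k} → Linear {k} {suc k} (λ u → 0# ∷ u)
  prepend-0 = record
    { cong = λ { e zero → refl ; e (suc j) → e j }
    ; linear = λ { c d u v zero → solve 2 (λ c d → con 0 := c :* con 0 :+ d :* con 0) refl c d ; c d u v (suc j) → refl } }

  -- Splitting off the first column makes every row a multiple of `δ zero` plus a row beginning with
  -- `0#`. By `expand-rows`, either no row supplies `δ zero`, which gives the maps that avoid
  -- `zero`, or exactly one does, which gives the maps that hit it. The minor is transposed so that
  -- the sum over that row is its Laplace expansion along the first row.
  alternating-expansion : ∀ a n {f : Mat n a → Carrier} → Alternating n f → ∀ x →
    f x ≈ sumInc a n λ I → f (δ ∘ I) * det λ j i → x i (I j)
  alternating-expansion a zero {f} alt x = trans (Alternating.cong alt λ ()) (sym (*-identityʳ _))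
  alternating-expansion zero (suc n) {f} alt x = begin
    f x                                              ≈⟨ alt.cong (λ i ()) ⟩
    f ((λ j → 0# * x zero j + 0# * x zero j) ∷ (x ∘ suc))  ≈⟨ proj₁ alt.multilinear 0# 0# (x zero) (x zero) (x ∘ suc) ⟩
    0# * _ + 0# * _                                  ≈⟨ trans (+-cong (zeroˡ _) (zeroˡ _)) (+-identityˡ 0#) ⟩
    0#                                               ∎
    where module alt = Alternating alt
  alternating-expansion (suc a) (suc n) {f} alt x = begin
    f x
      ≈⟨ alt.cong split ⟩
    f (shift (δ zero) (λ i → x i zero) y)
      ≈⟨ expand-rows (δ zero) alt (λ i → x i zero) y ⟩
    f y + (sum λ i → sgn i * x i zero * f (δ zero ∷ (y ∘ punchIn i)))
      ≈⟨ +-cong (alternating-expansion a (suc n) (alternating-∘ prepend-0 alt) (λ i → x i ∘ suc))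
           (sum-cong-≋ λ i → *-congˡ {sgn i * x i zero} (alternating-expansion a n
             (alternating-∘ prepend-0 (fix alt (δ zero))) (λ l → x (punchIn i l) ∘ suc))) ⟩
    sumInc a (suc n) (λ I → f (λ i → 0# ∷ δ (I i)) * det λ j i → x i (suc (I j))) +
    (sum λ i → sgn i * x i zero * sumInc a n λ I → f (δ zero ∷ (λ l → 0# ∷ δ (I l))) * minor I i)
      ≈⟨ +-cong (sumInc-cong a (suc n) λ I → *-congʳ (alt.cong λ i → 0∷δ (I i)))
           (trans (sum-sumInc a n (λ i → sgn i * x i zero) λ i I → f (δ zero ∷ (λ l → 0# ∷ δ (I l))) * minor I i)
             (sumInc-cong a n laplace)) ⟩
    sumInc (suc a) (suc n) (λ I → f (δ ∘ I) * det λ j i → x i (I j)) ∎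
    where
    module alt = Alternating alt
    y : Mat (suc n) (suc a)
    y i = 0# ∷ (x i ∘ suc)
    split : x ≋ shift (δ zero) (λ i → x i zero) y
    split i zero    = solve 1 (λ x → x := x :* con 1 :+ con 0) refl (x i zero)
    split i (suc j) = solve 2 (λ x y → y := x :* con 0 :+ y) refl (x i zero) (x i (suc j))
    0∷δ : ∀ (i : Fin a) j → (0# ∷ δ i) j ≈ δ (suc i) j
    0∷δ i zero    = refl
    0∷δ i (suc j) = refl
    minor : (Fin n → Fin a) → Fin (suc n) → Carrier
    minor I i = det λ j l → x (punchIn i l) (suc (I j))
    laplace : ∀ I → (sum λ i → sgn i * x i zero * (f (δ zero ∷ (λ l → 0# ∷ δ (I l))) * minor I i)) ≈
      f (δ ∘ (zero ∷ (suc ∘ I))) * det λ j i → x i ((zero ∷ (suc ∘ I)) j)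
    laplace I = trans (sum-pull (f (δ zero ∷ (λ l → 0# ∷ δ (I l)))) (λ i → sgn i * x i zero * minor I i)
        λ i → solve 3 (λ s f m → s :* (f :* m) := f :* (s :* m)) refl (sgn i * x i zero) _ (minor I i))
      (*-congʳ (alt.cong λ { zero j → refl ; (suc i) j → 0∷δ (I i) j }))

  infixl 7 _⊗_
  _⊗_ : ∀ {n m p} → Mat n m → Mat m p → Mat n p
  (M ⊗ N) i j = sum λ k → M i k * N k j

  ⊗-linear : ∀ {m p} (N : Mat m p) → Linear λ u j → sum λ k → u k * N k j
  ⊗-linear N = record
    { cong = λ e j → sum-cong-≋ λ k → *-congʳ (e k)
    ; linear = λ c d u v j → sum-linear c d (λ k → u k * N k j) (λ k → v k * N k j)
        λ k → solve 5 (λ c d u v x → (c :* u :+ d :* v) :* x := c :* (u :* x) :+ d :* (v :* x)) refl c d (u k) (v k) (N k j) }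

  δ-sum : ∀ {n} i (f : Fin n → Carrier) → sum (λ k → δ i k * f k) ≈ f i
  δ-sum zero f = trans (+-cong (*-identityˡ _) (sum-0 {f = λ k → 0# * f (suc k)} λ k → zeroˡ _)) (+-identityʳ _)
  δ-sum (suc i) f = trans (+-cong (zeroˡ _) (δ-sum i (f ∘ suc))) (+-identityˡ _)

  δ-sym : ∀ {n} (i j : Fin n) → δ i j ≈ δ j i
  δ-sym zero    zero    = refl
  δ-sym zero    (suc j) = refl
  δ-sym (suc i) zero    = refl
  δ-sym (suc i) (suc j) = δ-sym i j

  sum-δ : ∀ {n} (f : Fin n → Carrier) j → sum (λ k → f k * δ k j) ≈ f j
  sum-δ f j = trans (sum-cong-≋ λ k → trans (*-comm _ _) (*-congʳ (δ-sym k j))) (δ-sum j f)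

  det-δ : ∀ n → det (δ {n}) ≈ 1#
  det-δ zero    = refl
  det-δ (suc n) = trans (+-cong (trans (*-cong (*-identityˡ 1#) (det-δ n)) (*-identityˡ 1#))
    (sum-0 {n} {λ j → sgn (suc j) * 0# * det λ i k → δ (suc i) (punchIn (suc j) k)} λ j →
      trans (*-congʳ {det λ i k → δ (suc i) (punchIn (suc j) k)} (zeroʳ (sgn (suc j)))) (zeroˡ _)))
    (+-identityʳ 1#)

  -- Each row of `x ⊗ B` is linear in the same row of `x`, so the determinant is an alternating form
  -- in `x`.
  cauchy-binet : ∀ {n a} (x : Mat n a) (B : Mat a n) →
    det (x ⊗ B) ≈ sumInc a n λ I → det (λ i → B (I i)) * det λ j i → x i (I j)
  cauchy-binet {n} {a} x B = trans
    (alternating-expansion a n (alternating-∘ (⊗-linear B) (det-alternating n)) x)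
    (sumInc-cong a n λ I → *-congʳ (det-cong λ i j → δ-sum (I i) λ k → B k j))

  det-⊗-ᵀ : ∀ {n} (x B : Mat n n) → det (x ⊗ B) ≈ det B * det (x ᵀ)
  det-⊗-ᵀ {n} x B = trans (cauchy-binet x B) (sumInc-full n λ e →
    *-cong (det-cong λ i j → reflexive (≡.cong (λ k → B k j) (e i)))
      (det-cong λ j i → reflexive (≡.cong (x i) (e j))))

  -- Since `alternating-expansion` produces transposed minors, the square case of Cauchy-Binet with
  -- the identity as second factor compares `x` with its transpose.
  det-ᵀ : ∀ {n} (x : Mat n n) → det (x ᵀ) ≈ det x
  det-ᵀ {n} x = sym (begin
    det x                 ≈⟨ det-cong (λ i j → sum-δ (x i) j) ⟨
    det (x ⊗ δ)           ≈⟨ det-⊗-ᵀ x δ ⟩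
    det (δ {n}) * det (x ᵀ)   ≈⟨ trans (*-congʳ (det-δ n)) (*-identityˡ _) ⟩
    det (x ᵀ)             ∎)

  det-⊗ : ∀ {n} (x B : Mat n n) → det (x ⊗ B) ≈ det x * det B
  det-⊗ x B = trans (det-⊗-ᵀ x B) (trans (*-comm _ _) (*-congʳ (det-ᵀ x)))

  -- Block matrices and Schur complements.

  infixl 6 _⊞_
  _⊞_ : ∀ {n k} → Mat n k → Mat n k → Mat n k
  (M ⊞ N) i j = M i j + N i j

  𝟘 : ∀ {n k} → Mat n k
  𝟘 i j = 0#

  block : ∀ {n m p q} → Mat n p → Mat n q → Mat m p → Mat m q → Mat (n ℕ.+ m) (p ℕ.+ q)
  block P Q R S = (λ i → P i ++ Q i) ++ (λ i → R i ++ S i)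

  module _ {a} {X : Set a} where
    ++-ˡ : ∀ {n m} (u : Fin n → X) (v : Fin m → X) i → (u ++ v) (i ↑ˡ m) ≡ u i
    ++-ˡ {n} {m} u v i = ≡.cong [ u , v ]′ (splitAt-↑ˡ n i m)

    ++-ʳ : ∀ {n m} (u : Fin n → X) (v : Fin m → X) i → (u ++ v) (n ↑ʳ i) ≡ v i
    ++-ʳ {n} {m} u v i = ≡.cong [ u , v ]′ (splitAt-↑ʳ n m i)

    ++-suc : ∀ {n m} (u : Fin (suc n) → X) (v : Fin m → X) i → (u ++ v) (suc i) ≡ ((u ∘ suc) ++ v) i
    ++-suc {n} u v i with splitAt n i
    ... | inj₁ _ = ≡.refl
    ... | inj₂ _ = ≡.refl

    ++-punchIn : ∀ {n m} (u : Fin (suc n) → X) (v : Fin m → X) i (c : Fin (n ℕ.+ m)) →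
      (u ++ v) (punchIn (i ↑ˡ m) c) ≡ ((u ∘ punchIn i) ++ v) c
    ++-punchIn u v zero c = ++-suc u v c
    ++-punchIn {suc n} u v (suc i) zero = ≡.refl
    ++-punchIn {suc n} u v (suc i) (suc c) = ≡.trans (++-suc u v (punchIn (i ↑ˡ _) c))
      (≡.trans (++-punchIn (u ∘ suc) v i c) (≡.sym (++-suc (u ∘ punchIn (suc i)) v c)))

  ++-sum : ∀ {n m} (u : Fin n → Carrier) (v : Fin m → Carrier) (f : Fin (n ℕ.+ m) → Carrier) →
    sum (λ k → (u ++ v) k * f k) ≈ sum (λ k → u k * f (k ↑ˡ m)) + sum (λ k → v k * f (n ↑ʳ k))
  ++-sum {n} u v f = trans (sum-++ n λ k → (u ++ v) k * f k) (+-cong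
    (sum-cong-≋ λ k → *-congʳ (reflexive (++-ˡ u v k))) (sum-cong-≋ λ k → *-congʳ (reflexive (++-ʳ u v k))))

  block-cong : ∀ {n m p q} {P P′ : Mat n p} {Q Q′ : Mat n q} {R R′ : Mat m p} {S S′ : Mat m q} →
    P ≋ P′ → Q ≋ Q′ → R ≋ R′ → S ≋ S′ → block P Q R S ≋ block P′ Q′ R′ S′
  block-cong {n} {p = p} e f g h i j with splitAt n i
  ... | inj₁ i with splitAt p j
  ...   | inj₁ j = e i j
  ...   | inj₂ j = f i j
  block-cong {n} {p = p} e f g h _ j | inj₂ i with splitAt p j
  ...   | inj₁ j = g i j
  ...   | inj₂ j = h i j

  block-ᵀ : ∀ {n m p q} (P : Mat n p) (Q : Mat n q) (R : Mat m p) (S : Mat m q) →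
    block P Q R S ᵀ ≋ block (P ᵀ) (R ᵀ) (Q ᵀ) (S ᵀ)
  block-ᵀ {n} {p = p} P Q R S j i with splitAt p j in eq
  ... | inj₁ j with splitAt n i
  ...   | inj₁ i = reflexive (≡.cong [ P i , Q i ]′ eq)
  ...   | inj₂ i = reflexive (≡.cong [ R i , S i ]′ eq)
  block-ᵀ {n} {p = p} P Q R S _ i | inj₂ j with splitAt n i
  ...   | inj₁ i = reflexive (≡.cong [ P i , Q i ]′ eq)
  ...   | inj₂ i = reflexive (≡.cong [ R i , S i ]′ eq)

  det-block-ᵀ : ∀ {n m} (P : Mat n n) (Q : Mat n m) (R : Mat m n) (S : Mat m m) →
    det (block P Q R S) ≈ det (block (P ᵀ) (R ᵀ) (Q ᵀ) (S ᵀ))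
  det-block-ᵀ P Q R S = trans (sym (det-ᵀ (block P Q R S))) (det-cong (block-ᵀ P Q R S))

  block-⊗ : ∀ {n m p q r s} (P : Mat n p) (Q : Mat n q) (R : Mat m p) (S : Mat m q)
    (P′ : Mat p r) (Q′ : Mat p s) (R′ : Mat q r) (S′ : Mat q s) →
    block P Q R S ⊗ block P′ Q′ R′ S′ ≋
    block (P ⊗ P′ ⊞ Q ⊗ R′) (P ⊗ Q′ ⊞ Q ⊗ S′) (R ⊗ P′ ⊞ S ⊗ R′) (R ⊗ Q′ ⊞ S ⊗ S′)
  block-⊗ {n} {m} {p} {q} {r} {s} P Q R S P′ Q′ R′ S′ i j = row
    where
    column : ∀ (u : Fin p → Carrier) (v : Fin q → Carrier) →
      sum (λ k → (u ++ v) k * block P′ Q′ R′ S′ k j) ≈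
      ((λ j → sum (λ k → u k * P′ k j) + sum (λ k → v k * R′ k j)) ++
       (λ j → sum (λ k → u k * Q′ k j) + sum (λ k → v k * S′ k j))) j
    column u v = trans (++-sum u v λ k → block P′ Q′ R′ S′ k j)
      (trans (+-cong (sum-cong-≋ λ k → *-congˡ (reflexive (≡.cong (λ w → w j) (++-ˡ (λ i → P′ i ++ Q′ i) (λ i → R′ i ++ S′ i) k))))
                     (sum-cong-≋ λ k → *-congˡ (reflexive (≡.cong (λ w → w j) (++-ʳ (λ i → P′ i ++ Q′ i) (λ i → R′ i ++ S′ i) k)))))
        split)
      where
      split : sum (λ k → u k * (P′ k ++ Q′ k) j) + sum (λ k → v k * (R′ k ++ S′ k) j) ≈
        ((λ j → sum (λ k → u k * P′ k j) + sum (λ k → v k * R′ k j)) ++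
         (λ j → sum (λ k → u k * Q′ k j) + sum (λ k → v k * S′ k j))) j
      split with splitAt r j
      ... | inj₁ j = refl
      ... | inj₂ j = refl
    row : sum (λ k → block P Q R S i k * block P′ Q′ R′ S′ k j) ≈
      block (P ⊗ P′ ⊞ Q ⊗ R′) (P ⊗ Q′ ⊞ Q ⊗ S′) (R ⊗ P′ ⊞ S ⊗ R′) (R ⊗ Q′ ⊞ S ⊗ S′) i j
    row with splitAt n i
    ... | inj₁ i = column (P i) (Q i)
    ... | inj₂ i = column (R i) (S i)

  det-lower : ∀ {n m} (P : Mat n n) (R : Mat m n) (S : Mat m m) → det (block P 𝟘 R S) ≈ det P * det S
  det-lower {zero} P R S = sym (*-identityˡ (det S))
  det-lower {suc n} {m} P R S = begin
    det (block P 𝟘 R S)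
      ≈⟨ sum-++ (suc n) term ⟩
    sum (λ i → term (i ↑ˡ m)) + sum (λ i → term (suc n ↑ʳ i))
      ≈⟨ +-cong (sum-cong-≋ left) (sum-0 right) ⟩
    sum (λ i → sgn i * P zero i * det (λ r c → P (suc r) (punchIn i c)) * det S) + 0#
      ≈⟨ trans (+-identityʳ _) (sym (*-distribʳ-sum (det S) λ i → sgn i * P zero i * det λ r c → P (suc r) (punchIn i c))) ⟩
    det P * det S ∎
    where
    minor : Fin (suc n ℕ.+ m) → Mat (n ℕ.+ m) (n ℕ.+ m)
    minor i r c = block P 𝟘 R S (suc r) (punchIn i c)
    term : Fin (suc n ℕ.+ m) → Carrier
    term i = sgn i * (P zero ++ λ _ → 0#) i * det (minor i)
    minorˡ : ∀ i → minor (i ↑ˡ m) ≋ block (λ r c → P (suc r) (punchIn i c)) 𝟘 (λ r c → R r (punchIn i c)) S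
    minorˡ i r c with splitAt n r
    ... | inj₁ r = reflexive (++-punchIn (P (suc r)) (λ _ → 0#) i c)
    ... | inj₂ r = reflexive (++-punchIn (R r) (S r) i c)
    left : ∀ i → term (i ↑ˡ m) ≈ sgn i * P zero i * det (λ r c → P (suc r) (punchIn i c)) * det S
    left i = trans (*-cong
      (*-cong (reflexive (≡.cong ((- 1#) ^_) (toℕ-↑ˡ i m))) (reflexive (++-ˡ (P zero) (λ _ → 0#) i)))
      (trans (det-cong (minorˡ i)) (det-lower (λ r c → P (suc r) (punchIn i c)) (λ r c → R r (punchIn i c)) S)))
      (sym (*-assoc _ _ _))
    right : ∀ i → term (suc n ↑ʳ i) ≈ 0#
    right i = trans (*-congʳ {det (minor (suc n ↑ʳ i))} (trans (*-congˡ {sgn (suc n ↑ʳ i)}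
      (reflexive (++-ʳ (P zero) (λ _ → 0#) i))) (zeroʳ (sgn (suc n ↑ʳ i))))) (zeroˡ _)

  det-upper : ∀ {n m} (P : Mat n n) (Q : Mat n m) (S : Mat m m) → det (block P Q 𝟘 S) ≈ det P * det S
  det-upper P Q S = trans (det-block-ᵀ P Q 𝟘 S) (trans (det-lower (P ᵀ) (Q ᵀ) (S ᵀ)) (*-cong (det-ᵀ P) (det-ᵀ S)))

  det-block-⊗ : ∀ {n m} (P : Mat n n) (Q : Mat n m) (R : Mat m n) (S : Mat m m)
    (P′ : Mat n n) (Q′ : Mat n m) (R′ : Mat m n) (S′ : Mat m m) {P″ Q″ R″ S″} →
    P ⊗ P′ ⊞ Q ⊗ R′ ≋ P″ → P ⊗ Q′ ⊞ Q ⊗ S′ ≋ Q″ → R ⊗ P′ ⊞ S ⊗ R′ ≋ R″ → R ⊗ Q′ ⊞ S ⊗ S′ ≋ S″ →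
    det (block P″ Q″ R″ S″) ≈ det (block P Q R S) * det (block P′ Q′ R′ S′)
  det-block-⊗ P Q R S P′ Q′ R′ S′ e f g h = trans
    (sym (trans (det-cong (block-⊗ P Q R S P′ Q′ R′ S′)) (det-cong (block-cong e f g h))))
    (det-⊗ (block P Q R S) (block P′ Q′ R′ S′))

  δ⊗ : ∀ {n m} (M : Mat n m) → δ ⊗ M ≋ M
  δ⊗ M i j = δ-sum i λ k → M k j

  ⊗δ : ∀ {n m} (M : Mat n m) → M ⊗ δ ≋ M
  ⊗δ M i j = sum-δ (M i) j

  𝟘⊗ : ∀ {n m p} (M : Mat m p) → 𝟘 {n} ⊗ M ≋ 𝟘
  𝟘⊗ M i j = sum-0 {f = λ k → 0# * M k j} λ k → zeroˡ (M k j)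

  ⊗𝟘 : ∀ {n m p} (M : Mat n m) → M ⊗ 𝟘 {m} {p} ≋ 𝟘
  ⊗𝟘 M i j = sum-0 {f = λ k → M i k * 0#} λ k → zeroʳ (M i k)

  -- `D` takes the place of `S⁻¹ R`, so that `S` may be singular: the matrix is the product of an
  -- upper and a lower block triangular one.
  schur : ∀ {n m} (E : Mat n n) (Q : Mat n m) (D : Mat m n) (S : Mat m m) {P R} →
    E ⊞ Q ⊗ D ≋ P → S ⊗ D ≋ R → det (block P Q R S) ≈ det E * det S
  schur {n} {m} E Q D S e f = begin
    det (block _ Q _ S)
      ≈⟨ det-block-⊗ δ Q 𝟘 S E 𝟘 D δ
           (λ i j → trans (+-congʳ (δ⊗ E i j)) (e i j))
           (λ i j → trans (+-cong (⊗𝟘 δ i j) (⊗δ Q i j)) (+-identityˡ _))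
           (λ i j → trans (+-cong (𝟘⊗ E i j) (f i j)) (+-identityˡ _))
           (λ i j → trans (+-cong (𝟘⊗ (𝟘 {n}) i j) (⊗δ S i j)) (+-identityˡ _)) ⟩
    det (block δ Q 𝟘 S) * det (block E 𝟘 D δ)
      ≈⟨ *-cong (det-upper δ Q S) (det-lower E D δ) ⟩
    det (δ {n}) * det S * (det E * det (δ {m}))
      ≈⟨ *-cong (*-congʳ (det-δ n)) (*-congˡ (det-δ m)) ⟩
    1# * det S * (det E * 1#)
      ≈⟨ solve 2 (λ s e → con 1 :* s :* (e :* con 1) := e :* s) refl (det S) (det E) ⟩
    det E * det S ∎

  -- Determinants that lie in an additive subgroup.

  record AdditiveSubgroup p : Set (Level.suc p Level.⊔ ℓ) where
    field
      member : Carrier → Set p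
      ∈-resp : ∀ {x y} → x ≈ y → member x → member y
      0∈     : member 0#
      +∈     : ∀ {x y} → member x → member y → member (x + y)
      -∈     : ∀ {x} → member x → member (- x)

    -- Abstracts "entry from `R`": for the products of Fitting ideals inside `S⁻¹R`, the image of
    -- `R` consists of multipliers. Entries that equal an element of `R` only after denominators
    -- cancel are covered as well.
    Multiplier : Carrier → Set (p Level.⊔ ℓ)
    Multiplier r = ∀ {x} → member x → member (r * x)

    sum-∈ : ∀ {n} {f : Fin n → Carrier} → (∀ i → member (f i)) → member (sum f)
    sum-∈ {zero}  h = 0∈
    sum-∈ {suc n} h = +∈ (h zero) (sum-∈ (h ∘ suc))

    sgn-multiplier : ∀ {n} (i : Fin n) → Multiplier (sgn i)
    sgn-multiplier zero    x∈ = ∈-resp (sym (*-identityˡ _)) x∈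
    sgn-multiplier (suc i) x∈ = ∈-resp (trans (sym (-1*x≈-x _)) (sym (*-assoc _ _ _))) (-∈ (sgn-multiplier i x∈))

    -- Laplace expansion along the `k` upper rows, repeated. Admitting all maps `σ`, not only
    -- increasing ones, keeps the family closed under composition with `punchIn`, and the minors to
    -- which this is applied have the required property for any choice of columns.
    laplace-rows : ∀ k n (T : Mat k (k ℕ.+ n)) (U : Mat n (k ℕ.+ n)) → (∀ i j → Multiplier (T i j)) →
      (∀ (σ : Fin n → Fin (k ℕ.+ n)) → member (det λ i j → U i (σ j))) → member (det (T ++ U))
    laplace-rows zero    n T U T∈ h = h id
    laplace-rows (suc k) n T U T∈ h = sum-∈ λ j → ∈-resp (sym (*-assoc _ _ _))
      (sgn-multiplier j (T∈ zero j (∈-resp (det-cong λ i c → reflexive (minor j i c))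
        (laplace-rows k n (λ i c → T (suc i) (punchIn j c)) (λ i c → U i (punchIn j c))
          (λ i c → T∈ (suc i) (punchIn j c)) (λ σ → h (punchIn j ∘ σ))))))
      where
      minor : ∀ j i c → ((λ i c → T (suc i) (punchIn j c)) ++ (λ i c → U i (punchIn j c))) i c ≡ (T ++ U) (suc i) (punchIn j c)
      minor j i c with splitAt k i
      ... | inj₁ _ = ≡.refl
      ... | inj₂ _ = ≡.refl

    multiplier-++ : ∀ {n m} {u : Fin n → Carrier} {v : Fin m → Carrier} →
      (∀ j → Multiplier (u j)) → (∀ j → Multiplier (v j)) → ∀ j → Multiplier ((u ++ v) j)
    multiplier-++ {n} p q j with splitAt n j
    ... | inj₁ j = p j
    ... | inj₂ j = q j

    laplace-top : ∀ {n m} (P : Mat n n) (Q : Mat n m) (R : Mat m n) (S : Mat m m) →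
      (∀ i j → Multiplier (P i j)) → (∀ i j → Multiplier (Q i j)) →
      (∀ (σ : Fin m → Fin (n ℕ.+ m)) → member (det λ i j → (R i ++ S i) (σ j))) → member (det (block P Q R S))
    laplace-top P Q R S p q h =
      laplace-rows _ _ (λ i → P i ++ Q i) (λ i → R i ++ S i) (λ i → multiplier-++ (p i) (q i)) h

    laplace-left : ∀ {n m} (P : Mat n n) (Q : Mat n m) (R : Mat m n) (S : Mat m m) →
      (∀ i j → Multiplier (P i j)) → (∀ i j → Multiplier (R i j)) →
      (∀ (σ : Fin m → Fin (n ℕ.+ m)) → member (det λ i j → (Q ++ S) (σ i) j)) → member (det (block P Q R S))
    laplace-left {n} {m} P Q R S p r h = ∈-resp (sym (det-block-ᵀ P Q R S))
      (laplace-top (P ᵀ) (R ᵀ) (Q ᵀ) (S ᵀ) (λ i j → p j i) (λ i j → r j i)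
        λ σ → ∈-resp (trans (sym (det-ᵀ (λ i j → (Q ++ S) (σ i) j))) (det-cong λ i j → reflexive (swapped σ i j))) (h σ))
      where
      swapped : ∀ (σ : Fin m → Fin (n ℕ.+ m)) (i j : Fin m) → (Q ++ S) (σ j) i ≡ ((Q ᵀ) i ++ (S ᵀ) i) (σ j)
      swapped σ i j with splitAt n (σ j)
      ... | inj₁ _ = ≡.refl
      ... | inj₂ _ = ≡.refl

  ⊟_ : ∀ {n k} → Mat n k → Mat n k
  (⊟ M) i j = - M i j

  ⊗-cong : ∀ {n m p} {M M′ : Mat n m} {N N′ : Mat m p} → M ≋ M′ → N ≋ N′ → M ⊗ N ≋ M′ ⊗ N′
  ⊗-cong e f i j = sum-cong-≋ λ k → *-cong (e i k) (f k j)

  ⊗-assoc : ∀ {n m p q} (M : Mat n m) (N : Mat m p) (L : Mat p q) → (M ⊗ N) ⊗ L ≋ M ⊗ (N ⊗ L)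
  ⊗-assoc M N L i j = begin
    sum (λ k → sum (λ l → M i l * N l k) * L k j)    ≈⟨ sum-cong-≋ (λ k → *-distribʳ-sum (L k j) λ l → M i l * N l k) ⟩
    sum (λ k → sum (λ l → M i l * N l k * L k j))    ≈⟨ ∑-comm (λ k l → M i l * N l k * L k j) ⟩
    sum (λ l → sum (λ k → M i l * N l k * L k j))
      ≈⟨ sum-cong-≋ (λ l → sum-pull (M i l) (λ k → N l k * L k j) λ k → *-assoc (M i l) (N l k) (L k j)) ⟩
    sum (λ l → M i l * sum (λ k → N l k * L k j))    ∎

  ⊗-⊞ : ∀ {n m p} (M : Mat n m) (N L : Mat m p) → M ⊗ (N ⊞ L) ≋ M ⊗ N ⊞ M ⊗ L
  ⊗-⊞ M N L i j = trans (sum-cong-≋ λ k → distribˡ (M i k) (N k j) (L k j))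
    (∑-distrib-+ (λ k → M i k * N k j) (λ k → M i k * L k j))

  ⊞-⊗ : ∀ {n m p} (M N : Mat n m) (L : Mat m p) → (M ⊞ N) ⊗ L ≋ M ⊗ L ⊞ N ⊗ L
  ⊞-⊗ M N L i j = trans (sum-cong-≋ λ k → distribʳ (L k j) (M i k) (N i k))
    (∑-distrib-+ (λ k → M i k * L k j) (λ k → N i k * L k j))

  ⊟⊗ : ∀ {n m p} (M : Mat n m) (N : Mat m p) → (⊟ M) ⊗ N ≋ ⊟ (M ⊗ N)
  ⊟⊗ M N i j = trans (sum-pull (- 1#) (λ k → M i k * N k j) λ k →
    trans (*-congʳ (sym (-1*x≈-x (M i k)))) (*-assoc (- 1#) (M i k) (N k j))) (-1*x≈-x _)

  ⊗⊟ : ∀ {n m p} (M : Mat n m) (N : Mat m p) → M ⊗ (⊟ N) ≋ ⊟ (M ⊗ N)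
  ⊗⊟ M N i j = trans (sum-pull (- 1#) (λ k → M i k * N k j) λ k →
    trans (sym (-‿distribʳ-* (M i k) (N k j))) (sym (-1*x≈-x (M i k * N k j)))) (-1*x≈-x _)

  module _ {p} (N : AdditiveSubgroup p) where
    open AdditiveSubgroup N

    multiplier-resp : ∀ {r s} → r ≈ s → Multiplier r → Multiplier s
    multiplier-resp e h x∈ = ∈-resp (*-congʳ e) (h x∈)

    multiplier-0 : Multiplier 0#
    multiplier-0 x∈ = ∈-resp (sym (zeroˡ _)) 0∈

    multiplier-1 : Multiplier 1#
    multiplier-1 x∈ = ∈-resp (sym (*-identityˡ _)) x∈

    multiplier-+ : ∀ {r s} → Multiplier r → Multiplier s → Multiplier (r + s)
    multiplier-+ h k x∈ = ∈-resp (sym (distribʳ _ _ _)) (+∈ (h x∈) (k x∈))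

    multiplier-* : ∀ {r s} → Multiplier r → Multiplier s → Multiplier (r * s)
    multiplier-* h k x∈ = ∈-resp (sym (*-assoc _ _ _)) (h (k x∈))

    multiplier-neg : ∀ {r} → Multiplier r → Multiplier (- r)
    multiplier-neg h x∈ = ∈-resp (-‿distribˡ-* _ _) (-∈ (h x∈))

    multiplier-sum : ∀ {n} {f : Fin n → Carrier} → (∀ i → Multiplier (f i)) → Multiplier (sum f)
    multiplier-sum {zero}  h = multiplier-0
    multiplier-sum {suc n} {f} h = multiplier-+ {f zero} {sum (f ∘ suc)} (h zero) (multiplier-sum {f = f ∘ suc} (h ∘ suc))

    multiplier-δ : ∀ {n} (i j : Fin n) → Multiplier (δ i j)
    multiplier-δ zero    zero    = multiplier-1
    multiplier-δ zero    (suc j) = multiplier-0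
    multiplier-δ (suc i) zero    = multiplier-0
    multiplier-δ (suc i) (suc j) = multiplier-δ i j

    -- Carries a fixed factor, such as a minor of `κ`, through a Laplace expansion of the other
    -- factor.
    scaled : Carrier → AdditiveSubgroup p
    scaled c = record
      { member = λ x → member (c * x)
      ; ∈-resp = λ e → ∈-resp (*-congˡ e)
      ; 0∈ = ∈-resp (sym (zeroʳ c)) 0∈
      ; +∈ = λ x∈ y∈ → ∈-resp (sym (distribˡ c _ _)) (+∈ x∈ y∈)
      ; -∈ = λ x∈ → ∈-resp (-‿distribʳ-* c _) (-∈ x∈) }

    scaled-multiplier : ∀ c {r} → Multiplier r → AdditiveSubgroup.Multiplier (scaled c) r
    scaled-multiplier c {r} h {x} x∈ =
      ∈-resp (solve 3 (λ c r x → r :* (c :* x) := c :* (r :* x)) refl c r x) (h x∈)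

  -- The defect `W`: if `Ĥ ⊗ κ ≋ δ`, it is the idempotent complementary to `κ ⊗ Ĥ`, and it vanishes
  -- when the dual basis is a basis.
  complement : ∀ {m b} → Mat b m → Mat m b → Mat b b
  complement κ Ĥ = δ ⊞ ⊟ (κ ⊗ Ĥ)

  module _ {p} (N : AdditiveSubgroup p) where
    open AdditiveSubgroup N

    -- `C` writes the old generators in the new ones and `B` the new in the old, so the rows of
    -- `U ⊗ C` and of `1 - B ⊗ C` are relations between the new generators. Bordering `U` by them
    -- through unipotent factors preserves its determinant, and the columns of `U` and `- B` can be
    -- expanded away.
    det-change-generators : ∀ {n m} (U : Mat n n) (C : Mat n m) (B : Mat m n) →
      (∀ i j → Multiplier (U i j)) → (∀ i j → Multiplier (B i j)) →
      (∀ (σ : Fin m → Fin (n ℕ.+ m)) → member (det λ i j → ((U ⊗ C) ++ (δ ⊞ ⊟ (B ⊗ C))) (σ i) j)) →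
      member (det U)
    det-change-generators {n} {m} U C B U∈ B∈ h = ∈-resp eq
      (laplace-left U (U ⊗ C) (⊟ B) (δ ⊞ ⊟ (B ⊗ C)) U∈ (λ i j → multiplier-neg N {B i j} (B∈ i j)) h)
      where
      eq : det (block U (U ⊗ C) (⊟ B) (δ ⊞ ⊟ (B ⊗ C))) ≈ det U
      eq = begin
        det (block U (U ⊗ C) (⊟ B) (δ ⊞ ⊟ (B ⊗ C)))
          ≈⟨ det-block-⊗ U 𝟘 (⊟ B) δ δ C 𝟘 δ
              (λ i j → trans (+-cong (⊗δ U i j) (𝟘⊗ {n} (𝟘 {m}) i j)) (+-identityʳ _))
              (λ i j → trans (+-congˡ (𝟘⊗ (δ {m}) i j)) (+-identityʳ _))
              (λ i j → trans (+-cong (⊗δ (⊟ B) i j) (⊗𝟘 (δ {m}) i j)) (+-identityʳ _))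
              (λ i j → trans (+-comm _ _) (+-cong (δ⊗ (δ {m}) i j) (⊟⊗ B C i j))) ⟩
        det (block U 𝟘 (⊟ B) δ) * det (block δ C 𝟘 δ)
          ≈⟨ *-cong (det-lower U (⊟ B) δ) (det-upper δ C δ) ⟩
        det U * det (δ {m}) * (det (δ {n}) * det (δ {m}))
          ≈⟨ *-cong (*-congˡ (det-δ m)) (*-cong (det-δ n) (det-δ m)) ⟩
        det U * 1# * (1# * 1#)
          ≈⟨ solve 1 (λ u → u :* con 1 :* (con 1 :* con 1) := u) refl (det U) ⟩
        det U ∎

    module _ {m b} (κ : Mat b m) (Ĥ : Mat m b) where

      -- det Y det T is the determinant of a matrix whose last b rows are (κ T, W).
      det-dual : ∀ (H : Mat m b) (T : Mat m m) {Y : Mat m m} → H ⊗ κ ≋ Y →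
        (∀ i j → Multiplier (H i j)) →
        (∀ (σ : Fin b → Fin (m ℕ.+ b)) → member (det λ i j → ((κ ⊗ T) i ++ complement κ Ĥ i) (σ j))) →
        member (det Y * det T)
      det-dual H T {Y} Hκ≋Y H∈ h = ∈-resp eq
        (laplace-top 𝟘 (⊟ H) (κ ⊗ T) (complement κ Ĥ) (λ i j → multiplier-0 N) (λ i j → multiplier-neg N {H i j} (H∈ i j)) h)
        where
        eq : det (block 𝟘 (⊟ H) (κ ⊗ T) (complement κ Ĥ)) ≈ det Y * det T
        eq = begin
          det (block 𝟘 (⊟ H) (κ ⊗ T) (complement κ Ĥ))
            ≈⟨ det-block-⊗ 𝟘 (⊟ H) κ δ T (⊟ Ĥ) 𝟘 δ
                (λ i j → trans (+-cong (𝟘⊗ {m} T i j) (⊗𝟘 (⊟ H) i j)) (+-identityʳ _))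
                (λ i j → trans (+-cong (𝟘⊗ {m} (⊟ Ĥ) i j) (⊗δ (⊟ H) i j)) (+-identityˡ _))
                (λ i j → trans (+-congˡ (⊗𝟘 (δ {b}) i j)) (+-identityʳ _))
                (λ i j → trans (+-comm _ _) (+-cong (δ⊗ (δ {b}) i j) (⊗⊟ κ Ĥ i j))) ⟩
          det (block 𝟘 (⊟ H) κ δ) * det (block T (⊟ Ĥ) 𝟘 δ)
            ≈⟨ *-cong (schur Y (⊟ H) κ δ
                  (λ i j → trans (+-cong (sym (Hκ≋Y i j)) (⊟⊗ H κ i j)) (-‿inverseʳ _)) (δ⊗ κ))
                (det-upper T (⊟ Ĥ) δ) ⟩
          det Y * det (δ {b}) * (det T * det (δ {b}))
            ≈⟨ *-cong (*-congˡ (det-δ b)) (*-congˡ (det-δ b)) ⟩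
          det Y * 1# * (det T * 1#)
            ≈⟨ solve 2 (λ y t → y :* con 1 :* (t :* con 1) := y :* t) refl (det Y) (det T) ⟩
          det Y * det T ∎

  -- Exchanging minors of a presentation for minors of its dual, and back.

  module _ {p} (N : AdditiveSubgroup p) where
    open AdditiveSubgroup N

    module _ {m b} (κ : Mat b m) (Ĥ : Mat m b) where

      -- Cauchy-Binet splits minors of `A₁` off `det X`. The remaining factor times `det Y` is, by a
      -- Schur complement, the determinant of a matrix with upper rows `(G, - Z)` made of
      -- multipliers. Its lower rows `(Y D′, Y)` are `Y` times `(D′, 1)`, so their minors are
      -- products `det Y det T`, to which `det-dual` applies.
      presentation-to-dual : ∀ {n a q} (Column : (Fin b → Carrier) → Set q)
        (A₁ : Mat a n) (D : Mat m a) {F G : Mat n a} {X : Mat n n} {Y : Mat m m} (Z : Mat n m) (H : Mat m b) →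
        F ⊗ A₁ ≋ X → F ≋ G ⊞ Z ⊗ D → H ⊗ κ ≋ Y →
        (∀ i j → Multiplier (G i j)) → (∀ i j → Multiplier (Z i j)) → (∀ i j → Multiplier (H i j)) →
        (∀ j → Column λ i → complement κ Ĥ i j) → (∀ j → Column λ i → (κ ⊗ D) i j) → (∀ j → Column λ i → (κ ⊗ δ) i j) →
        (∀ (I : Fin n → Fin a) (V : Mat b b) → (∀ j → Column λ i → V i j) → member (det (λ i → A₁ (I i)) * det V)) →
        member (det Y * det X)
      presentation-to-dual {n} {a} Column A₁ D {F} {G} {X} {Y} Z H FA≋X F≋ Hκ≋Y G∈ Z∈ H∈ colW colD colδ h =
        ∈-resp (trans (*-comm _ _) (*-congˡ (trans (sym (cauchy-binet F A₁)) (det-cong FA≋X))))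
          (∈-resp (trans (*-comm (det Y) _) refl) (∈-resp (sumInc-* a n (det Y) {minors} λ I → refl)
            (sumInc-closed member 0∈ +∈ a n each)))
        where
        minors : (Fin n → Fin a) → Carrier
        minors I = det (λ i → A₁ (I i)) * det λ j i → F i (I j)
        each : ∀ I → member (det Y * minors I)
        each I = ∈-resp eq (laplace-top′ (λ i j → G i (I j)) (⊟ Z) (Y ⊗ D′) Y
            (λ i j → scaled-multiplier N c (G∈ i (I j)))
            (λ i j → scaled-multiplier N c (multiplier-neg N {Z i j} (Z∈ i j)))
            λ τ → AdditiveSubgroup.∈-resp N′ (minor τ) (det-dual N′ κ Ĥ H (T τ) Hκ≋Y
              (λ i j → scaled-multiplier N c (H∈ i j))
              λ σ → h I (λ i j → ((κ ⊗ T τ) i ++ complement κ Ĥ i) (σ j)) (columns τ σ)))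
          where
          c : Carrier
          c = det (λ i → A₁ (I i))
          N′ : AdditiveSubgroup p
          N′ = scaled N c
          open AdditiveSubgroup N′ using () renaming (laplace-top to laplace-top′)
          D′ : Mat m n
          D′ i j = D i (I j)
          T : (Fin m → Fin (n ℕ.+ m)) → Mat m m
          T τ i j = (D′ i ++ δ i) (τ j)
          minor : ∀ (τ : Fin m → Fin (n ℕ.+ m)) → det Y * det (T τ) ≈ det λ i j → ((Y ⊗ D′) i ++ Y i) (τ j)
          minor τ = trans (sym (det-⊗ Y (T τ))) (det-cong entry)
            where
            entry : ∀ i j → (Y ⊗ T τ) i j ≈ ((Y ⊗ D′) i ++ Y i) (τ j)
            entry i j with splitAt n (τ j)
            ... | inj₁ _ = refl
            ... | inj₂ l = ⊗δ Y i l
          columns : ∀ (τ : Fin m → Fin (n ℕ.+ m)) (σ : Fin b → Fin (m ℕ.+ b)) j → Column λ i → ((κ ⊗ T τ) i ++ complement κ Ĥ i) (σ j)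
          columns τ σ j with splitAt m (σ j)
          ... | inj₂ l = colW l
          ... | inj₁ l with splitAt n (τ l)
          ...   | inj₁ l = colD (I l)
          ...   | inj₂ l = colδ l
          eq : c * det (block (λ i j → G i (I j)) (⊟ Z) (Y ⊗ D′) Y) ≈ det Y * minors I
          eq = begin
            c * det (block (λ i j → G i (I j)) (⊟ Z) (Y ⊗ D′) Y)
              ≈⟨ *-congˡ (schur (λ i j → F i (I j)) (⊟ Z) D′ Y
                   (λ i j → trans (+-cong (F≋ i (I j)) (⊟⊗ Z D′ i j)) (trans (+-assoc _ _ _)
                     (trans (+-congˡ (-‿inverseʳ _)) (+-identityʳ _)))) λ i j → refl) ⟩
            c * (det (λ i j → F i (I j)) * det Y)
              ≈⟨ *-congˡ (*-congʳ (det-ᵀ (λ i j → F i (I j)))) ⟨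
            c * (det (λ j i → F i (I j)) * det Y)
              ≈⟨ solve 3 (λ c f y → c :* (f :* y) := y :* (c :* f)) refl c _ (det Y) ⟩
            det Y * minors I ∎

  alternating-++ : ∀ {k n w} {f : Mat (k ℕ.+ n) w → Carrier} → Alternating (k ℕ.+ n) f → (T : Mat k w) →
    Alternating n λ t → f (T ++ t)
  alternating-++ {zero} alt T = alt
  alternating-++ {suc k} {n} {w} alt T =
    alternating-resp (λ t → Alternating.cong alt (rows t)) (alternating-++ (fix alt (T zero)) (T ∘ suc))
    where
    rows : ∀ (t : Mat n w) → (T zero ∷ ((T ∘ suc) ++ t)) ≋ (T ++ t)
    rows t zero    j = refl
    rows t (suc i) j = reflexive (≡.cong (λ u → u j) (≡.sym (++-suc T t i)))

  append-0-linear : ∀ {k} l → Linear {k} {k ℕ.+ l} (λ u → u ++ λ _ → 0#)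
  append-0-linear {k} l = record { cong = cong ; linear = linear }
    where
    cong : ∀ {u v : Fin k → Carrier} → (∀ j → u j ≈ v j) → ∀ j → (u ++ λ _ → 0#) j ≈ (v ++ λ _ → 0#) j
    cong e j with splitAt k j
    ... | inj₁ j = e j
    ... | inj₂ j = refl
    linear : ∀ c d (u v : Fin k → Carrier) (j : Fin (k ℕ.+ l)) →
      ((λ i → c * u i + d * v i) ++ λ _ → 0#) j ≈ c * (u ++ λ _ → 0#) j + d * (v ++ λ _ → 0#) j
    linear c d u v j with splitAt k j
    ... | inj₁ j = refl
    ... | inj₂ j = solve 2 (λ c d → con 0 := c :* con 0 :+ d :* con 0) refl c d

  module _ {m b} (κ : Mat b m) (Ĥ : Mat m b) (Ĥκ≋δ : Ĥ ⊗ κ ≋ δ) (U : Mat b b) where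
    private
      W : Mat b b
      W = complement κ Ĥ
      Λ : Mat m b
      Λ = Ĥ ⊗ U

      complement-⊗ : W ⊗ U ≋ U ⊞ κ ⊗ (⊟ Λ)
      complement-⊗ i j = trans (⊞-⊗ δ (⊟ (κ ⊗ Ĥ)) U i j) (+-cong (δ⊗ U i j)
        (trans (⊟⊗ (κ ⊗ Ĥ) U i j) (trans (-‿cong (⊗-assoc κ Ĥ U i j)) (sym (⊗⊟ κ Λ i j)))))

      annihilated : Ĥ ⊗ (W ⊗ U) ≋ 𝟘
      annihilated i j = begin
        (Ĥ ⊗ (W ⊗ U)) i j                   ≈⟨ ⊗-cong {M = Ĥ} (λ _ _ → refl) complement-⊗ i j ⟩
        (Ĥ ⊗ (U ⊞ κ ⊗ (⊟ Λ))) i j           ≈⟨ ⊗-⊞ Ĥ U (κ ⊗ (⊟ Λ)) i j ⟩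
        Λ i j + (Ĥ ⊗ (κ ⊗ (⊟ Λ))) i j       ≈⟨ +-congˡ (⊗-assoc Ĥ κ (⊟ Λ) i j) ⟨
        Λ i j + ((Ĥ ⊗ κ) ⊗ (⊟ Λ)) i j       ≈⟨ +-congˡ (⊗-cong {N = ⊟ Λ} Ĥκ≋δ (λ _ _ → refl) i j) ⟩
        Λ i j + (δ ⊗ (⊟ Λ)) i j             ≈⟨ +-congˡ (δ⊗ (⊟ Λ) i j) ⟩
        Λ i j + - Λ i j                     ≈⟨ -‿inverseʳ _ ⟩
        0#                                  ∎

    -- Separates `W ⊗ U`, which will be over `R`, from `Λ`, which has denominators. That `κ` becomes
    -- a block of its own allows an expansion in its minors. The zero block comes from `Ĥ ⊗ κ ≋ δ`,
    -- and `- Λ` survives beside it because `Ĥ` annihilates `W ⊗ U`.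
    det-split : det (block (W ⊗ U) κ (⊟ Λ) 𝟘) ≈ det U
    det-split = begin
      det (block (W ⊗ U) κ (⊟ Λ) 𝟘)
        ≈⟨ det-block-⊗ δ 𝟘 (⊟ Ĥ) δ (W ⊗ U) κ (⊟ Λ) δ
             (λ i j → trans (+-cong (δ⊗ (W ⊗ U) i j) (𝟘⊗ (⊟ Λ) i j)) (+-identityʳ _))
             (λ i j → trans (+-cong (δ⊗ κ i j) (𝟘⊗ (δ {m}) i j)) (+-identityʳ _))
             (λ i j → trans (+-cong (trans (⊟⊗ Ĥ (W ⊗ U) i j) (trans (-‿cong (annihilated i j)) -0#≈0#)) (δ⊗ (⊟ Λ) i j)) (+-identityˡ _))
             (λ i j → trans (+-cong (trans (⊟⊗ Ĥ κ i j) (-‿cong (Ĥκ≋δ i j))) (δ⊗ (δ {m}) i j)) (-‿inverseˡ _)) ⟩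
      det (block δ 𝟘 (⊟ Ĥ) δ) * det (block (W ⊗ U) κ (⊟ Λ) δ)
        ≈⟨ *-cong (det-lower δ (⊟ Ĥ) δ) (schur U κ (⊟ Λ) δ (λ i j → sym (complement-⊗ i j)) (δ⊗ (⊟ Λ))) ⟩
      det (δ {b}) * det (δ {m}) * (det U * det (δ {m}))
        ≈⟨ *-cong (*-cong (det-δ b) (det-δ m)) (*-congˡ (det-δ m)) ⟩
      1# * 1# * (det U * 1#)
        ≈⟨ solve 1 (λ u → con 1 :* con 1 :* (u :* con 1) := u) refl (det U) ⟩
      det U ∎

    -- The determinant is alternating in the columns of the block `κ`. Expanding in them leaves
    -- columns of the identity in place of `κ`, and as coefficients the minors of `κ`, which will be
    -- minors of relations of `P₂`.
    det-split-expansion : det U ≈ sumInc b m λ I → det (block (W ⊗ U) ((δ ∘ I) ᵀ) (⊟ Λ) 𝟘) * det (κ ∘ I)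
    det-split-expansion = begin
      det U                                                    ≈⟨ det-split ⟨
      det (block (W ⊗ U) κ (⊟ Λ) 𝟘)                            ≈⟨ det-block-ᵀ (W ⊗ U) κ (⊟ Λ) 𝟘 ⟩
      form (κ ᵀ)                                               ≈⟨ alternating-expansion b m form-alternating (κ ᵀ) ⟩
      sumInc b m (λ I → form (δ ∘ I) * det (κ ∘ I))
        ≈⟨ sumInc-cong b m (λ I → *-congʳ (det-block-ᵀ ((W ⊗ U) ᵀ) ((⊟ Λ) ᵀ) (δ ∘ I) 𝟘)) ⟩
      sumInc b m (λ I → det (block (W ⊗ U) ((δ ∘ I) ᵀ) (⊟ Λ) 𝟘) * det (κ ∘ I)) ∎
      where
      form : Mat m b → Carrier
      form z = det (block ((W ⊗ U) ᵀ) ((⊟ Λ) ᵀ) z 𝟘)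
      form-alternating : Alternating m form
      form-alternating = alternating-∘ (append-0-linear m)
        (alternating-++ (det-alternating (b ℕ.+ m)) (λ i → ((W ⊗ U) ᵀ) i ++ ((⊟ Λ) ᵀ) i))

    -- Beside each minor of `κ`, the rows `(W ⊗ U, δ)` are expanded away, and minors `Λ′` of
    -- `(- Λ, 0)` remain. Their denominators come from `Φ`. Multiplication by `det Γ` permits a
    -- Schur complement in which `Φ` occurs only as `Γ ⊗ Φ`; the columns left after expansion
    -- consist of rows of `- C` and `Γ`, that is, of relations of `N`.
    dual-to-presentation : ∀ {p} (N : AdditiveSubgroup p) → let open AdditiveSubgroup N in
      ∀ {n a q} (Row : (Fin n → Carrier) → Set q) (C : Mat m n) (Φ : Mat n a) (Γ : Mat n n) (Z : Mat m b) (G : Mat a b) →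
      Λ ≋ Z ⊞ C ⊗ (Φ ⊗ G) →
      (∀ i j → Multiplier (Z i j)) → (∀ i j → Multiplier (G i j)) →
      (∀ i j → Multiplier ((Γ ⊗ Φ) i j)) → (∀ i j → Multiplier ((W ⊗ U) i j)) →
      (∀ i → Row ((⊟ C) i)) → (∀ i → Row (Γ i)) →
      (∀ (I : Fin m → Fin b) (V : Mat n n) → (∀ i → Row (V i)) → member (det (κ ∘ I) * det V)) →
      member (det Γ * det U)
    dual-to-presentation {p} N {n} {a} Row C Φ Γ Z G Λ≋ Z∈ G∈ ΓΦ∈ WU∈ rowC rowΓ h =
      ∈-resp (*-congˡ (sym det-split-expansion))
        (∈-resp (sumInc-* b m (det Γ) {minors} λ I → refl) (sumInc-closed member 0∈ +∈ b m each))
      where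
      open AdditiveSubgroup N
      minors : (Fin m → Fin b) → Carrier
      minors I = det (block (W ⊗ U) ((δ ∘ I) ᵀ) (⊟ Λ) 𝟘) * det (κ ∘ I)
      each : ∀ I → member (det Γ * minors I)
      each I = ∈-resp (solve 3 (λ k g x → k :* g :* x := g :* (x :* k)) refl (det (κ ∘ I)) (det Γ) _)
        (AdditiveSubgroup.laplace-top N₁ (W ⊗ U) ((δ ∘ I) ᵀ) (⊟ Λ) 𝟘
          (λ i j → scaled-multiplier N (det (κ ∘ I) * det Γ) (WU∈ i j))
          (λ i j → multiplier-δ N₁ (I j) i) outer)
        where
        N₁ N₂ : AdditiveSubgroup p
        N₁ = scaled N (det (κ ∘ I) * det Γ)
        N₂ = scaled N (det (κ ∘ I))
        module N₂ = AdditiveSubgroup N₂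
        up : ∀ {r} → Multiplier r → N₂.Multiplier r
        up = scaled-multiplier N (det (κ ∘ I))
        outer : ∀ (σ : Fin m → Fin (b ℕ.+ m)) → AdditiveSubgroup.member N₁ (det λ i j → ((⊟ Λ) i ++ 𝟘 {m} i) (σ j))
        outer σ = ∈-resp eq (N₂.laplace-left Z′ (⊟ C) ((Γ ⊗ Φ) ⊗ G′) Γ
            (λ i j → up (Z′∈ i j))
            (λ i j → multiplier-sum N₂ {f = λ k → (Γ ⊗ Φ) i k * G′ k j} λ k →
              multiplier-* N₂ {(Γ ⊗ Φ) i k} {G′ k j} (up (ΓΦ∈ i k)) (up (G′∈ k j)))
            λ ρ → h I (λ i → ((⊟ C) ++ Γ) (ρ i)) (rows ρ))
          where
          Z′ : Mat m m
          Z′ i j = ((⊟ Z) i ++ 𝟘 {m} i) (σ j)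
          G′ : Mat a m
          G′ i j = ((⊟ G) i ++ 𝟘 {a} i) (σ j)
          Z′∈ : ∀ i j → Multiplier (Z′ i j)
          Z′∈ i j = multiplier-++ {u = (⊟ Z) i} {𝟘 {m} i} (λ l → multiplier-neg N {Z i l} (Z∈ i l)) (λ _ → multiplier-0 N) (σ j)
          G′∈ : ∀ i j → Multiplier (G′ i j)
          G′∈ i j = multiplier-++ {u = (⊟ G) i} {𝟘 {a} i} (λ l → multiplier-neg N {G i l} (G∈ i l)) (λ _ → multiplier-0 N) (σ j)
          rows : ∀ (ρ : Fin n → Fin (m ℕ.+ n)) i → Row (((⊟ C) ++ Γ) (ρ i))
          rows ρ i with splitAt m (ρ i)
          ... | inj₁ k = rowC k
          ... | inj₂ k = rowΓ k
          Λ′ : Mat m m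
          Λ′ i j = ((⊟ Λ) i ++ 𝟘 {m} i) (σ j)
          Λ′≋ : Λ′ ⊞ (⊟ C) ⊗ (Φ ⊗ G′) ≋ Z′
          Λ′≋ i j with splitAt b (σ j)
          ... | inj₁ l = begin
            - Λ i l + ((⊟ C) ⊗ (Φ ⊗ (⊟ G))) i l
              ≈⟨ +-cong (-‿cong (Λ≋ i l)) (trans (⊗-cong {M = ⊟ C} (λ _ _ → refl) (⊗⊟ Φ G) i l)
                   (trans (⊗⊟ (⊟ C) (Φ ⊗ G) i l) (trans (-‿cong (⊟⊗ C (Φ ⊗ G) i l)) (-‿involutive _)))) ⟩
            - (Z i l + (C ⊗ (Φ ⊗ G)) i l) + (C ⊗ (Φ ⊗ G)) i l
              ≈⟨ +-congʳ (sym (-‿+-comm (Z i l) _)) ⟩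
            - Z i l + - (C ⊗ (Φ ⊗ G)) i l + (C ⊗ (Φ ⊗ G)) i l
              ≈⟨ trans (+-assoc _ _ _) (trans (+-congˡ (-‿inverseˡ _)) (+-identityʳ _)) ⟩
            - Z i l ∎
          ... | inj₂ l = trans (+-identityˡ _)
            (trans (⊗-cong {M = ⊟ C} {N = Φ ⊗ 𝟘 {a} {m}} {N′ = 𝟘} (λ _ _ → refl) (⊗𝟘 Φ) i l) (⊗𝟘 (⊟ C) i l))
          eq : det (κ ∘ I) * det (block Z′ (⊟ C) ((Γ ⊗ Φ) ⊗ G′) Γ) ≈ det (κ ∘ I) * det Γ * det Λ′
          eq = trans (*-congˡ (schur Λ′ (⊟ C) (Φ ⊗ G′) Γ Λ′≋ (λ i j → sym (⊗-assoc Γ Φ G′ i j))))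
            (solve 3 (λ k l g → k :* (l :* g) := k :* g :* l) refl (det (κ ∘ I)) (det Λ′) (det Γ))

-- Homomorphisms, vectors and finite presentations.

module ModuleTheory {ℓ} (R : CommutativeRing ℓ ℓ) where
  open Modules R hiding (δ)
  private module R = CommutativeRing R
  open CommutativeRing R using (Carrier; _≈_; _+_; _*_; 0#)
  open Determinants R using (δ; sum-δ)

  Ker : {M N : Mod} → M ⟶ N → Mod
  Ker f = Submodule.asModule (kernel f)

  id-hom : {M : Mod} → M ⟶ M
  id-hom {M} = mkHom id id (λ _ _ → ≈ᴹ-refl) (λ _ _ → ≈ᴹ-refl)
    where open Module M

  include : {M : Mod} (N : Submodule M) → Submodule.asModule N ⟶ M
  include {M} N = mkHom proj₁ id (λ _ _ → ≈ᴹ-refl) (λ _ _ → ≈ᴹ-refl)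
    where open Module M

  corestrict : {L M : Mod} (N : Submodule M) (f : L ⟶ M) → (∀ x → ⟦ f ⟧ x ∈ N) → L ⟶ Submodule.asModule N
  corestrict N f h = mkHom (λ x → ⟦ f ⟧ x , h x) f.⟦⟧-cong f.+ᴹ-homo f.*ₗ-homo
    where module f = _⟶_ f

  infixl 6 _⊹_ _⊖ʰ_
  _⊹_ _⊖ʰ_ : {M N : Mod} → M ⟶ N → M ⟶ N → M ⟶ N
  _⊹_ {M} {N} f g = Module._+ᴹ_ (Hom M N) f g
  _⊖ʰ_ {M} {N} f g = f ⊹ Module.-ᴹ_ (Hom M N) g

  _⊕ᴹ_ : Mod → Mod → Mod
  M ⊕ᴹ N = DirectProduct.⟨module⟩ M N

  module _ {M N : Mod} where
    private
      module M = Module M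
      module N = Module N

    fst : M ⊕ᴹ N ⟶ M
    fst = mkHom proj₁ proj₁ (λ _ _ → M.≈ᴹ-refl) (λ _ _ → M.≈ᴹ-refl)

    snd : M ⊕ᴹ N ⟶ N
    snd = mkHom proj₂ proj₂ (λ _ _ → N.≈ᴹ-refl) (λ _ _ → N.≈ᴹ-refl)

    inl : M ⟶ M ⊕ᴹ N
    inl = mkHom (_, N.0ᴹ) (_, N.≈ᴹ-refl) (λ _ _ → M.≈ᴹ-refl , N.≈ᴹ-sym (N.+ᴹ-identityˡ N.0ᴹ))
      (λ r _ → M.≈ᴹ-refl , N.≈ᴹ-sym (N.*ₗ-zeroʳ r))

    inr : N ⟶ M ⊕ᴹ N
    inr = mkHom (M.0ᴹ ,_) (M.≈ᴹ-refl ,_) (λ _ _ → M.≈ᴹ-sym (M.+ᴹ-identityˡ M.0ᴹ) , N.≈ᴹ-refl)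
      (λ r _ → M.≈ᴹ-sym (M.*ₗ-zeroʳ r) , N.≈ᴹ-refl)

    inl+inr : ∀ x y → Module._≈ᴹ_ (M ⊕ᴹ N) (x , y) (Module._+ᴹ_ (M ⊕ᴹ N) (x , N.0ᴹ) (M.0ᴹ , y))
    inl+inr x y = M.≈ᴹ-sym (M.+ᴹ-identityʳ x) , N.≈ᴹ-sym (N.+ᴹ-identityˡ y)

  module Differences (M : Mod) where
    open Module M

    x-y≈0 : ∀ {x y} → x ≈ᴹ y → x +ᴹ -ᴹ y ≈ᴹ 0ᴹ
    x-y≈0 e = ≈ᴹ-trans (+ᴹ-congʳ e) (-ᴹ‿inverseʳ _)

    [x-y]+y≈x : ∀ x y → (x +ᴹ -ᴹ y) +ᴹ y ≈ᴹ x
    [x-y]+y≈x x y = ≈ᴹ-trans (+ᴹ-assoc _ _ _) (≈ᴹ-trans (+ᴹ-congˡ (-ᴹ‿inverseˡ y)) (+ᴹ-identityʳ x))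

    x-y≈0⇒x≈y : ∀ {x y} → x +ᴹ -ᴹ y ≈ᴹ 0ᴹ → x ≈ᴹ y
    x-y≈0⇒x≈y {x} {y} e = ≈ᴹ-trans (≈ᴹ-sym ([x-y]+y≈x x y)) (≈ᴹ-trans (+ᴹ-congʳ e) (+ᴹ-identityˡ y))

    -0≈0 : -ᴹ 0ᴹ ≈ᴹ 0ᴹ
    -0≈0 = ≈ᴹ-trans (≈ᴹ-sym (+ᴹ-identityˡ _)) (-ᴹ‿inverseʳ 0ᴹ)

  abstract
    -- Surjectivity provides a choice of preimages that need not respect equality or the operations.
    -- Composed with `f` it does, since two preimages of equal elements differ by an element of
    -- `kernel p`.
    descend : {E G B : Mod} (p : E ⟶ G) → IsSurjective p → (f : E ⟶ B) →
      (∀ e → e ∈ kernel p → e ∈ kernel f) → Σ (G ⟶ B) λ f̄ → ∀ e → Module._≈ᴹ_ B (⟦ f̄ ⟧ (⟦ p ⟧ e)) (⟦ f ⟧ e)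
    descend {E} {G} {B} p surj f vanish = mkHom (λ x → ⟦ f ⟧ (s x))
        (λ {x} {y} e → agree (G.≈ᴹ-trans (ps x) (G.≈ᴹ-trans e (G.≈ᴹ-sym (ps y)))))
        (λ x y → B.≈ᴹ-trans (agree (G.≈ᴹ-trans (ps _) (G.≈ᴹ-trans (G.+ᴹ-cong (G.≈ᴹ-sym (ps x)) (G.≈ᴹ-sym (ps y)))
          (G.≈ᴹ-sym (p.+ᴹ-homo _ _))))) (f.+ᴹ-homo _ _))
        (λ r x → B.≈ᴹ-trans (agree (G.≈ᴹ-trans (ps _) (G.≈ᴹ-trans (G.*ₗ-congˡ (G.≈ᴹ-sym (ps x)))
          (G.≈ᴹ-sym (p.*ₗ-homo r _))))) (f.*ₗ-homo r _)) ,
      λ e → agree (ps (⟦ p ⟧ e))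
      where
      module E = Module E
      module G = Module G
      module B = Module B
      module p = _⟶_ p
      module f = _⟶_ f
      s : ∣ G ∣ → ∣ E ∣
      s x = proj₁ (surj x)
      ps : ∀ x → ⟦ p ⟧ (s x) G.≈ᴹ x
      ps x = proj₂ (surj x)
      agree : ∀ {e e′} → ⟦ p ⟧ e G.≈ᴹ ⟦ p ⟧ e′ → ⟦ f ⟧ e B.≈ᴹ ⟦ f ⟧ e′
      agree {e} {e′} q = Differences.x-y≈0⇒x≈y B (B.≈ᴹ-trans (B.+ᴹ-congˡ (B.≈ᴹ-sym (f.-ᴹ-homo e′)))
        (B.≈ᴹ-trans (B.≈ᴹ-sym (f.+ᴹ-homo e (E.-ᴹ e′))) (vanish (e E.+ᴹ E.-ᴹ e′)
          (G.≈ᴹ-trans (p.+ᴹ-homo e (E.-ᴹ e′)) (G.≈ᴹ-trans (G.+ᴹ-congˡ (p.-ᴹ-homo e′)) (Differences.x-y≈0 G q))))))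

  open SemiringSum R.semiring using () renaming (sum to sumᴿ)

  module _ (n : ℕ) where
    -- Functions rather than the formal terms of `Free`, so that coordinates are directly available
    -- as matrix entries.
    VecOps : ModuleOps
    VecOps .ModuleOps.Elem = Fin n → Carrier
    VecOps .ModuleOps.eq u v = ∀ i → u i ≈ v i
    VecOps .ModuleOps.add u v i = u i + v i
    VecOps .ModuleOps.nil i = 0#
    VecOps .ModuleOps.neg u i = R.- u i
    VecOps .ModuleOps.act r u i = r * u i

    abstract
      VecLaws : ModuleLaws VecOps
      VecLaws .ModuleLaws.equiv = record
        { refl = λ _ → R.refl ; sym = λ e i → R.sym (e i) ; trans = λ e f i → R.trans (e i) (f i) }
      VecLaws .ModuleLaws.add-cong e f i = R.+-cong (e i) (f i)
      VecLaws .ModuleLaws.neg-cong e i = R.-‿cong (e i)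
      VecLaws .ModuleLaws.act-cong er e i = R.*-cong er (e i)
      VecLaws .ModuleLaws.add-assoc u v w i = R.+-assoc _ _ _
      VecLaws .ModuleLaws.add-comm u v i = R.+-comm _ _
      VecLaws .ModuleLaws.add-nil u i = R.+-identityˡ _
      VecLaws .ModuleLaws.add-neg u i = R.-‿inverseˡ _
      VecLaws .ModuleLaws.act-add r u v i = R.distribˡ _ _ _
      VecLaws .ModuleLaws.add-act u r s i = R.distribʳ _ _ _
      VecLaws .ModuleLaws.act-assoc r s u i = R.*-assoc _ _ _
      VecLaws .ModuleLaws.act-1 u i = R.*-identityˡ _

    Vec : Mod
    Vec = mkModule VecOps VecLaws

  coord : ∀ {n} → Fin n → Vec n ⟶ ⟨R⟩
  coord i = mkHom (λ u → u i) (λ e → e i) (λ _ _ → R.refl) (λ _ _ → R.refl)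

  module _ (M : Mod) where
    open Module M
    open CommutativeMonoidSum +ᴹ-commutativeMonoid using (sum; sum-cong-≋; ∑-distrib-+)

    *ₗ-sum : ∀ {n} r (u : Fin n → Carrierᴹ) → sum (λ i → r *ₗ u i) ≈ᴹ r *ₗ sum u
    *ₗ-sum {zero}  r u = ≈ᴹ-sym (*ₗ-zeroʳ r)
    *ₗ-sum {suc n} r u = ≈ᴹ-trans (+ᴹ-congˡ (*ₗ-sum r (u ∘ suc))) (≈ᴹ-sym (*ₗ-distribˡ r _ _))

    combination : ∀ {n} → (Fin n → Carrierᴹ) → Vec n ⟶ M
    combination v = mkHom (λ x → sum λ i → x i *ₗ v i)
      (λ e → sum-cong-≋ λ i → *ₗ-congʳ (e i))
      (λ x y → ≈ᴹ-trans (sum-cong-≋ λ i → *ₗ-distribʳ (v i) (x i) (y i)) (∑-distrib-+ (λ i → x i *ₗ v i) (λ i → y i *ₗ v i)))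
      (λ r x → ≈ᴹ-trans (sum-cong-≋ λ i → *ₗ-assoc r (x i) (v i)) (*ₗ-sum r λ i → x i *ₗ v i))

  comb : {M : Mod} {n : ℕ} → (Fin n → ∣ M ∣) → Vec n ⟶ M
  comb {M} = combination M

  comb-cong : {M : Mod} {n : ℕ} {v w : Fin n → ∣ M ∣} → (∀ i → Module._≈ᴹ_ M (v i) (w i)) →
    ∀ x → Module._≈ᴹ_ M (⟦ comb {M} v ⟧ x) (⟦ comb {M} w ⟧ x)
  comb-cong {M} e x = sum-cong-≋ λ i → *ₗ-congˡ (e i)
    where
    open Module M
    open CommutativeMonoidSum +ᴹ-commutativeMonoid using (sum-cong-≋)

  hom-comb : {M N : Mod} {n : ℕ} (f : M ⟶ N) (v : Fin n → ∣ M ∣) (x : Fin n → Carrier) →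
    Module._≈ᴹ_ N (⟦ f ⟧ (⟦ comb {M} v ⟧ x)) (⟦ comb {N} (⟦ f ⟧ ∘ v) ⟧ x)
  hom-comb {n = zero}  f v x = _⟶_.0ᴹ-homo f
  hom-comb {M} {N} {suc n} f v x = ≈ᴹ-trans (+ᴹ-homo _ _) (+ᴹ-cong (*ₗ-homo _ _) (hom-comb {M} {N} f (v ∘ suc) (x ∘ suc)))
    where
    open Module N
    open _⟶_ f

  comb-δ : ∀ {n} (x : Fin n → Carrier) → Module._≈ᴹ_ (Vec n) (⟦ comb {Vec n} δ ⟧ x) x
  comb-δ {n} x j = R.trans (hom-comb {Vec n} {⟨R⟩} (coord j) δ x) (sum-δ x j)

  hom-δ : {M : Mod} {n : ℕ} (f : Vec n ⟶ M) (x : Fin n → Carrier) →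
    Module._≈ᴹ_ M (⟦ f ⟧ x) (⟦ comb {M} (⟦ f ⟧ ∘ δ) ⟧ x)
  hom-δ {M} {n} f x = ≈ᴹ-trans (⟦⟧-cong (Module.≈ᴹ-sym (Vec n) {⟦ comb {Vec n} δ ⟧ x} {x} (comb-δ x))) (hom-comb {Vec n} {M} f δ x)
    where
    open Module M
    open _⟶_ f

  comb-comb : {M : Mod} {n m : ℕ} (v : Fin m → ∣ M ∣) (C : Fin n → Fin m → Carrier) (x : Fin n → Carrier) →
    Module._≈ᴹ_ M (⟦ comb {M} v ⟧ (λ j → sumᴿ λ i → x i * C i j)) (⟦ comb {M} (λ i → ⟦ comb {M} v ⟧ (C i)) ⟧ x)
  comb-comb {M} {n} {m} v C x = ≈ᴹ-trans
    (⟦⟧-cong λ j → R.sym (hom-comb {Vec m} {⟨R⟩} (coord j) C x)) (hom-comb {Vec m} {M} (comb {M} v) C x)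
    where
    open Module M
    open _⟶_ (comb {M} v)

  comb-of-δ : {M : Mod} {n : ℕ} (v : Fin n → ∣ M ∣) (i : Fin n) → Module._≈ᴹ_ M (⟦ comb {M} v ⟧ (δ i)) (v i)
  comb-of-δ {M} {suc n} v zero = ≈ᴹ-trans (+ᴹ-cong (*ₗ-identityˡ _) (≈ᴹ-trans (⟦⟧-cong λ _ → R.refl) 0ᴹ-homo)) (+ᴹ-identityʳ _)
    where
    open Module M
    open _⟶_ (comb {M} (v ∘ suc))
  comb-of-δ {M} {suc n} v (suc i) = ≈ᴹ-trans (+ᴹ-cong (*ₗ-zeroˡ _) (comb-of-δ {M} (v ∘ suc) i)) (+ᴹ-identityˡ _)
    where open Module M

  Vec-projective : ∀ n → IsProjective (Vec n)
  Vec-projective n {M} {N} g surj f = comb {M} s , λ x → ≈ᴹ-trans (hom-comb {M} {N} g s x)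
      (≈ᴹ-trans (comb-cong {N} (λ i → proj₂ (surj (⟦ f ⟧ (δ i)))) x) (≈ᴹ-sym (hom-δ {N} f x)))
    where
    open Module N
    s : Fin n → ∣ M ∣
    s i = proj₁ (surj (⟦ f ⟧ (δ i)))

  Span⇒comb : {M : Mod} {n : ℕ} (v : Fin n → ∣ M ∣) {x : ∣ M ∣} → Span M v x →
    ∃ λ c → Module._≈ᴹ_ M (⟦ comb {M} v ⟧ c) x
  Span⇒comb {M} v = Span⊆ (image (comb {M} v)) λ i → δ i , comb-of-δ {M} v i

  comb∈Span : {M : Mod} {n : ℕ} (v : Fin n → ∣ M ∣) (c : Fin n → Carrier) → Span M v (⟦ comb {M} v ⟧ c)
  comb∈Span {M} {zero}  v c = zero
  comb∈Span {M} {suc n} v c = add (mul (c zero) (gen zero))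
    (Span⊆ (finSpan M v) (λ i → gen (suc i)) (comb∈Span {M} (v ∘ suc) (c ∘ suc)))

  presentation : {M : Mod} (fg : FinitelyGenerated M) → Vec (FinitelyGenerated.size fg) ⟶ M
  presentation {M} fg = comb {M} (FinitelyGenerated.generators fg)

  presentation-surjective : {M : Mod} (fg : FinitelyGenerated M) → IsSurjective (presentation {M} fg)
  presentation-surjective {M} fg x = Span⇒comb {M} _ (FinitelyGenerated.generates fg x)

  -- Finite dual bases, the witnesses of finitely generated projectivity.

  record DualBasis (K : Mod) : Set ℓ where
    field
      size    : ℕ
      vectors : Fin size → ∣ K ∣
      forms   : K ⟶ Vec size
      expand  : ∀ x → Module._≈ᴹ_ K (⟦ comb {K} vectors ⟧ (⟦ forms ⟧ x)) x

  -- Schanuel's argument: lifts of τσ and of 1 − τσ to the free cover of K add up to a section.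
  module _ (noeth : IsNoetherian) {P : Mod} (pd≤1 : ProjDim≤ 1 P) (fg : FinitelyGenerated P) where
    private
      P• : ProjectiveResolution P
      P• = proj₁ pd≤1
      P•-zero : ∀ i → 1 ℕ.< i → IsZero (ProjectiveResolution.P P• i)
      P•-zero = proj₂ pd≤1
      open ProjectiveResolution P• renaming (P to P•ᵢ)
      module P = Module P
      n : ℕ
      n = FinitelyGenerated.size fg
      F : Mod
      F = Vec n
      module F = Module F
      module P₀ = Module (P•ᵢ 0)
      module P₁ = Module (P•ᵢ 1)
      module d₀ = _⟶_ (d 0)
      π : F ⟶ P
      π = presentation {P} fg
      module π = _⟶_ π
      K : Mod
      K = Ker π
      module FGK = FG (noetherian⇒FG {F} noeth n δ (kernel π)
        λ {x} _ → resp {x = ⟦ comb {F} δ ⟧ x} {x} (comb-δ x) (comb∈Span {F} δ x))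
      κ : Fin FGK.size → ∣ K ∣
      κ i = FGK.generators i , FGK.contained i
      κ-surjective : IsSurjective (comb {K} κ)
      κ-surjective (x , x∈) with Span⇒comb {F} FGK.generators (FGK.generates {x} x∈)
      ... | c , e = c , F.≈ᴹ-trans (hom-comb {K} {F} (include (kernel π)) κ c) e
      lift-ε : Σ (P•ᵢ 0 ⟶ F) λ f → ∀ t → ⟦ π ⟧ (⟦ f ⟧ t) P.≈ᴹ ⟦ ε ⟧ t
      lift-ε = projective 0 π (presentation-surjective {P} fg) ε
      lift-π : Σ (F ⟶ P•ᵢ 0) λ f → ∀ x → ⟦ ε ⟧ (⟦ f ⟧ x) P.≈ᴹ ⟦ π ⟧ x
      lift-π = Vec-projective n ε ε-surj π
      τ : P•ᵢ 0 ⟶ F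
      τ = proj₁ lift-ε
      πτ : ∀ t → ⟦ π ⟧ (⟦ τ ⟧ t) P.≈ᴹ ⟦ ε ⟧ t
      πτ = proj₂ lift-ε
      σ : F ⟶ P•ᵢ 0
      σ = proj₁ lift-π
      εσ : ∀ x → ⟦ ε ⟧ (⟦ σ ⟧ x) P.≈ᴹ ⟦ π ⟧ x
      εσ = proj₂ lift-π
      τσ : F ⟶ F
      τσ = τ ⊚ σ
      -- The resolution vanishes in degree 2. Consequently `Ker ε` is isomorphic to the projective
      -- module `P•ᵢ 1`, through which `τσ` restricted to `K` factors and therefore lifts along
      -- `comb κ`.
      d₀-injective : ∀ u → ⟦ d 0 ⟧ u P₀.≈ᴹ P₀.0ᴹ → u P₁.≈ᴹ P₁.0ᴹ
      d₀-injective u du≈0 with proj₂ (exact-d 0) u du≈0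
      ... | w , dw≈u = P₁.≈ᴹ-trans (P₁.≈ᴹ-sym dw≈u) (P₁.≈ᴹ-trans
        (_⟶_.⟦⟧-cong (d 1) (P•-zero 2 (s≤s (s≤s z≤n)) w)) (_⟶_.0ᴹ-homo (d 1)))
      d₀′ : P•ᵢ 1 ⟶ Ker ε
      d₀′ = corestrict (kernel ε) (d 0) (proj₁ exact-ε)
      inverse : Σ (Ker ε ⟶ P•ᵢ 1) λ f → ∀ u → ⟦ f ⟧ (⟦ d₀′ ⟧ u) P₁.≈ᴹ u
      inverse = descend d₀′ (λ (t , et) → proj₂ exact-ε t et) id-hom d₀-injective
      σ′ : K ⟶ P•ᵢ 1
      σ′ = proj₁ inverse ⊚ corestrict (kernel ε) (σ ⊚ include (kernel π)) (λ (x , x∈) → P.≈ᴹ-trans (εσ x) x∈)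
      σ′-lifts : ∀ x → ⟦ d 0 ⟧ (⟦ σ′ ⟧ x) P₀.≈ᴹ ⟦ σ ⟧ (proj₁ x)
      σ′-lifts (x , x∈) = P₀.≈ᴹ-trans (d₀.⟦⟧-cong (P₁.≈ᴹ-trans
          (_⟶_.⟦⟧-cong (proj₁ inverse) {⟦ σ ⟧ x , closed} {⟦ d₀′ ⟧ (proj₁ bounded)} (P₀.≈ᴹ-sym (proj₂ bounded)))
          (proj₂ inverse (proj₁ bounded)))) (proj₂ bounded)
        where
        closed : ⟦ ε ⟧ (⟦ σ ⟧ x) P.≈ᴹ P.0ᴹ
        closed = P.≈ᴹ-trans (εσ x) x∈
        bounded : ∃ λ u → ⟦ d 0 ⟧ u P₀.≈ᴹ ⟦ σ ⟧ x
        bounded = proj₂ exact-ε (⟦ σ ⟧ x) closed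
      lift-τ : Σ (P•ᵢ 1 ⟶ Vec FGK.size) λ f → ∀ u →
        Module._≈ᴹ_ K (⟦ comb {K} κ ⟧ (⟦ f ⟧ u)) (⟦ τ ⟧ (⟦ d 0 ⟧ u) , P.≈ᴹ-trans (πτ _) (proj₁ exact-ε u))
      lift-τ = projective 1 (comb {K} κ) κ-surjective (corestrict (kernel π) (τ ⊚ d 0) (λ u → P.≈ᴹ-trans (πτ _) (proj₁ exact-ε u)))
      ρ : F ⟶ K
      ρ = corestrict (kernel π) (id-hom ⊖ʰ τσ) λ x → P.≈ᴹ-trans (π.+ᴹ-homo x (F.-ᴹ ⟦ τσ ⟧ x))
        (P.≈ᴹ-trans (P.+ᴹ-congˡ (P.≈ᴹ-trans (π.-ᴹ-homo (⟦ τσ ⟧ x)) (P.-ᴹ‿cong (P.≈ᴹ-trans (πτ (⟦ σ ⟧ x)) (εσ x))))) (P.-ᴹ‿inverseʳ _))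
      lift-ρ : Σ (F ⟶ Vec FGK.size) λ f → ∀ x → Module._≈ᴹ_ K (⟦ comb {K} κ ⟧ (⟦ f ⟧ x)) (⟦ ρ ⟧ x)
      lift-ρ = Vec-projective n (comb {K} κ) κ-surjective ρ
      τ̂ : P•ᵢ 1 ⟶ Vec FGK.size
      τ̂ = proj₁ lift-τ
      τ̂-lifts : ∀ u → ⟦ include (kernel π) ⟧ (⟦ comb {K} κ ⟧ (⟦ τ̂ ⟧ u)) F.≈ᴹ ⟦ τ ⟧ (⟦ d 0 ⟧ u)
      τ̂-lifts = proj₂ lift-τ
      ρ̂ : F ⟶ Vec FGK.size
      ρ̂ = proj₁ lift-ρ
      ρ̂-lifts : ∀ x → ⟦ include (kernel π) ⟧ (⟦ comb {K} κ ⟧ (⟦ ρ̂ ⟧ x)) F.≈ᴹ (x F.+ᴹ F.-ᴹ ⟦ τσ ⟧ x)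
      ρ̂-lifts = proj₂ lift-ρ
      forms : K ⟶ Vec FGK.size
      forms = τ̂ ⊚ σ′ ⊹ ρ̂ ⊚ include (kernel π)

    abstract
      dualBasis : DualBasis K
      dualBasis = record
        { vectors = κ
        ; forms = forms
        ; expand = λ x → F.≈ᴹ-trans (_⟶_.+ᴹ-homo (comb {K} κ) (⟦ τ̂ ⟧ (⟦ σ′ ⟧ x)) (⟦ ρ̂ ⟧ (proj₁ x)))
            (F.≈ᴹ-trans (F.+ᴹ-cong (τ̂-lifts (⟦ σ′ ⟧ x)) (ρ̂-lifts (proj₁ x)))
            (F.≈ᴹ-trans (F.+ᴹ-congʳ (_⟶_.⟦⟧-cong τ (σ′-lifts x)))
            (F.≈ᴹ-trans (F.+ᴹ-comm (⟦ τσ ⟧ (proj₁ x)) (proj₁ x F.+ᴹ F.-ᴹ ⟦ τσ ⟧ (proj₁ x)))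
              (Differences.[x-y]+y≈x F (proj₁ x) (⟦ τσ ⟧ (proj₁ x)))))) }

  -- Extension of functionals when `Ext²` vanishes.

  module _ {F G Q : Mod} (F-projective : IsProjective F) (π : F ⟶ Q) (π-surj : IsSurjective π)
    (p : G ⟶ F) (exact : IsExact p π) (Ext²≈0 : IsZero (Ext 2 Q ⟨R⟩)) (f : Ker p ⟶ ⟨R⟩) where
    private
      open ProjectiveResolution (standardResolution Q) using (P; d; ε; ε-surj; exact-ε; exact-d)
      πp≈0 : ∀ x → Module._≈ᴹ_ Q (⟦ π ⟧ (⟦ p ⟧ x)) (Module.0ᴹ Q)
      πp≈0 = proj₁ exact
      lift-p : ∀ y → y ∈ kernel π → ∃ λ x → Module._≈ᴹ_ F (⟦ p ⟧ x) y
      lift-p = proj₂ exact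
      module F = Module F
      module G = Module G
      module Q = Module Q
      module P₀ = Module (P 0)
      module P₁ = Module (P 1)
      module p = _⟶_ p
      module π = _⟶_ π

      τ₀ : P 0 ⟶ F
      τ₀ = lift (proj₁ ∘ π-surj)
      πτ₀ : ∀ t → ⟦ π ⟧ (⟦ τ₀ ⟧ t) Q.≈ᴹ ⟦ ε ⟧ t
      πτ₀ = lift-unique (π ⊚ τ₀) ε (proj₂ ∘ π-surj)

      boundary : (z : ∣ Ker ε ∣) → ∃ λ x → ⟦ p ⟧ x F.≈ᴹ ⟦ τ₀ ⟧ (proj₁ z)
      boundary (t , εt≈0) = lift-p (⟦ τ₀ ⟧ t) (Q.≈ᴹ-trans (πτ₀ t) εt≈0)
      τ₁ : P 1 ⟶ G
      τ₁ = lift (proj₁ ∘ boundary)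
      pτ₁ : ∀ u → ⟦ p ⟧ (⟦ τ₁ ⟧ u) F.≈ᴹ ⟦ τ₀ ⟧ (⟦ d 0 ⟧ u)
      pτ₁ = lift-unique (p ⊚ τ₁) (τ₀ ⊚ d 0) (proj₂ ∘ boundary)

      τ₁-closed : ∀ u → u ∈ kernel (d 0) → ⟦ τ₁ ⟧ u ∈ kernel p
      τ₁-closed u du≈0 = F.≈ᴹ-trans (pτ₁ u) (F.≈ᴹ-trans (_⟶_.⟦⟧-cong τ₀ du≈0) (_⟶_.0ᴹ-homo τ₀))
      τ₁′ : Ker (d 0) ⟶ Ker p
      τ₁′ = corestrict (kernel p) (τ₁ ⊚ include (kernel (d 0))) λ (u , du≈0) → τ₁-closed u du≈0

      -- The functional transported to the standard resolution by the comparison map `τ₁`. That its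
      -- class in `Ext²` is zero yields `g` on all of `P 1` that agrees with `f ⊚ τ₁′` on the
      -- cycles.
      f₂ : P 2 ⟶ ⟨R⟩
      f₂ = lift (λ z → ⟦ f ⟧ (⟦ τ₁′ ⟧ z))
      d₁′ : P 2 ⟶ Ker (d 0)
      d₁′ = corestrict (kernel (d 0)) (d 1) (proj₁ (exact-d 0))
      f₂-factors : ∀ v → ⟦ f₂ ⟧ v ≈ ⟦ f ⟧ (⟦ τ₁′ ⟧ (⟦ d₁′ ⟧ v))
      f₂-factors = lift-unique f₂ (f ⊚ (τ₁′ ⊚ d₁′)) λ _ → R.refl
      cocycle : ∀ w → ⟦ f₂ ⟧ (⟦ d 2 ⟧ w) ≈ 0#
      cocycle w = R.trans (f₂-factors (⟦ d 2 ⟧ w)) (R.trans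
        (_⟶_.⟦⟧-cong (f ⊚ τ₁′) {⟦ d₁′ ⟧ (⟦ d 2 ⟧ w)} {Module.0ᴹ (Ker (d 0))} (proj₁ (exact-d 1) w)) (_⟶_.0ᴹ-homo (f ⊚ τ₁′)))
      coboundary : ∃ λ (g : P 1 ⟶ ⟨R⟩) → ∀ t → ⟦ f₂ ⟧ t ≈ 0# + ⟦ g ⟧ (⟦ d 1 ⟧ t)
      coboundary = Ext²≈0 (f₂ , cocycle)
      g : P 1 ⟶ ⟨R⟩
      g = proj₁ coboundary
      f≈g : ∀ z → ⟦ f ⟧ (⟦ τ₁′ ⟧ z) ≈ ⟦ g ⟧ (proj₁ z)
      f≈g z = R.trans (proj₂ coboundary (η z)) (R.+-identityˡ _)

      lift-π : Σ (F ⟶ P 0) λ σ → ∀ x → ⟦ ε ⟧ (⟦ σ ⟧ x) Q.≈ᴹ ⟦ π ⟧ x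
      lift-π = F-projective ε ε-surj π
      σ : F ⟶ P 0
      σ = proj₁ lift-π

      p′ : G ⟶ Ker π
      p′ = corestrict (kernel π) p πp≈0
      homotopy : Σ (F ⟶ G) λ ρ → ∀ x → ⟦ p ⟧ (⟦ ρ ⟧ x) F.≈ᴹ ⟦ τ₀ ⟧ (⟦ σ ⟧ x) F.+ᴹ F.-ᴹ x
      homotopy = F-projective p′ (λ (y , πy≈0) → lift-p y πy≈0)
        (corestrict (kernel π) (τ₀ ⊚ σ ⊖ʰ id-hom) λ x → Q.≈ᴹ-trans (π.+ᴹ-homo (⟦ τ₀ ⟧ (⟦ σ ⟧ x)) (F.-ᴹ x))
          (Q.≈ᴹ-trans (Q.+ᴹ-cong (Q.≈ᴹ-trans (πτ₀ (⟦ σ ⟧ x)) (proj₂ lift-π x)) (π.-ᴹ-homo x)) (Q.-ᴹ‿inverseʳ _)))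
      ρ : F ⟶ G
      ρ = proj₁ homotopy

      -- `G` is not assumed projective, so `σ ⊚ p` cannot be lifted to a homomorphism into `P 1`.
      -- Its kernel `E` is the fibre product of pairs `(x, u)` with `u` a lift of `σ (p x)`; the
      -- extension is built on `E` and then descends to `G`.
      mismatch : G ⊕ᴹ P 1 ⟶ P 0
      mismatch = d 0 ⊚ snd ⊖ʰ σ ⊚ (p ⊚ fst)
      E : Mod
      E = Ker mismatch
      -- Replaces `x` by a cycle: on `E` the images of `x` and `τ₁ u` under `p` differ by the
      -- homotopy term, which `ρ` compensates. For `x` in `kernel p` and `u` zero it returns `x`,
      -- which makes the result an extension of `f`.
      residue : G ⊕ᴹ P 1 ⟶ G
      residue = fst ⊖ʰ τ₁ ⊚ snd ⊹ ρ ⊚ (p ⊚ fst)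
      residue-closed : ∀ (e : ∣ E ∣) → ⟦ residue ⟧ (proj₁ e) ∈ kernel p
      residue-closed ((x , u) , e) = begin
        ⟦ p ⟧ (x G.+ᴹ G.-ᴹ ⟦ τ₁ ⟧ u G.+ᴹ ⟦ ρ ⟧ y)
          ≈⟨ p.+ᴹ-homo (x G.+ᴹ G.-ᴹ ⟦ τ₁ ⟧ u) (⟦ ρ ⟧ y) ⟩
        ⟦ p ⟧ (x G.+ᴹ G.-ᴹ ⟦ τ₁ ⟧ u) F.+ᴹ ⟦ p ⟧ (⟦ ρ ⟧ y)
          ≈⟨ F.+ᴹ-cong (F.≈ᴹ-trans (p.+ᴹ-homo x (G.-ᴹ ⟦ τ₁ ⟧ u)) (F.+ᴹ-congˡ (p.-ᴹ-homo (⟦ τ₁ ⟧ u)))) (proj₂ homotopy y) ⟩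
        (y F.+ᴹ F.-ᴹ ⟦ p ⟧ (⟦ τ₁ ⟧ u)) F.+ᴹ (⟦ τ₀ ⟧ (⟦ σ ⟧ y) F.+ᴹ F.-ᴹ y)
          ≈⟨ F.+ᴹ-congʳ (F.+ᴹ-congˡ (F.-ᴹ‿cong (F.≈ᴹ-trans (pτ₁ u) (_⟶_.⟦⟧-cong τ₀ (Differences.x-y≈0⇒x≈y (P 0) e))))) ⟩
        (y F.+ᴹ F.-ᴹ ⟦ τ₀ ⟧ (⟦ σ ⟧ y)) F.+ᴹ (⟦ τ₀ ⟧ (⟦ σ ⟧ y) F.+ᴹ F.-ᴹ y)
          ≈⟨ F.≈ᴹ-trans (F.≈ᴹ-sym (F.+ᴹ-assoc _ _ _)) (F.+ᴹ-congʳ (Differences.[x-y]+y≈x F y (⟦ τ₀ ⟧ (⟦ σ ⟧ y)))) ⟩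
        y F.+ᴹ F.-ᴹ y
          ≈⟨ F.-ᴹ‿inverseʳ y ⟩
        F.0ᴹ ∎
        where
        open SetoidReasoning F.≈ᴹ-setoid
        y : ∣ F ∣
        y = ⟦ p ⟧ x
      residue′ : E ⟶ Ker p
      residue′ = corestrict (kernel p) (residue ⊚ include (kernel mismatch)) residue-closed

      project : E ⟶ G
      project = fst ⊚ include (kernel mismatch)
      project-surjective : IsSurjective project
      project-surjective x = ((x , η (⟦ σ ⟧ (⟦ p ⟧ x) , closed)) , P₀.-ᴹ‿inverseʳ (⟦ σ ⟧ (⟦ p ⟧ x))) , G.≈ᴹ-refl
        where
        closed : ⟦ ε ⟧ (⟦ σ ⟧ (⟦ p ⟧ x)) Q.≈ᴹ Q.0ᴹ
        closed = Q.≈ᴹ-trans (proj₂ lift-π (⟦ p ⟧ x)) (πp≈0 x)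

      Ψ : E ⟶ ⟨R⟩
      Ψ = g ⊚ (snd ⊚ include (kernel mismatch)) ⊹ f ⊚ residue′
      -- Over `x = 0`, `u` is a cycle and the residue is `- τ₁ u`, so the contributions of `g` and
      -- `f` cancel.
      Ψ-vanishes : ∀ e → e ∈ kernel project → e ∈ kernel Ψ
      Ψ-vanishes ((x , u) , e) x≈0 = R.trans (R.+-congʳ (R.sym (f≈g (u , du≈0))))
        (R.trans (R.sym (_⟶_.+ᴹ-homo f (⟦ τ₁′ ⟧ (u , du≈0)) (⟦ residue′ ⟧ ((x , u) , e))))
        (R.trans (_⟶_.⟦⟧-cong f {Module._+ᴹ_ (Ker p) (⟦ τ₁′ ⟧ (u , du≈0)) (⟦ residue′ ⟧ ((x , u) , e))}
          {Module.0ᴹ (Ker p)} total) (_⟶_.0ᴹ-homo f)))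
        where
        px≈0 : ⟦ p ⟧ x F.≈ᴹ F.0ᴹ
        px≈0 = F.≈ᴹ-trans (p.⟦⟧-cong x≈0) p.0ᴹ-homo
        du≈0 : ⟦ d 0 ⟧ u P₀.≈ᴹ P₀.0ᴹ
        du≈0 = P₀.≈ᴹ-trans (Differences.x-y≈0⇒x≈y (P 0) e) (P₀.≈ᴹ-trans (_⟶_.⟦⟧-cong σ px≈0) (_⟶_.0ᴹ-homo σ))
        total : ⟦ τ₁ ⟧ u G.+ᴹ (x G.+ᴹ G.-ᴹ ⟦ τ₁ ⟧ u G.+ᴹ ⟦ ρ ⟧ (⟦ p ⟧ x)) G.≈ᴹ G.0ᴹ
        total = begin
          ⟦ τ₁ ⟧ u G.+ᴹ (x G.+ᴹ G.-ᴹ ⟦ τ₁ ⟧ u G.+ᴹ ⟦ ρ ⟧ (⟦ p ⟧ x))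
            ≈⟨ G.+ᴹ-congˡ (G.+ᴹ-cong (G.+ᴹ-congʳ x≈0) (G.≈ᴹ-trans (_⟶_.⟦⟧-cong ρ px≈0) (_⟶_.0ᴹ-homo ρ))) ⟩
          ⟦ τ₁ ⟧ u G.+ᴹ (G.0ᴹ G.+ᴹ G.-ᴹ ⟦ τ₁ ⟧ u G.+ᴹ G.0ᴹ)
            ≈⟨ G.+ᴹ-congˡ (G.≈ᴹ-trans (G.+ᴹ-identityʳ _) (G.+ᴹ-identityˡ _)) ⟩
          ⟦ τ₁ ⟧ u G.+ᴹ G.-ᴹ ⟦ τ₁ ⟧ u
            ≈⟨ G.-ᴹ‿inverseʳ _ ⟩
          G.0ᴹ ∎
          where open SetoidReasoning G.≈ᴹ-setoid

      descended : Σ (G ⟶ ⟨R⟩) λ f̂ → ∀ e → ⟦ f̂ ⟧ (⟦ project ⟧ e) ≈ ⟦ Ψ ⟧ e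
      descended = descend project project-surjective Ψ Ψ-vanishes
      f̂ : G ⟶ ⟨R⟩
      f̂ = proj₁ descended

      f̂-extends : ∀ z → ⟦ f̂ ⟧ (proj₁ z) ≈ ⟦ f ⟧ z
      f̂-extends (x , px≈0) = R.trans (proj₂ descended ((x , P₁.0ᴹ) , e)) (R.trans (R.+-congʳ (_⟶_.0ᴹ-homo g))
        (R.trans (R.+-identityˡ _) (_⟶_.⟦⟧-cong f {⟦ residue′ ⟧ ((x , P₁.0ᴹ) , e)} {x , px≈0} same)))
        where
        e : ⟦ mismatch ⟧ (x , P₁.0ᴹ) P₀.≈ᴹ P₀.0ᴹ
        e = Differences.x-y≈0 (P 0) (P₀.≈ᴹ-trans (_⟶_.0ᴹ-homo (d 0)) (P₀.≈ᴹ-sym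
          (P₀.≈ᴹ-trans (_⟶_.⟦⟧-cong σ px≈0) (_⟶_.0ᴹ-homo σ))))
        same : x G.+ᴹ G.-ᴹ ⟦ τ₁ ⟧ P₁.0ᴹ G.+ᴹ ⟦ ρ ⟧ (⟦ p ⟧ x) G.≈ᴹ x
        same = G.≈ᴹ-trans (G.+ᴹ-cong
          (G.≈ᴹ-trans (G.+ᴹ-congˡ (G.≈ᴹ-trans (G.-ᴹ‿cong (_⟶_.0ᴹ-homo τ₁)) (Differences.-0≈0 G))) (G.+ᴹ-identityʳ x))
          (G.≈ᴹ-trans (_⟶_.⟦⟧-cong ρ px≈0) (_⟶_.0ᴹ-homo ρ))) (G.+ᴹ-identityʳ x)

    abstract
      -- The obstruction lies in `Ext¹` of the image of `p`, which is `Ext² Q` by dimension shifting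
      -- along the projective `F`.
      extend-functional : Σ (G ⟶ ⟨R⟩) λ f̂ → ∀ z → ⟦ f̂ ⟧ (proj₁ z) ≈ ⟦ f ⟧ z
      extend-functional = f̂ , f̂-extends

  -- The dual of `M` as a quotient of `Hom K₂ ⟨R⟩`.

  module DualOfKernel {M P₂ P₁ N F₂ F₁ : Mod}
    (α : M ⟶ P₂) (β : P₂ ⟶ P₁) (γ : P₁ ⟶ N)
    (α-inj : IsInjective α) (exact-P₂ : IsExact α β) (exact-P₁ : IsExact β γ) (γ-surj : IsSurjective γ)
    (Ext²Q≈0 : IsZero (Ext 2 (Submodule.asModule (image β)) ⟨R⟩)) (Ext²N≈0 : IsZero (Ext 2 N ⟨R⟩))
    (F₂-projective : IsProjective F₂) (F₁-projective : IsProjective F₁)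
    (π₂ : F₂ ⟶ P₂) (π₂-surj : IsSurjective π₂) (π₁ : F₁ ⟶ P₁) (π₁-surj : IsSurjective π₁)
    (C : F₂ ⟶ F₁) (π₁C : ∀ x → Module._≈ᴹ_ P₁ (⟦ π₁ ⟧ (⟦ C ⟧ x)) (⟦ β ⟧ (⟦ π₂ ⟧ x)))
    where
    private
      module M = Module M
      module P₂ = Module P₂
      module P₁ = Module P₁
      module N = Module N
      module F₂ = Module F₂
      module F₁ = Module F₁
      module α = _⟶_ α
      module β = _⟶_ β
      module γ = _⟶_ γ
      module π₂ = _⟶_ π₂
      module π₁ = _⟶_ π₁
      module C = _⟶_ C
      open ProjectiveResolution (standardResolution M) using (P; d; ε; exact-ε; exact-d)

    K₂ K₁ : Mod
    K₂ = Ker π₂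
    K₁ = Ker π₁

    private
      Z₀ : Mod
      Z₀ = Ker ε

      d₀′ : P 1 ⟶ Z₀
      d₀′ = corestrict (kernel ε) (d 0) (proj₁ exact-ε)

    C∈K₁ : ∀ x → x ∈ kernel (β ⊚ π₂) → ⟦ C ⟧ x ∈ kernel π₁
    C∈K₁ x e = P₁.≈ᴹ-trans (π₁C x) e

    Cᴷ : K₂ ⟶ K₁
    Cᴷ = corestrict (kernel π₁) (C ⊚ include (kernel π₂))
      λ (x , x∈) → C∈K₁ x (P₁.≈ᴹ-trans (β.⟦⟧-cong x∈) β.0ᴹ-homo)

    private
      lift-α : (x : ∣ M ∣) → ∃ λ y → ⟦ π₂ ⟧ y P₂.≈ᴹ ⟦ α ⟧ x
      lift-α x = π₂-surj (⟦ α ⟧ x)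

      ζ : P 0 ⟶ F₂
      ζ = lift (proj₁ ∘ lift-α)

      π₂ζ : ∀ t → ⟦ π₂ ⟧ (⟦ ζ ⟧ t) P₂.≈ᴹ ⟦ α ⟧ (⟦ ε ⟧ t)
      π₂ζ = lift-unique (π₂ ⊚ ζ) (α ⊚ ε) (proj₂ ∘ lift-α)

      ζ′ : Z₀ ⟶ K₂
      ζ′ = corestrict (kernel π₂) (ζ ⊚ include (kernel ε)) λ (t , εt≈0) →
        P₂.≈ᴹ-trans (π₂ζ t) (P₂.≈ᴹ-trans (α.⟦⟧-cong εt≈0) α.0ᴹ-homo)

      cocycle : (h : K₂ ⟶ ⟨R⟩) → ∀ v → ⟦ h ⟧ (⟦ ζ′ ⟧ (⟦ d₀′ ⟧ (⟦ d 1 ⟧ v))) ≈ 0#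
      cocycle h v = R.trans (_⟶_.⟦⟧-cong (h ⊚ ζ′) {⟦ d₀′ ⟧ (⟦ d 1 ⟧ v)} {Module.0ᴹ Z₀} (proj₁ (exact-d 0) v)) (_⟶_.0ᴹ-homo (h ⊚ ζ′))

    -- Up to sign, the connecting map from `Hom K₂ ⟨R⟩` to `Ext¹` of `P₂`, followed by the map
    -- induced by `α`. On cocycles it is pullback along `ζ`, which lifts `α ⊚ ε` and hence takes
    -- `Ker ε` into `K₂`.
    θ : Hom K₂ ⟨R⟩ ⟶ M ⋆
    θ = mkHom (λ h → h ⊚ (ζ′ ⊚ d₀′) , cocycle h)
      (λ e → 0-hom , λ u → R.trans (e _) (R.sym (R.+-identityʳ _)))
      (λ _ _ → 0-hom , λ u → R.sym (R.+-identityʳ _))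
      (λ _ _ → 0-hom , λ u → R.sym (R.+-identityʳ _))

    private
      βα≈0 : ∀ x → ⟦ β ⟧ (⟦ α ⟧ x) P₁.≈ᴹ P₁.0ᴹ
      βα≈0 = proj₁ exact-P₂

      Q : Mod
      Q = Submodule.asModule (image β)

      πQ : F₂ ⟶ Q
      πQ = corestrict (image β) (β ⊚ π₂) λ x → ⟦ π₂ ⟧ x , P₁.≈ᴹ-refl

      πQ-surj : IsSurjective πQ
      πQ-surj (y , x , e) = proj₁ (π₂-surj x) , P₁.≈ᴹ-trans (β.⟦⟧-cong (proj₂ (π₂-surj x))) e

      -- Its image is the preimage of `α M` in `F₂`. A functional on the source separates into one
      -- on `P 0`, which contributes a coboundary, and one on `K₂`.
      p : P 0 ⊕ᴹ K₂ ⟶ F₂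
      p = ζ ⊚ fst ⊹ include (kernel π₂) ⊚ snd

      π₂p : ∀ e → ⟦ π₂ ⟧ (⟦ p ⟧ e) P₂.≈ᴹ ⟦ α ⟧ (⟦ ε ⟧ (proj₁ e))
      π₂p (t , (y , y∈)) = P₂.≈ᴹ-trans (π₂.+ᴹ-homo (⟦ ζ ⟧ t) y)
        (P₂.≈ᴹ-trans (P₂.+ᴹ-cong (π₂ζ t) y∈) (P₂.+ᴹ-identityʳ _))

      p-exact : IsExact p πQ
      p-exact = (λ e → P₁.≈ᴹ-trans (β.⟦⟧-cong (π₂p e)) (βα≈0 (⟦ ε ⟧ (proj₁ e)))) ,
        λ y βπ₂y≈0 → let x , αx≈π₂y = proj₂ exact-P₂ (⟦ π₂ ⟧ y) βπ₂y≈0 in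
          (η x , (y F₂.+ᴹ F₂.-ᴹ ⟦ ζ ⟧ (η x) , P₂.≈ᴹ-trans (π₂.+ᴹ-homo y (F₂.-ᴹ ⟦ ζ ⟧ (η x)))
            (P₂.≈ᴹ-trans (P₂.+ᴹ-congˡ (π₂.-ᴹ-homo (⟦ ζ ⟧ (η x))))
              (Differences.x-y≈0 P₂ (P₂.≈ᴹ-sym (P₂.≈ᴹ-trans (π₂ζ (η x)) αx≈π₂y)))))) ,
          F₂.≈ᴹ-trans (F₂.+ᴹ-comm (⟦ ζ ⟧ (η x)) (y F₂.+ᴹ F₂.-ᴹ ⟦ ζ ⟧ (η x))) (Differences.[x-y]+y≈x F₂ y (⟦ ζ ⟧ (η x)))

      ker-p : ∀ e → e ∈ kernel p → ⟦ ε ⟧ (proj₁ e) M.≈ᴹ M.0ᴹ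
      ker-p e pe≈0 = α-inj (P₂.≈ᴹ-trans (P₂.≈ᴹ-sym (π₂p e)) (P₂.≈ᴹ-trans (π₂.⟦⟧-cong pe≈0)
        (P₂.≈ᴹ-trans π₂.0ᴹ-homo (P₂.≈ᴹ-sym α.0ᴹ-homo))))

    -- A cocycle is a functional on `Ker ε`, hence one on `kernel p` through the first component,
    -- and it extends to the whole source because `Ext²` of the image of `β` vanishes. The elements
    -- `(t, - ζ t)` of `kernel p` account for the sign in `h`.
    θ-surjective : IsSurjective θ
    θ-surjective (f , f-cocycle) = h , (Module.-ᴹ_ (Hom (P 0) ⟨R⟩) g , agree)
      where
      factored : Σ (Z₀ ⟶ ⟨R⟩) λ f′ → ∀ u → ⟦ f′ ⟧ (⟦ d₀′ ⟧ u) ≈ ⟦ f ⟧ u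
      factored = descend d₀′ (λ (t , εt≈0) → proj₂ exact-ε t εt≈0) f λ u du≈0 →
        R.trans (_⟶_.⟦⟧-cong f (Module.≈ᴹ-sym (P 1) (proj₂ (proj₂ (exact-d 0) u du≈0))))
          (f-cocycle (proj₁ (proj₂ (exact-d 0) u du≈0)))
      f′ : Z₀ ⟶ ⟨R⟩
      f′ = proj₁ factored
      f″ : Ker p ⟶ ⟨R⟩
      f″ = f′ ⊚ corestrict (kernel ε) (fst ⊚ include (kernel p)) λ (e , pe≈0) → ker-p e pe≈0
      extended : Σ (P 0 ⊕ᴹ K₂ ⟶ ⟨R⟩) λ f̂ → ∀ z → ⟦ f̂ ⟧ (proj₁ z) ≈ ⟦ f″ ⟧ z
      extended = extend-functional F₂-projective πQ πQ-surj p p-exact Ext²Q≈0 f″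
      f̂ : P 0 ⊕ᴹ K₂ ⟶ ⟨R⟩
      f̂ = proj₁ extended
      g : P 0 ⟶ ⟨R⟩
      g = f̂ ⊚ inl
      h : K₂ ⟶ ⟨R⟩
      h = Module.-ᴹ_ (Hom K₂ ⟨R⟩) (f̂ ⊚ inr)
      split : ∀ (t : ∣ Z₀ ∣) → ⟦ f′ ⟧ t ≈ ⟦ g ⟧ (proj₁ t) + ⟦ h ⟧ (⟦ ζ′ ⟧ t)
      split t = R.trans (R.trans (_⟶_.⟦⟧-cong f′ {t} {proj₁ t , ker-p (proj₁ t , k) closed} (Module.≈ᴹ-refl (P 0)))
          (R.sym (proj₂ extended ((proj₁ t , k) , closed))))
        (R.trans (_⟶_.⟦⟧-cong f̂ (inl+inr {P 0} {K₂} (proj₁ t) k)) (R.trans (_⟶_.+ᴹ-homo f̂ _ _)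
          (R.+-congˡ (_⟶_.-ᴹ-homo (f̂ ⊚ inr) (⟦ ζ′ ⟧ t)))))
        where
        k : ∣ K₂ ∣
        k = Module.-ᴹ_ K₂ (⟦ ζ′ ⟧ t)
        closed : (proj₁ t , k) ∈ kernel p
        closed = F₂.-ᴹ‿inverseʳ (⟦ ζ ⟧ (proj₁ t))
      agree : ∀ u → ⟦ h ⟧ (⟦ ζ′ ⟧ (⟦ d₀′ ⟧ u)) ≈ ⟦ f ⟧ u + R.- ⟦ g ⟧ (⟦ d 0 ⟧ u)
      agree u = R.sym (R.trans (R.+-congʳ (R.trans (R.sym (proj₂ factored u)) (split (⟦ d₀′ ⟧ u))))
        (R.trans (R.+-congʳ (R.+-comm _ _)) (R.trans (R.+-assoc _ _ _) (R.trans (R.+-congˡ (R.-‿inverseʳ _)) (R.+-identityʳ _)))))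

    Extends : K₂ ⟶ ⟨R⟩ → F₂ ⟶ ⟨R⟩ → K₁ ⟶ ⟨R⟩ → Set ℓ
    Extends h c ψ = ∀ x → ⟦ h ⟧ x ≈ ⟦ c ⟧ (proj₁ x) + ⟦ ψ ⟧ (⟦ Cᴷ ⟧ x)

    -- Since `β ⊚ α` is zero, `C ⊚ ζ` maps all of `P 0`, not just `Ker ε`, into `K₁`. So the part
    -- with `ψ` pulls back to a coboundary just as the part with `c` does.
    θ-vanishes : ∀ h c ψ → Extends h c ψ → h ∈ kernel θ
    θ-vanishes h c ψ e = c ⊚ ζ ⊹ ψ ⊚ Cζ , λ u → R.trans (e (⟦ ζ′ ⟧ (⟦ d₀′ ⟧ u))) (R.trans
      (R.+-congˡ (_⟶_.⟦⟧-cong ψ {⟦ Cᴷ ⟧ (⟦ ζ′ ⟧ (⟦ d₀′ ⟧ u))} {⟦ Cζ ⟧ (⟦ d 0 ⟧ u)} F₁.≈ᴹ-refl)) (R.sym (R.+-identityˡ _)))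
      where
      Cζ : P 0 ⟶ K₁
      Cζ = corestrict (kernel π₁) (C ⊚ ζ) λ t → C∈K₁ (⟦ ζ ⟧ t) (P₁.≈ᴹ-trans (β.⟦⟧-cong (π₂ζ t)) (βα≈0 (⟦ ε ⟧ t)))

    -- If `h` becomes the coboundary of `g`, then `g` and `h` glue to a functional `h̃` on the
    -- preimage of `α M`. Pulled back to `Ker q`, it extends to `F₂ ⊕ᴹ K₁` because `Ext²` of `N`
    -- vanishes; the element `(x, - C x)` of `kernel q` then reads off `c` and `ψ`.
    ker-θ : ∀ h → h ∈ kernel θ → ∃ λ c → ∃ λ ψ → Extends h c ψ
    ker-θ h (g , h≈g) = f̂ ⊚ inl , Module.-ᴹ_ (Hom K₁ ⟨R⟩) (f̂ ⊚ inr) , extends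
      where
      h≈g′ : ∀ t → ⟦ h ⟧ (⟦ ζ′ ⟧ t) ≈ ⟦ g ⟧ (proj₁ t)
      h≈g′ (t , εt≈0) = R.trans (_⟶_.⟦⟧-cong (h ⊚ ζ′) {t , εt≈0} {⟦ d₀′ ⟧ (η (t , εt≈0))} (Module.≈ᴹ-refl (P 0)))
        (R.trans (h≈g (η (t , εt≈0))) (R.+-identityˡ _))
      KQ : Mod
      KQ = Ker πQ
      p′ : P 0 ⊕ᴹ K₂ ⟶ KQ
      p′ = corestrict (kernel πQ) p (proj₁ p-exact)
      Ψ : P 0 ⊕ᴹ K₂ ⟶ ⟨R⟩
      Ψ = g ⊚ fst ⊹ h ⊚ snd
      Ψ-vanishes : ∀ e → e ∈ kernel p′ → e ∈ kernel Ψ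
      Ψ-vanishes (t , k) pe≈0 = R.trans (R.+-congʳ (R.sym (h≈g′ t′))) (R.trans (R.sym (_⟶_.+ᴹ-homo h (⟦ ζ′ ⟧ t′) k))
        (R.trans (_⟶_.⟦⟧-cong h {Module._+ᴹ_ K₂ (⟦ ζ′ ⟧ t′) k} {Module.0ᴹ K₂} pe≈0) (_⟶_.0ᴹ-homo h)))
        where
        t′ : ∣ Z₀ ∣
        t′ = t , ker-p (t , k) pe≈0
      descended : Σ (KQ ⟶ ⟨R⟩) λ h̃ → ∀ e → ⟦ h̃ ⟧ (⟦ p′ ⟧ e) ≈ ⟦ Ψ ⟧ e
      descended = descend p′ (λ (y , y∈) → proj₂ p-exact y y∈) Ψ Ψ-vanishes
      h̃ : KQ ⟶ ⟨R⟩
      h̃ = proj₁ descended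
      h̃-extends : ∀ (k : ∣ K₂ ∣) (k∈ : proj₁ k ∈ kernel πQ) → ⟦ h̃ ⟧ (proj₁ k , k∈) ≈ ⟦ h ⟧ k
      h̃-extends k k∈ = R.trans (_⟶_.⟦⟧-cong h̃ {proj₁ k , k∈} {⟦ p′ ⟧ (Module.0ᴹ (P 0) , k)}
          (F₂.≈ᴹ-sym (F₂.≈ᴹ-trans (F₂.+ᴹ-congʳ (_⟶_.0ᴹ-homo ζ)) (F₂.+ᴹ-identityˡ _))))
        (R.trans (proj₂ descended (Module.0ᴹ (P 0) , k)) (R.trans (R.+-congʳ (_⟶_.0ᴹ-homo g)) (R.+-identityˡ _)))

      πN : F₁ ⟶ N
      πN = γ ⊚ π₁
      πN-surj : IsSurjective πN
      πN-surj y = let x , γx≈y = γ-surj y ; z , π₁z≈x = π₁-surj x in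
        z , N.≈ᴹ-trans (γ.⟦⟧-cong π₁z≈x) γx≈y
      q : F₂ ⊕ᴹ K₁ ⟶ F₁
      q = C ⊚ fst ⊹ include (kernel π₁) ⊚ snd
      π₁q : ∀ e → ⟦ π₁ ⟧ (⟦ q ⟧ e) P₁.≈ᴹ ⟦ β ⟧ (⟦ π₂ ⟧ (proj₁ e))
      π₁q (x , (y , y∈)) = P₁.≈ᴹ-trans (π₁.+ᴹ-homo (⟦ C ⟧ x) y) (P₁.≈ᴹ-trans (P₁.+ᴹ-cong (π₁C x) y∈) (P₁.+ᴹ-identityʳ _))
      q-exact : IsExact q πN
      q-exact = (λ e → N.≈ᴹ-trans (γ.⟦⟧-cong (π₁q e)) (proj₁ exact-P₁ (⟦ π₂ ⟧ (proj₁ e)))) ,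
        λ y γπ₁y≈0 → let b , βb≈ = proj₂ exact-P₁ (⟦ π₁ ⟧ y) γπ₁y≈0 ; x , π₂x≈b = π₂-surj b in
          (x , (y F₁.+ᴹ F₁.-ᴹ ⟦ C ⟧ x , P₁.≈ᴹ-trans (π₁.+ᴹ-homo y (F₁.-ᴹ ⟦ C ⟧ x)) (P₁.≈ᴹ-trans
              (P₁.+ᴹ-congˡ (π₁.-ᴹ-homo (⟦ C ⟧ x))) (Differences.x-y≈0 P₁ (P₁.≈ᴹ-sym
                (P₁.≈ᴹ-trans (π₁C x) (P₁.≈ᴹ-trans (β.⟦⟧-cong π₂x≈b) βb≈))))))) ,
          F₁.≈ᴹ-trans (F₁.+ᴹ-comm (⟦ C ⟧ x) (y F₁.+ᴹ F₁.-ᴹ ⟦ C ⟧ x)) (Differences.[x-y]+y≈x F₁ y (⟦ C ⟧ x))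
      to-KQ : Ker q ⟶ KQ
      to-KQ = corestrict (kernel πQ) (fst ⊚ include (kernel q)) λ (e , qe≈0) →
        P₁.≈ᴹ-trans (P₁.≈ᴹ-sym (π₁q e)) (P₁.≈ᴹ-trans (π₁.⟦⟧-cong qe≈0) π₁.0ᴹ-homo)
      extended : Σ (F₂ ⊕ᴹ K₁ ⟶ ⟨R⟩) λ f̂ → ∀ z → ⟦ f̂ ⟧ (proj₁ z) ≈ ⟦ h̃ ⊚ to-KQ ⟧ z
      extended = extend-functional F₁-projective πN πN-surj q q-exact Ext²N≈0 (h̃ ⊚ to-KQ)
      f̂ : F₂ ⊕ᴹ K₁ ⟶ ⟨R⟩
      f̂ = proj₁ extended
      extends : ∀ x → ⟦ h ⟧ x ≈ ⟦ f̂ ⊚ inl ⟧ (proj₁ x) + R.- ⟦ f̂ ⊚ inr ⟧ (⟦ Cᴷ ⟧ x)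
      extends x = R.trans (R.sym (h̃-extends x (proj₂ (⟦ to-KQ ⟧ ((proj₁ x , k) , closed)))))
        (R.trans (R.sym (proj₂ extended ((proj₁ x , k) , closed)))
        (R.trans (_⟶_.⟦⟧-cong f̂ (inl+inr {F₂} {K₁} (proj₁ x) k)) (R.trans (_⟶_.+ᴹ-homo f̂ _ _)
          (R.+-congˡ (_⟶_.-ᴹ-homo (f̂ ⊚ inr) (⟦ Cᴷ ⟧ x))))))
        where
        k : ∣ K₁ ∣
        k = Module.-ᴹ_ K₁ (⟦ Cᴷ ⟧ x)
        closed : (proj₁ x , k) ∈ kernel q
        closed = F₁.-ᴹ‿inverseʳ (⟦ C ⟧ (proj₁ x))

-- Base change of determinants, and lattices over the larger ring.

module Extension {ℓ} (R Q : CommutativeRing ℓ ℓ) (φ : CommutativeRing.Carrier R → CommutativeRing.Carrier Q)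
  (φ-homo : IsRingHomomorphism (CommutativeRing.rawRing R) (CommutativeRing.rawRing Q) φ) where

  open Modules R hiding (δ; refl; sym; trans)
  open ModuleTheory R
  open CommutativeRing Q hiding (zero)
  open Modules Q using () renaming (det to detᵠ)
  open Determinants Q
  private
    module R = CommutativeRing R
    module φ = IsRingHomomorphism φ-homo
  open Determinants R using () renaming (sgn to sgnᴿ; δ to δᴿ; sum-δ to sum-δᴿ)
  open SemiringSum semiring using (sum; sum-cong-≋; *-distribʳ-sum)
  open SemiringSum R.semiring using () renaming (sum to sumᴿ)
  open SetoidReasoning setoid
  open import Algebra.Solver.Ring.NaturalCoefficients.Default commutativeSemiring
    using (solve; _:=_; _:+_; _:*_; con)

  φ-sum : ∀ {n} (f : Fin n → R.Carrier) → φ (sumᴿ f) ≈ sum (φ ∘ f)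
  φ-sum {zero}  f = φ.0#-homo
  φ-sum {suc n} f = trans (φ.+-homo _ _) (+-congˡ (φ-sum (f ∘ suc)))

  φ-dot : ∀ {n} (f g : Fin n → R.Carrier) → φ (sumᴿ λ i → f i R.* g i) ≈ sum λ i → φ (f i) * φ (g i)
  φ-dot f g = trans (φ-sum λ i → f i R.* g i) (sum-cong-≋ λ i → φ.*-homo (f i) (g i))

  φ-δ : ∀ {n} (i j : Fin n) → φ (δᴿ i j) ≈ δ i j
  φ-δ zero    zero    = φ.1#-homo
  φ-δ zero    (suc j) = φ.0#-homo
  φ-δ (suc i) zero    = φ.0#-homo
  φ-δ (suc i) (suc j) = φ-δ i j

  φ-sgn : ∀ {n} (i : Fin n) → φ (sgnᴿ i) ≈ sgn i
  φ-sgn zero    = φ.1#-homo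
  φ-sgn (suc i) = trans (φ.*-homo _ _) (*-cong (trans (φ.-‿homo _) (-‿cong φ.1#-homo)) (φ-sgn i))

  φ-det : ∀ {n} (M : Fin n → Fin n → R.Carrier) → φ (det M) ≈ detᵠ λ i j → φ (M i j)
  φ-det {zero}  M = φ.1#-homo
  φ-det {suc n} M = trans (φ-sum λ j → sgnᴿ j R.* M zero j R.* det λ i k → M (suc i) (punchIn j k))
    (sum-cong-≋ λ j → trans (φ.*-homo _ _) (*-cong (trans (φ.*-homo (sgnᴿ j) (M zero j)) (*-congʳ (φ-sgn j)))
      (φ-det λ i k → M (suc i) (punchIn j k))))

  -- As s Rⁿ ⊆ L and s is invertible in Q, a functional on L is evaluation against a vector over Q.
  module Lattice {n} (L : Submodule (Vec n)) (B : DualBasis (Submodule.asModule L))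
    (s : R.Carrier) (s∈ : ∀ i → Module._*ₗ_ (Vec n) s (δᴿ i) ∈ L) (s⁻¹ : Carrier) (ss⁻¹ : φ s * s⁻¹ ≈ 1#) where
    open DualBasis B
    K : Mod
    K = Submodule.asModule L
    private module K = Module K

    basis : Mat size n
    basis l i = φ (proj₁ (vectors l) i)

    scaled-basis : Fin n → ∣ K ∣
    scaled-basis i = Module._*ₗ_ (Vec n) s (δᴿ i) , s∈ i

    -- The values at the unit vectors of the linear extension of `f` over `Q`; since only `s` times
    -- a unit vector is known to lie in `L`, a division by `s` is required.
    rowOf : (K ⟶ ⟨R⟩) → Fin n → Carrier
    rowOf f j = φ (⟦ f ⟧ (scaled-basis j)) * s⁻¹

    form : Fin size → K ⟶ ⟨R⟩
    form l = coord l ⊚ forms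

    dual : Mat n size
    dual j l = rowOf (form l) j

    cancel : ∀ {x y} → φ s * x ≈ y → x ≈ y * s⁻¹
    cancel {x} {y} e = begin
      x                  ≈⟨ *-identityˡ x ⟨
      1# * x             ≈⟨ *-congʳ ss⁻¹ ⟨
      φ s * s⁻¹ * x      ≈⟨ solve 3 (λ s t x → s :* t :* x := s :* x :* t) refl (φ s) s⁻¹ x ⟩
      φ s * x * s⁻¹      ≈⟨ *-congʳ e ⟩
      y * s⁻¹            ∎

    -- In `K`, `s x` is the combination of the vectors `scaled-basis j` with the coordinates of `x`;
    -- apply `f` and cancel `s`.
    evaluate : ∀ f (x : ∣ K ∣) → φ (⟦ f ⟧ x) ≈ sum λ j → φ (proj₁ x j) * rowOf f j
    evaluate f x = trans (cancel multiple) (trans (*-distribʳ-sum s⁻¹ λ j → φ (proj₁ x j) * φ (⟦ f ⟧ (scaled-basis j)))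
      (sum-cong-≋ λ j → *-assoc (φ (proj₁ x j)) (φ (⟦ f ⟧ (scaled-basis j))) s⁻¹))
      where
      s·x : K._≈ᴹ_ (s K.*ₗ x) (⟦ comb {K} scaled-basis ⟧ (proj₁ x))
      s·x = Module.≈ᴹ-sym (Vec n) {⟦ include L ⟧ (⟦ comb {K} scaled-basis ⟧ (proj₁ x))} {λ i → s R.* proj₁ x i} λ i →
        R.trans (hom-comb {K} {⟨R⟩} (coord i ⊚ include L) scaled-basis (proj₁ x) )
          (R.trans (sumᴿ-cong λ j → x∙yz≈y∙xz (proj₁ x j) s (δᴿ j i))
            (R.trans (R.sym (*-distribˡ-sumᴿ s λ j → proj₁ x j R.* δᴿ j i)) (R.*-congˡ (sum-δᴿ (proj₁ x) i))))
        where
        open SemiringSum R.semiring using () renaming (sum-cong-≋ to sumᴿ-cong; *-distribˡ-sum to *-distribˡ-sumᴿ)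
        open CommutativeSemigroupProperties R.*-commutativeSemigroup using (x∙yz≈y∙xz)
      multiple : φ s * φ (⟦ f ⟧ x) ≈ sum λ j → φ (proj₁ x j) * φ (⟦ f ⟧ (scaled-basis j))
      multiple = begin
        φ s * φ (⟦ f ⟧ x)                                     ≈⟨ φ.*-homo s (⟦ f ⟧ x) ⟨
        φ (s R.* ⟦ f ⟧ x)                                     ≈⟨ φ.⟦⟧-cong (_⟶_.*ₗ-homo f s x) ⟨
        φ (⟦ f ⟧ (s K.*ₗ x))
          ≈⟨ φ.⟦⟧-cong (R.trans (_⟶_.⟦⟧-cong f {s K.*ₗ x} {⟦ comb {K} scaled-basis ⟧ (proj₁ x)} s·x)
               (hom-comb {K} {⟨R⟩} f scaled-basis (proj₁ x))) ⟩
        φ (sumᴿ λ j → proj₁ x j R.* ⟦ f ⟧ (scaled-basis j))   ≈⟨ φ-dot (proj₁ x) (λ j → ⟦ f ⟧ (scaled-basis j)) ⟩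
        sum (λ j → φ (proj₁ x j) * φ (⟦ f ⟧ (scaled-basis j))) ∎

    expand-form : ∀ (f : K ⟶ ⟨R⟩) x → sumᴿ (λ l → ⟦ forms ⟧ x l R.* ⟦ f ⟧ (vectors l)) R.≈ ⟦ f ⟧ x
    expand-form f x = R.trans (R.sym (hom-comb {K} {⟨R⟩} f vectors (⟦ forms ⟧ x)))
      (_⟶_.⟦⟧-cong f {⟦ comb {K} vectors ⟧ (⟦ forms ⟧ x)} {x} (expand x))

    expand-coordinates : ∀ (x : ∣ K ∣) i → (sum λ l → φ (⟦ forms ⟧ x l) * basis l i) ≈ φ (proj₁ x i)
    expand-coordinates x i = trans (sym (φ-dot (⟦ forms ⟧ x) (λ l → proj₁ (vectors l) i)))
      (φ.⟦⟧-cong (expand-form (coord i ⊚ include L) x))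

    -- Expand `scaled-basis j` in the dual basis and divide by `s`. In the opposite order the
    -- product is the matrix of the values of the forms on the vectors, in general only an
    -- idempotent.
    dual⊗basis : dual ⊗ basis ≋ δ
    dual⊗basis j i = begin
      sum (λ l → φ (⟦ forms ⟧ (scaled-basis j) l) * s⁻¹ * basis l i)
        ≈⟨ sum-cong-≋ (λ l → solve 3 (λ f t b → f :* t :* b := f :* b :* t) refl _ s⁻¹ (basis l i)) ⟩
      sum (λ l → φ (⟦ forms ⟧ (scaled-basis j) l) * basis l i * s⁻¹)
        ≈⟨ *-distribʳ-sum s⁻¹ (λ l → φ (⟦ forms ⟧ (scaled-basis j) l) * basis l i) ⟨
      sum (λ l → φ (⟦ forms ⟧ (scaled-basis j) l) * basis l i) * s⁻¹
        ≈⟨ *-congʳ (expand-coordinates (scaled-basis j) i) ⟩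
      φ (s R.* δᴿ j i) * s⁻¹
        ≈⟨ cancel (sym (trans (φ.*-homo s _) (*-congˡ (φ-δ j i)))) ⟨
      δ j i ∎

  -- Comparison of products of minors for the two presentations.

  -- RelN stands for the relations between the generators of N that come from Rⁿ, RelD for those
  -- between the generators of M* that come from the forms of B₂.
  module Comparison {n m} (L₁ : Submodule (Vec n)) (L₂ : Submodule (Vec m))
    (B₁ : DualBasis (Submodule.asModule L₁)) (B₂ : DualBasis (Submodule.asModule L₂))
    (s₁ s₂ : R.Carrier) (s₁∈ : ∀ i → Module._*ₗ_ (Vec n) s₁ (δᴿ i) ∈ L₁) (s₂∈ : ∀ i → Module._*ₗ_ (Vec m) s₂ (δᴿ i) ∈ L₂)
    (s₁⁻¹ s₂⁻¹ : Carrier) (s₁s₁⁻¹ : φ s₁ * s₁⁻¹ ≈ 1#) (s₂s₂⁻¹ : φ s₂ * s₂⁻¹ ≈ 1#)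
    (C : Vec m ⟶ Vec n) (Cᴷ : Submodule.asModule L₂ ⟶ Submodule.asModule L₁)
    (Cᴷ≈C : ∀ x j → proj₁ (⟦ Cᴷ ⟧ x) j R.≈ ⟦ C ⟧ (proj₁ x) j)
    (RelN : (Fin n → R.Carrier) → Set ℓ) (RelD : (Fin (DualBasis.size B₂) → R.Carrier) → Set ℓ)
    where
    private
      module X₁ = Lattice L₁ B₁ s₁ s₁∈ s₁⁻¹ s₁s₁⁻¹
      module X₂ = Lattice L₂ B₂ s₂ s₂∈ s₂⁻¹ s₂s₂⁻¹
      a b : ℕ
      a = DualBasis.size B₁
      b = DualBasis.size B₂
      open DualBasis B₁ using () renaming (vectors to κ₁; forms to forms₁)
      open DualBasis B₂ using () renaming (vectors to κ₂; forms to forms₂)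
      K₁ K₂ : Mod
      K₁ = Submodule.asModule L₁
      K₂ = Submodule.asModule L₂

      Cᵠ : Mat m n
      Cᵠ i j = φ (⟦ C ⟧ (δᴿ i) j)

      φ-C : ∀ x j → φ (⟦ C ⟧ x j) ≈ sum λ i → φ (x i) * Cᵠ i j
      φ-C x j = trans (φ.⟦⟧-cong (hom-δ {⟨R⟩} (coord j ⊚ C) x)) (φ-dot x λ i → ⟦ C ⟧ (δᴿ i) j)

    module _ {p} (N : AdditiveSubgroup p) (scalar : ∀ r → AdditiveSubgroup.Multiplier N (φ r)) where
      open AdditiveSubgroup N
      private
        scalar′ : ∀ {x} r → φ r ≈ x → Multiplier x
        scalar′ r e = multiplier-resp N e (scalar r)

      -- The inclusion of 𝓕(P₂) 𝓕(N) in 𝓕(P₁) 𝓕(M*), on products of minors. A relation of `N` is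
      -- `k + C z` with `k` in `L₁`; multiplied by `X₁.dual` this becomes `F = G + Z D` with `G` and
      -- `Z` over `R`.
      lattice-to-dual :
        (∀ {x} → RelN x → ∃ λ z → Module._+ᴹ_ (Vec n) x (Module.-ᴹ_ (Vec n) (⟦ C ⟧ z)) ∈ L₁) →
        (∀ v (c : Vec m ⟶ ⟨R⟩) (ψ : K₁ ⟶ ⟨R⟩) →
          (∀ y → sumᴿ (λ l → v l R.* ⟦ forms₂ ⟧ y l) R.≈ ⟦ c ⟧ (proj₁ y) R.+ ⟦ ψ ⟧ (⟦ Cᴷ ⟧ y)) → RelD v) →
        (∀ A V → (∀ i → A i ∈ L₁) → (∀ i → RelD (V i)) → member (φ (det A) * φ (det V))) →
        ∀ Y X → (∀ i → Y i ∈ L₂) → (∀ i → RelN (X i)) → member (φ (det Y) * φ (det X))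
      lattice-to-dual RelN⇒ ⇒RelD h Y X Y∈ X∈ = ∈-resp (*-cong (sym (φ-det Y)) (sym (φ-det X)))
        (presentation-to-dual N X₂.basis X₂.dual Column X₁.basis D {F} {G} Z H
          (λ i j → trans (⊗-assoc Xᵠ X₁.dual X₁.basis i j) (trans (⊗-cong {M = Xᵠ} (λ _ _ → refl) X₁.dual⊗basis i j) (⊗δ Xᵠ i j)))
          F≋
          (λ i j → X₂.expand-coordinates (Y i , Y∈ i) j)
          (λ i j → scalar _) (λ i j → scalar _) (λ i j → scalar _)
          columnW columnD columnδ combine)
        where
        Xᵠ : Mat n n
        Xᵠ i j = φ (X i j)
        D : Mat m a
        D = Cᵠ ⊗ X₁.dual
        F : Mat n a
        F = Xᵠ ⊗ X₁.dual
        z : Fin n → Fin m → R.Carrier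
        z i = proj₁ (RelN⇒ (X∈ i))
        k : Fin n → ∣ K₁ ∣
        k i = _ , proj₂ (RelN⇒ (X∈ i))
        G : Mat n a
        G i l = φ (⟦ forms₁ ⟧ (k i) l)
        Z : Mat n m
        Z i j = φ (z i j)
        H : Mat m b
        H i l = φ (⟦ forms₂ ⟧ (Y i , Y∈ i) l)
        kᵠ : Mat n n
        kᵠ i j = φ (proj₁ (k i) j)
        X≋ : Xᵠ ≋ kᵠ ⊞ Z ⊗ Cᵠ
        X≋ i j = trans (φ.⟦⟧-cong (R.sym (Differences.[x-y]+y≈x ⟨R⟩ (X i j) (⟦ C ⟧ (z i) j))))
          (trans (φ.+-homo _ _) (+-congˡ (φ-C (z i) j)))
        F≋ : F ≋ G ⊞ Z ⊗ D
        F≋ i l = trans (⊗-cong {N = X₁.dual} X≋ (λ _ _ → refl) i l) (trans (⊞-⊗ kᵠ (Z ⊗ Cᵠ) X₁.dual i l)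
          (+-cong (sym (X₁.evaluate (X₁.form l) (k i))) (⊗-assoc Z Cᵠ X₁.dual i l)))
        Column : (Fin b → Carrier) → Set ℓ
        Column v = ∃ λ v′ → (∀ l → v l ≈ φ (v′ l)) × RelD v′
        -- A functional on `K₂` has its values at the `κ₂ l` as coefficients in the coordinate
        -- forms, so a functional that dies in the dual gives a relation.
        fromFunctional : ∀ (c : Vec m ⟶ ⟨R⟩) (ψ : K₁ ⟶ ⟨R⟩) v →
          (∀ l → v l ≈ φ (⟦ c ⟧ (proj₁ (κ₂ l)) R.+ ⟦ ψ ⟧ (⟦ Cᴷ ⟧ (κ₂ l)))) → Column v
        fromFunctional c ψ v e = (λ l → ⟦ f ⟧ (κ₂ l)) , e ,
          ⇒RelD _ c ψ λ y → R.trans (sumᴿ-cong λ l → R.*-comm (⟦ f ⟧ (κ₂ l)) (⟦ forms₂ ⟧ y l)) (X₂.expand-form f y)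
          where
          open SemiringSum R.semiring using () renaming (sum-cong-≋ to sumᴿ-cong)
          f : K₂ ⟶ ⟨R⟩
          f = c ⊚ include L₂ ⊹ ψ ⊚ Cᴷ
        columnδ : ∀ j → Column λ i → (X₂.basis ⊗ δ) i j
        columnδ j = fromFunctional (coord j) 0-hom _ λ l → trans (⊗δ X₂.basis l j) (φ.⟦⟧-cong (R.sym (R.+-identityʳ _)))
        columnD : ∀ j → Column λ i → (X₂.basis ⊗ D) i j
        columnD j = fromFunctional 0-hom (X₁.form j) _ λ l → sym (begin
          φ (R.0# R.+ ⟦ X₁.form j ⟧ (⟦ Cᴷ ⟧ (κ₂ l)))          ≈⟨ φ.⟦⟧-cong (R.+-identityˡ _) ⟩
          φ (⟦ X₁.form j ⟧ (⟦ Cᴷ ⟧ (κ₂ l)))                   ≈⟨ X₁.evaluate (X₁.form j) (⟦ Cᴷ ⟧ (κ₂ l)) ⟩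
          sum (λ i → φ (proj₁ (⟦ Cᴷ ⟧ (κ₂ l)) i) * X₁.dual i j)
            ≈⟨ sum-cong-≋ (λ i → *-congʳ (trans (φ.⟦⟧-cong (Cᴷ≈C (κ₂ l) i)) (φ-C (proj₁ (κ₂ l)) i))) ⟩
          ((X₂.basis ⊗ Cᵠ) ⊗ X₁.dual) l j                     ≈⟨ ⊗-assoc X₂.basis Cᵠ X₁.dual l j ⟩
          (X₂.basis ⊗ D) l j                                  ∎)
        -- A relation that holds already between the forms on `K₂`: the `j`-th form minus its own
        -- expansion in the dual basis is zero. Hence both functionals are zero.
        columnW : ∀ j → Column λ i → complement X₂.basis X₂.dual i j
        columnW j = v , (λ l → sym (trans (φ.+-homo _ _) (+-cong (φ-δ l j)
            (trans (φ.-‿homo _) (-‿cong (X₂.evaluate (X₂.form j) (κ₂ l))))))) ,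
          ⇒RelD v 0-hom 0-hom λ y → R.trans (vanishes y) (R.sym (R.+-identityˡ _))
          where
          open SemiringSum R.semiring using () renaming (sum-cong-≋ to sumᴿ-cong; ∑-distrib-+ to sumᴿ-+)
          v : Fin b → R.Carrier
          v l = δᴿ l j R.+ R.- ⟦ forms₂ ⟧ (κ₂ l) j
          vanishes : ∀ y → sumᴿ (λ l → v l R.* ⟦ forms₂ ⟧ y l) R.≈ R.0#
          vanishes y = R.trans (sumᴿ-cong λ l → R.trans (R.*-comm (v l) (⟦ forms₂ ⟧ y l))
              (R.distribˡ (⟦ forms₂ ⟧ y l) (δᴿ l j) (R.- ⟦ forms₂ ⟧ (κ₂ l) j)))
            (R.trans (sumᴿ-+ (λ l → ⟦ forms₂ ⟧ y l R.* δᴿ l j) (λ l → ⟦ forms₂ ⟧ y l R.* R.- ⟦ forms₂ ⟧ (κ₂ l) j))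
            (R.trans (R.+-cong (sum-δᴿ (⟦ forms₂ ⟧ y) j) (X₂.expand-form (Module.-ᴹ_ (Hom K₂ ⟨R⟩) (X₂.form j)) y))
              (R.-‿inverseʳ _)))
        combine : ∀ (I : Fin n → Fin a) (V : Mat b b) → (∀ j → Column λ i → V i j) →
          member (detᵠ (λ i → X₁.basis (I i)) * detᵠ V)
        combine I V V∈ = ∈-resp (*-cong (φ-det λ i → proj₁ (κ₁ (I i)))
            (trans (φ-det V′) (trans (det-cong λ i j → sym (proj₁ (proj₂ (V∈ i)) j)) (det-ᵀ V))))
          (h (λ i → proj₁ (κ₁ (I i))) V′ (λ i → proj₂ (κ₁ (I i))) λ j → proj₂ (proj₂ (V∈ j)))
          where
          V′ : Fin b → Fin b → R.Carrier
          V′ j = proj₁ (V∈ j)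

      -- The reverse inclusion. `V` enters transposed, with relations of the dual as columns. The
      -- decomposition of `Λ` is the identity `h = c + ψ ⊚ Cᴷ` at the vectors `X₂.scaled-basis i`,
      -- divided by `s₂`.
      dual-to-lattice :
        (∀ i → RelN (λ j → R.- ⟦ C ⟧ (δᴿ i) j)) → (∀ {x} → x ∈ L₁ → RelN x) →
        (∀ {v} → RelD v → ∃ λ (c : Vec m ⟶ ⟨R⟩) → ∃ λ (ψ : K₁ ⟶ ⟨R⟩) →
          ∀ y → sumᴿ (λ l → v l R.* ⟦ forms₂ ⟧ y l) R.≈ ⟦ c ⟧ (proj₁ y) R.+ ⟦ ψ ⟧ (⟦ Cᴷ ⟧ y)) →
        (∀ Y X → (∀ i → Y i ∈ L₂) → (∀ i → RelN (X i)) → member (φ (det Y) * φ (det X))) →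
        ∀ A V → (∀ i → A i ∈ L₁) → (∀ i → RelD (V i)) → member (φ (det A) * φ (det V))
      dual-to-lattice C-RelN L₁-RelN RelD⇒ h A V A∈ V∈ = ∈-resp (*-cong (sym (φ-det A)) (trans (det-ᵀ Vᵠ) (sym (φ-det V))))
        (dual-to-presentation X₂.basis X₂.dual X₂.dual⊗basis (Vᵠ ᵀ) N Row Cᵠ X₁.dual Γ Z G Λ≋
          (λ i j → scalar _) (λ i j → scalar _)
          -- The rows of `A` lie in `L₁`, so the entries of `Γ ⊗ X₁.dual` are values of coordinate
          -- forms and the denominators cancel.
          (λ i l → scalar′ _ (X₁.evaluate (X₁.form l) (A i , A∈ i)))
          (λ i j → multiplier-sum N {f = λ l → complement X₂.basis X₂.dual i l * Vᵠ j l} λ l →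
            multiplier-* N {complement X₂.basis X₂.dual i l} {Vᵠ j l}
              (multiplier-+ N {δ i l} { - (X₂.basis ⊗ X₂.dual) i l} (multiplier-δ N i l)
                (multiplier-neg N {(X₂.basis ⊗ X₂.dual) i l} (scalar′ _ (X₂.evaluate (X₂.form l) (κ₂ i)))))
              (scalar (V j l)))
          (λ i → _ , (λ j → sym (φ.-‿homo _)) , C-RelN i)
          (λ i → _ , (λ j → refl) , L₁-RelN (A∈ i))
          combine)
        where
        Vᵠ : Mat b b
        Vᵠ i l = φ (V i l)
        Γ : Mat n n
        Γ i j = φ (A i j)
        c : Fin b → Vec m ⟶ ⟨R⟩
        c j = proj₁ (RelD⇒ (V∈ j))
        ψ : Fin b → K₁ ⟶ ⟨R⟩
        ψ j = proj₁ (proj₂ (RelD⇒ (V∈ j)))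
        Z : Mat m b
        Z i j = φ (⟦ c j ⟧ (δᴿ i))
        G : Mat a b
        G l j = φ (⟦ ψ j ⟧ (κ₁ l))
        Row : (Fin n → Carrier) → Set ℓ
        Row x = ∃ λ x′ → (∀ j → x j ≈ φ (x′ j)) × RelN x′
        ψ-part : ∀ i j → φ (⟦ ψ j ⟧ (⟦ Cᴷ ⟧ (X₂.scaled-basis i))) * s₂⁻¹ ≈ (Cᵠ ⊗ (X₁.dual ⊗ G)) i j
        ψ-part i j = sym (X₂.cancel (sym (begin
          φ (⟦ ψ j ⟧ e)
            ≈⟨ φ.⟦⟧-cong (X₁.expand-form (ψ j) e) ⟨
          φ (sumᴿ λ l → ⟦ forms₁ ⟧ e l R.* ⟦ ψ j ⟧ (κ₁ l))
            ≈⟨ φ-dot (⟦ forms₁ ⟧ e) (λ l → ⟦ ψ j ⟧ (κ₁ l)) ⟩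
          sum (λ l → φ (⟦ forms₁ ⟧ e l) * G l j)
            ≈⟨ sum-cong-≋ (λ l → *-congʳ (trans (X₁.evaluate (X₁.form l) e) (sum-pull (φ s₂) (λ k → Cᵠ i k * X₁.dual k l) λ k →
                 trans (*-congʳ (Ce k)) (*-assoc _ _ _)))) ⟩
          sum (λ l → φ s₂ * (Cᵠ ⊗ X₁.dual) i l * G l j)
            ≈⟨ sum-pull (φ s₂) (λ l → (Cᵠ ⊗ X₁.dual) i l * G l j) (λ l → *-assoc _ _ _) ⟩
          φ s₂ * ((Cᵠ ⊗ X₁.dual) ⊗ G) i j
            ≈⟨ *-congˡ (⊗-assoc Cᵠ X₁.dual G i j) ⟩
          φ s₂ * (Cᵠ ⊗ (X₁.dual ⊗ G)) i j ∎)))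
          where
          e : ∣ K₁ ∣
          e = ⟦ Cᴷ ⟧ (X₂.scaled-basis i)
          Ce : ∀ k → φ (proj₁ e k) ≈ φ s₂ * Cᵠ i k
          Ce k = trans (φ.⟦⟧-cong (R.trans (Cᴷ≈C (X₂.scaled-basis i) k) (_⟶_.*ₗ-homo C s₂ (δᴿ i) k))) (φ.*-homo _ _)
        Λ≋ : X₂.dual ⊗ (Vᵠ ᵀ) ≋ Z ⊞ Cᵠ ⊗ (X₁.dual ⊗ G)
        Λ≋ i j = begin
          sum (λ l → φ (⟦ forms₂ ⟧ e l) * s₂⁻¹ * φ (V j l))
            ≈⟨ sum-pull s₂⁻¹ (λ l → φ (V j l) * φ (⟦ forms₂ ⟧ e l))
                 (λ l → solve 3 (λ f t v → f :* t :* v := t :* (v :* f)) refl (φ (⟦ forms₂ ⟧ e l)) s₂⁻¹ (φ (V j l))) ⟩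
          s₂⁻¹ * sum (λ l → φ (V j l) * φ (⟦ forms₂ ⟧ e l))
            ≈⟨ *-congˡ (φ-dot (V j) (⟦ forms₂ ⟧ e)) ⟨
          s₂⁻¹ * φ (sumᴿ λ l → V j l R.* ⟦ forms₂ ⟧ e l)
            ≈⟨ *-congˡ (trans (φ.⟦⟧-cong (proj₂ (proj₂ (RelD⇒ (V∈ j))) e)) (φ.+-homo _ _)) ⟩
          s₂⁻¹ * (φ (⟦ c j ⟧ (proj₁ e)) + φ (⟦ ψ j ⟧ (⟦ Cᴷ ⟧ e)))
            ≈⟨ solve 3 (λ t x y → t :* (x :+ y) := x :* t :+ y :* t) refl s₂⁻¹ _ _ ⟩
          φ (⟦ c j ⟧ (proj₁ e)) * s₂⁻¹ + φ (⟦ ψ j ⟧ (⟦ Cᴷ ⟧ e)) * s₂⁻¹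
            ≈⟨ +-cong (sym (X₂.cancel (sym (trans (φ.⟦⟧-cong (_⟶_.*ₗ-homo (c j) s₂ (δᴿ i))) (φ.*-homo _ _))))) (ψ-part i j) ⟩
          Z i j + (Cᵠ ⊗ (X₁.dual ⊗ G)) i j ∎
          where
          e : ∣ K₂ ∣
          e = X₂.scaled-basis i
        combine : ∀ (I : Fin m → Fin b) (U : Mat n n) → (∀ i → Row (U i)) →
          member (detᵠ (X₂.basis ∘ I) * detᵠ U)
        combine I U U∈ = ∈-resp (*-cong (φ-det λ i → proj₁ (κ₂ (I i)))
            (trans (φ-det λ i → proj₁ (U∈ i)) (det-cong λ i j → sym (proj₁ (proj₂ (U∈ i)) j))))
          (h (λ i → proj₁ (κ₂ (I i))) (λ i → proj₁ (U∈ i)) (λ i → proj₂ (κ₂ (I i))) λ i → proj₂ (proj₂ (U∈ i)))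

-- Independence of Fitting ideals from the generators.

module FittingIdeals {ℓ} (R : CommutativeRing ℓ ℓ) where
  open Modules R hiding (δ)
  open ModuleTheory R
  private module R = CommutativeRing R
  open Determinants R using (AdditiveSubgroup; _⊗_; _⊞_; ⊟_; det-change-generators) renaming (δ to δᴿ)

  push-generators : {A B : Mod} (f : A ⟶ B) → IsSurjective f → {n : ℕ} (g : Fin n → ∣ A ∣) →
    IsSurjective (comb {A} g) → FinitelyGenerated B
  push-generators {A} {B} f f-surj g g-surj = record
    { generators = ⟦ f ⟧ ∘ g
    ; generates = λ x → let y , fy≈x = f-surj x ; c , gc≈y = g-surj y in
        resp (≈ᴹ-trans (≈ᴹ-sym (hom-comb {A} {B} f g c)) (≈ᴹ-trans (_⟶_.⟦⟧-cong f gc≈y) fy≈x))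
          (comb∈Span {B} (⟦ f ⟧ ∘ g) c) }
    where open Module B

  comb-kernel : {A B : Mod} (f : A ⟶ B) {n : ℕ} (g : Fin n → ∣ A ∣) (v : Fin n → R.Carrier) →
    (⟦ comb {A} g ⟧ v ∈ kernel f → v ∈ kernel (comb {B} (⟦ f ⟧ ∘ g))) ×
    (v ∈ kernel (comb {B} (⟦ f ⟧ ∘ g)) → ⟦ comb {A} g ⟧ v ∈ kernel f)
  comb-kernel {A} {B} f g v = ≈ᴹ-trans (≈ᴹ-sym (hom-comb {A} {B} f g v)) , ≈ᴹ-trans (hom-comb {A} {B} f g v)
    where open Module B

  ideal-subgroup : Ideal → AdditiveSubgroup ℓ
  ideal-subgroup I = record { member = member ; ∈-resp = ∈-resp ; 0∈ = 0∈ ; +∈ = +∈ ; -∈ = -∈ }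
    where open Submodule I

  fittingIdeal-⊆ : {M : Mod} (fg fg′ : FinitelyGenerated M) → ∀ {r} → r ∈ fittingIdeal {M} fg → r ∈ fittingIdeal {M} fg′
  fittingIdeal-⊆ {M} fg fg′ = Span⊆ (fittingIdeal {M} fg′) λ (U , U-rel) →
    det-change-generators (ideal-subgroup (fittingIdeal {M} fg′)) U C B
      (λ i j → mul (U i j)) (λ i j → mul (B i j))
      λ σ → gen ((λ i → ((U ⊗ C) ++ (δᴿ ⊞ ⊟ (B ⊗ C))) (σ i)) , λ i → relation U U-rel (σ i))
    where
    open Module M
    module G = FinitelyGenerated fg
    module H = FinitelyGenerated fg′
    π′ : Vec H.size ⟶ M
    π′ = presentation {M} fg′
    module π′ = _⟶_ π′
    C : Fin G.size → Fin H.size → R.Carrier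
    C i = proj₁ (presentation-surjective {M} fg′ (G.generators i))
    C-lifts : ∀ i → ⟦ π′ ⟧ (C i) ≈ᴹ G.generators i
    C-lifts i = proj₂ (presentation-surjective {M} fg′ (G.generators i))
    B : Fin H.size → Fin G.size → R.Carrier
    B j = proj₁ (presentation-surjective {M} fg (H.generators j))
    B-lifts : ∀ j → ⟦ presentation {M} fg ⟧ (B j) ≈ᴹ H.generators j
    B-lifts j = proj₂ (presentation-surjective {M} fg (H.generators j))
    transport : ∀ {n} (X : Fin n → Fin G.size → R.Carrier) i → ⟦ π′ ⟧ ((X ⊗ C) i) ≈ᴹ ⟦ presentation {M} fg ⟧ (X i)
    transport X i = ≈ᴹ-trans (comb-comb {M} H.generators C (X i)) (comb-cong {M} C-lifts (X i))
    relation : ∀ U → (∀ i → ⟦ presentation {M} fg ⟧ (U i) ≈ᴹ 0ᴹ) → ∀ i → ⟦ π′ ⟧ (((U ⊗ C) ++ (δᴿ ⊞ ⊟ (B ⊗ C))) i) ≈ᴹ 0ᴹ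
    relation U U-rel i with splitAt G.size i
    ... | inj₁ i = ≈ᴹ-trans (transport U i) (U-rel i)
    ... | inj₂ j = ≈ᴹ-trans (π′.+ᴹ-homo (δᴿ j) ((⊟ (B ⊗ C)) j)) (≈ᴹ-trans (+ᴹ-congˡ (π′.-ᴹ-homo ((B ⊗ C) j)))
      (Differences.x-y≈0 M (≈ᴹ-trans (comb-of-δ {M} H.generators j) (≈ᴹ-sym (≈ᴹ-trans (transport B j) (B-lifts j))))))

-- Fitting ideals and their products over the localisation.

module _ {ℓ} (R : CommutativeRing ℓ ℓ) (S : Modules.MultiplicativeSet R) where
  open Modules R hiding (δ)
  open ModuleTheory R
  open FittingIdeals R
  open MultiplicativeSet S using (1∈; *-∈)
  open Localisation S
  open Ω
  private
    module R = CommutativeRing R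
    module Q = CommutativeRing S⁻¹R
    module ι = _⟶_ ι
    module Ωᴹ = CommutativeMonoid Ω-commutativeMonoid
  open Determinants R using () renaming (δ to δᴿ)
  open Determinants S⁻¹R using (AdditiveSubgroup)

  fromR-homo : IsRingHomomorphism R.rawRing Q.rawRing fromR
  fromR-homo = record
    { isSemiringHomomorphism = record
      { isNearSemiringHomomorphism = record
        { +-isMonoidHomomorphism = record
          { isMagmaHomomorphism = record
            { isRelHomomorphism = record { cong = ι.⟦⟧-cong } ; homo = ι.+ᴹ-homo }
          ; ε-homo = Q.refl }
        ; *-homo = ι.*ₗ-homo }
      ; 1#-homo = Q.refl }
    ; -‿homo = ι.-ᴹ-homo }

  open Extension R S⁻¹R fromR fromR-homo using (module Comparison)

  reciprocal : ∀ {s} → s ∈S → Σ Fraction λ s⁻¹ → fromR s *ᶠ s⁻¹ ≃ Q.1#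
  reciprocal {s} s∈ = R.1# / s [ s∈ ] , cross R.1# 1∈ (R.*-congˡ
    (R.trans (R.*-identityʳ _) (R.trans (R.*-comm s R.1#) (R.*-congˡ (R.sym (R.*-identityˡ s))))))

  -- This is where torsion enters: an `s` that kills all generators sends every unit vector into the
  -- kernel of the presentation, as `Lattice` requires.
  common-denominator : {M : Mod} → IsTorsion M → ∀ {n} (x : Fin n → ∣ M ∣) →
    ∃ λ s → s ∈S × ∀ i → Module._≈ᴹ_ M (Module._*ₗ_ M s (x i)) (Module.0ᴹ M)
  common-denominator torsion {zero} x = R.1# , 1∈ , λ ()
  common-denominator {M} torsion {suc n} x with torsion (x zero) | common-denominator {M} torsion (x ∘ suc)
  ... | s , s∈ , sx≈0 | t , t∈ , tx≈0 = s R.* t , *-∈ s∈ t∈ , λ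
    { zero → ≈ᴹ-trans (*ₗ-congʳ (R.*-comm s t)) (≈ᴹ-trans (*ₗ-assoc t s (x zero)) (≈ᴹ-trans (*ₗ-congˡ sx≈0) (*ₗ-zeroʳ t)))
    ; (suc i) → ≈ᴹ-trans (*ₗ-assoc s t (x (suc i))) (≈ᴹ-trans (*ₗ-congˡ (tx≈0 i)) (*ₗ-zeroʳ s)) }
    where open Module M

  submodule-subgroup : Submodule ⟨S⁻¹R⟩ → AdditiveSubgroup ℓ
  submodule-subgroup N = record { member = member ; ∈-resp = ∈-resp ; 0∈ = 0∈ ; +∈ = +∈ ; -∈ = -∈ }
    where open Submodule N

  timesBy : Fraction → ⟨R⟩ ⟶ ⟨S⁻¹R⟩
  timesBy y = mkHom (λ r → fromR r *ᶠ y) (λ e → Q.*-congʳ {y} (ι.⟦⟧-cong e))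
    (λ r s → Q.trans (Q.*-congʳ {y} (ι.+ᴹ-homo r s)) (Q.distribʳ y (fromR r) (fromR s)))
    (λ r s → Q.trans (Q.*-congʳ {y} (ι.*ₗ-homo r s)) (Q.*-assoc (fromR r) (fromR s) y))

  module _ (noeth : IsNoetherian) where

    Fitt-independent : {M : Mod} (fg fg′ : FinitelyGenerated M) → Fitt noeth M fg ≈Ω Fitt noeth M fg′
    Fitt-independent {M} fg fg′ x =
      (λ (r , r∈ , e) → r , fittingIdeal-⊆ {M} fg fg′ r∈ , e) , (λ (r , r∈ , e) → r , fittingIdeal-⊆ {M} fg′ fg r∈ , e)

    -- Span induction in each factor, with the other one held fixed by `timesBy`, leaves only
    -- products of two generating minors.
    Fitt·Fitt⊆ : {M M′ : Mod} (fg : FinitelyGenerated M) (fg′ : FinitelyGenerated M′) (N : Submodule ⟨S⁻¹R⟩) →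
      (∀ (U : Relations {M} fg) (V : Relations {M′} fg′) → (fromR (det (proj₁ U)) *ᶠ fromR (det (proj₁ V))) ∈ N) →
      ∀ {z} → z ∈ submodule (Fitt noeth M fg · Fitt noeth M′ fg′) → z ∈ N
    Fitt·Fitt⊆ {M} {M′} fg fg′ N h = Span⊆ N λ ((x , (r , r∈ , e)) , (y , (r′ , r′∈ , e′))) →
      N.∈-resp {fromR r *ᶠ fromR r′} (Q.*-cong e e′)
        (Span⊆ (preimage (timesBy (fromR r′)) N) (λ U →
          N.∈-resp (Q.*-comm (fromR r′) (fromR (det (proj₁ U))))
            (Span⊆ (preimage (timesBy (fromR (det (proj₁ U)))) N) (λ V →
              N.∈-resp (Q.*-comm (fromR (det (proj₁ U))) (fromR (det (proj₁ V)))) (h U V)) r′∈)) r∈)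
      where module N = Submodule N

    det·det∈ : {M M′ : Mod} (fg : FinitelyGenerated M) (fg′ : FinitelyGenerated M′)
      (U : Relations {M} fg) (V : Relations {M′} fg′) →
      (fromR (det (proj₁ U)) *ᶠ fromR (det (proj₁ V))) ∈ submodule (Fitt noeth M fg · Fitt noeth M′ fg′)
    det·det∈ fg fg′ U V = gen ((_ , (_ , gen U , Q.refl)) , (_ , (_ , gen V , Q.refl)))

    -- The comparison for a given coresolution.

    module _ {M : Mod} (s : Coresolution M) where
      open Coresolution s
      private
        module P₂ = 𝓟 P₂∈𝓟
        module P₁ = 𝓟 P₁∈𝓟
        fg₂ : FinitelyGenerated P₂
        fg₂ = 𝓜.fg P₂.P∈𝓜
        fg₁ : FinitelyGenerated P₁
        fg₁ = 𝓜.fg P₁.P∈𝓜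
        m n : ℕ
        m = FinitelyGenerated.size fg₂
        n = FinitelyGenerated.size fg₁
        π₂ : Vec m ⟶ P₂
        π₂ = presentation {P₂} fg₂
        π₁ : Vec n ⟶ P₁
        π₁ = presentation {P₁} fg₁
        lift-β : Σ (Vec m ⟶ Vec n) λ C → ∀ x → Module._≈ᴹ_ P₁ (⟦ π₁ ⟧ (⟦ C ⟧ x)) (⟦ β ⟧ (⟦ π₂ ⟧ x))
        lift-β = Vec-projective m π₁ (presentation-surjective {P₁} fg₁) (β ⊚ π₂)
        C : Vec m ⟶ Vec n
        C = proj₁ lift-β
        B₂ : DualBasis (Ker π₂)
        B₂ = dualBasis noeth {P₂} P₂.pd≤1 fg₂
        B₁ : DualBasis (Ker π₁)
        B₁ = dualBasis noeth {P₁} P₁.pd≤1 fg₁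
        module B₂ = DualBasis B₂

        module Dual = DualOfKernel α β γ α-inj exact-P₂ exact-P₁ γ-surj
          (𝓒.Ext≥2 image∈𝓒 2 (s≤s (s≤s z≤n))) (𝓒.Ext≥2 N∈𝓒 2 (s≤s (s≤s z≤n)))
          (Vec-projective m) (Vec-projective n) π₂ (presentation-surjective {P₂} fg₂) π₁ (presentation-surjective {P₁} fg₁)
          C (proj₂ lift-β)
        open Dual using (K₂; K₁; Cᴷ; Extends)

        forms : Fin B₂.size → K₂ ⟶ ⟨R⟩
        forms l = coord l ⊚ B₂.forms

        H : Mod
        H = Hom K₂ ⟨R⟩

        at : ∣ K₂ ∣ → H ⟶ ⟨R⟩
        at y = mkHom (λ f → ⟦ f ⟧ y) (λ e → e y) (λ _ _ → R.refl) (λ _ _ → R.refl)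

        expand-functional : ∀ (h : K₂ ⟶ ⟨R⟩) → Module._≈ᴹ_ H (⟦ comb {H} forms ⟧ (λ l → ⟦ h ⟧ (B₂.vectors l))) h
        expand-functional h y = R.trans (hom-comb {H} {⟨R⟩} (at y) forms (λ l → ⟦ h ⟧ (B₂.vectors l)))
          (R.trans (sum-cong-≋ λ l → R.*-comm (⟦ h ⟧ (B₂.vectors l)) (⟦ B₂.forms ⟧ y l))
            (R.trans (R.sym (hom-comb {K₂} {⟨R⟩} h B₂.vectors (⟦ B₂.forms ⟧ y)))
              (_⟶_.⟦⟧-cong h {⟦ comb {K₂} B₂.vectors ⟧ (⟦ B₂.forms ⟧ y)} {y} (B₂.expand y))))
          where open SemiringSum R.semiring using (sum-cong-≋)

        -- Images of the generators of `P₁`, in place of those given with `N∈𝓒`: their relations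
        -- form the kernel of `γ ⊚ π₁`, to which exactness applies. `Fitt-independent` returns to
        -- the given generators.
        fgN : FinitelyGenerated N
        fgN = push-generators {P₁} {N} γ γ-surj (FinitelyGenerated.generators fg₁) (presentation-surjective {P₁} fg₁)

        RelN : (Fin n → R.Carrier) → Set ℓ
        RelN x = x ∈ kernel (presentation {N} fgN)

        d₂ : ∃ λ s → s ∈S × ∀ i → Module._*ₗ_ (Vec m) s (δᴿ i) ∈ kernel π₂
        d₂ = let s , s∈ , h = common-denominator {P₂} (𝓜.torsion P₂.P∈𝓜) (FinitelyGenerated.generators fg₂) in
          s , s∈ , λ i → ≈ᴹ-trans (_⟶_.*ₗ-homo π₂ s (δᴿ i)) (≈ᴹ-trans (*ₗ-congˡ (comb-of-δ {P₂} _ i)) (h i))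
          where open Module P₂
        d₁ : ∃ λ s → s ∈S × ∀ i → Module._*ₗ_ (Vec n) s (δᴿ i) ∈ kernel π₁
        d₁ = let s , s∈ , h = common-denominator {P₁} (𝓜.torsion P₁.P∈𝓜) (FinitelyGenerated.generators fg₁) in
          s , s∈ , λ i → ≈ᴹ-trans (_⟶_.*ₗ-homo π₁ s (δᴿ i)) (≈ᴹ-trans (*ₗ-congˡ (comb-of-δ {P₁} _ i)) (h i))
          where open Module P₁

        r₁ : Σ Fraction λ s⁻¹ → fromR (proj₁ d₁) *ᶠ s⁻¹ ≃ Q.1#
        r₁ = reciprocal (proj₁ (proj₂ d₁))
        r₂ : Σ Fraction λ s⁻¹ → fromR (proj₁ d₂) *ᶠ s⁻¹ ≃ Q.1#
        r₂ = reciprocal (proj₁ (proj₂ d₂))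

        open Module N using () renaming (≈ᴹ-trans to transᴺ; ≈ᴹ-sym to symᴺ; 0ᴹ to 0ᴺ)
        module P₁ᴹ = Module P₁

        πN : ∀ x → Module._≈ᴹ_ N (⟦ γ ⟧ (⟦ π₁ ⟧ x)) (⟦ presentation {N} fgN ⟧ x)
        πN = hom-comb {P₁} {N} γ (FinitelyGenerated.generators fg₁)

        RelN⇒ : ∀ {x} → RelN x → ∃ λ z → Module._+ᴹ_ (Vec n) x (Module.-ᴹ_ (Vec n) (⟦ C ⟧ z)) ∈ kernel π₁
        RelN⇒ {x} x∈ =
          let b , βb≈π₁x = proj₂ exact-P₁ (⟦ π₁ ⟧ x) (transᴺ (πN x) x∈)
              z , π₂z≈b = presentation-surjective {P₂} fg₂ b
          in z , P₁ᴹ.≈ᴹ-trans (_⟶_.+ᴹ-homo π₁ x (Module.-ᴹ_ (Vec n) (⟦ C ⟧ z)))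
            (P₁ᴹ.≈ᴹ-trans (P₁ᴹ.+ᴹ-congˡ (_⟶_.-ᴹ-homo π₁ (⟦ C ⟧ z)))
              (Differences.x-y≈0 P₁ (P₁ᴹ.≈ᴹ-sym (P₁ᴹ.≈ᴹ-trans (proj₂ lift-β z)
                (P₁ᴹ.≈ᴹ-trans (_⟶_.⟦⟧-cong β π₂z≈b) βb≈π₁x)))))

        ⇒RelN : ∀ {x} → x ∈ kernel π₁ → RelN x
        ⇒RelN {x} x∈ = transᴺ (symᴺ (πN x)) (transᴺ (_⟶_.⟦⟧-cong γ x∈) (_⟶_.0ᴹ-homo γ))

        -C-RelN : ∀ z → RelN (Module.-ᴹ_ (Vec n) (⟦ C ⟧ z))
        -C-RelN z = Submodule.-∈ (kernel (presentation {N} fgN)) {⟦ C ⟧ z}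
          (transᴺ (symᴺ (πN (⟦ C ⟧ z))) (transᴺ (_⟶_.⟦⟧-cong γ (proj₂ lift-β z)) (proj₁ exact-P₁ (⟦ π₂ ⟧ z))))

        functional : (Fin B₂.size → R.Carrier) → K₂ ⟶ ⟨R⟩
        functional v = ⟦ comb {H} forms ⟧ v

        functional-at : ∀ v y → ⟦ functional v ⟧ y R.≈ ⟦ comb {⟨R⟩} (⟦ B₂.forms ⟧ y) ⟧ v
        functional-at v y = hom-comb {H} {⟨R⟩} (at y) forms v

        𝓕P₂ 𝓕N : Ω
        𝓕P₂ = Fitt noeth P₂ fg₂
        𝓕N = Fitt noeth N fgN

      -- `D` stands for `M ⋆`. Only the surjection `θ` and the description of its kernel enter the
      -- comparison, which keeps the resolution behind `M ⋆` out of it.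
      module _ (D : Mod) (θ : Hom K₂ ⟨R⟩ ⟶ D) (θ-surjective : IsSurjective θ)
        (θ-vanishes : ∀ h c ψ → Extends h c ψ → h ∈ kernel θ)
        (ker-θ : ∀ h → h ∈ kernel θ → ∃ λ c → ∃ λ ψ → Extends h c ψ) where
        private
          fgD : FinitelyGenerated D
          fgD = push-generators {H} {D} θ θ-surjective forms
            λ h → (λ l → ⟦ h ⟧ (B₂.vectors l)) , expand-functional h

          RelD : (Fin B₂.size → R.Carrier) → Set ℓ
          RelD v = v ∈ kernel (presentation {D} fgD)

          module Comparing = Comparison (kernel π₁) (kernel π₂) B₁ B₂ (proj₁ d₁) (proj₁ d₂) (proj₂ (proj₂ d₁)) (proj₂ (proj₂ d₂))
            (proj₁ r₁) (proj₁ r₂) (proj₂ r₁) (proj₂ r₂) C Cᴷ (λ _ _ → R.refl) RelN RelD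

          ⇒RelD : ∀ v (c : Vec m ⟶ ⟨R⟩) (ψ : K₁ ⟶ ⟨R⟩) →
            (∀ y → ⟦ comb {⟨R⟩} (⟦ B₂.forms ⟧ y) ⟧ v R.≈ ⟦ c ⟧ (proj₁ y) R.+ ⟦ ψ ⟧ (⟦ Cᴷ ⟧ y)) → RelD v
          ⇒RelD v c ψ e = proj₁ (comb-kernel {H} {D} θ forms v)
            (θ-vanishes (functional v) c ψ λ y → R.trans (functional-at v y) (e y))

          RelD⇒ : ∀ {v} → RelD v → ∃ λ (c : Vec m ⟶ ⟨R⟩) → ∃ λ (ψ : K₁ ⟶ ⟨R⟩) →
            ∀ y → ⟦ comb {⟨R⟩} (⟦ B₂.forms ⟧ y) ⟧ v R.≈ ⟦ c ⟧ (proj₁ y) R.+ ⟦ ψ ⟧ (⟦ Cᴷ ⟧ y)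
          RelD⇒ {v} v∈ = let c , ψ , e = ker-θ (functional v) (proj₂ (comb-kernel {H} {D} θ forms v) v∈)
            in c , ψ , λ y → R.trans (R.sym (functional-at v y)) (e y)

          𝓕D : Ω
          𝓕D = Fitt noeth D fgD

        -- For each inclusion the additive subgroup is the target product itself. It is an
        -- `R`-submodule, so images of elements of `R` are multipliers.
        products-agree : 𝓕P₂ · 𝓕N ≈Ω 𝓕P₁ noeth s · 𝓕D
        products-agree z =
          Fitt·Fitt⊆ {P₂} {N} fg₂ fgN (submodule (𝓕P₁ noeth s · 𝓕D)) (λ (Y , Y∈) (X , X∈) →
            Comparing.lattice-to-dual (submodule-subgroup (submodule (𝓕P₁ noeth s · 𝓕D))) (λ r → mul r) RelN⇒ ⇒RelD
              (λ A V A∈ V∈ → det·det∈ {P₁} {D} fg₁ fgD (A , A∈) (V , V∈)) Y X Y∈ X∈) ,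
          Fitt·Fitt⊆ {P₁} {D} fg₁ fgD (submodule (𝓕P₂ · 𝓕N)) (λ (A , A∈) (V , V∈) →
            Comparing.dual-to-lattice (submodule-subgroup (submodule (𝓕P₂ · 𝓕N))) (λ r → mul r) (λ i → -C-RelN (δᴿ i)) ⇒RelN RelD⇒
              (λ Y X Y∈ X∈ → det·det∈ {P₂} {N} fg₂ fgN (Y , Y∈) (X , X∈)) A V A∈ V∈)

        𝓕⟨-2⟩≈𝓕 : (𝓕P₁⁻¹ : Inverse (𝓕P₁ noeth s)) (fg : FinitelyGenerated D) → 𝓕⟨-2⟩ noeth s 𝓕P₁⁻¹ ≈Ω Fitt noeth D fg
        𝓕⟨-2⟩≈𝓕 (J , J·𝓕P₁≈1) fg = begin
          J · 𝓕P₂ · 𝓕 noeth (𝓒.M∈𝓜 N∈𝓒)   ≈⟨ Ωᴹ.assoc J 𝓕P₂ (𝓕 noeth (𝓒.M∈𝓜 N∈𝓒)) ⟩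
          J · (𝓕P₂ · 𝓕 noeth (𝓒.M∈𝓜 N∈𝓒))
            ≈⟨ Ωᴹ.∙-congˡ {J} {𝓕P₂ · 𝓕 noeth (𝓒.M∈𝓜 N∈𝓒)} {𝓕P₂ · 𝓕N} (Ωᴹ.∙-congˡ {𝓕P₂} {𝓕 noeth (𝓒.M∈𝓜 N∈𝓒)} {𝓕N}
                 (Fitt-independent {N} (𝓜.fg (𝓒.M∈𝓜 N∈𝓒)) fgN)) ⟩
          J · (𝓕P₂ · 𝓕N)                   ≈⟨ Ωᴹ.∙-congˡ {J} {𝓕P₂ · 𝓕N} {𝓕P₁ noeth s · 𝓕D} products-agree ⟩
          J · (𝓕P₁ noeth s · 𝓕D)           ≈⟨ Ωᴹ.assoc J (𝓕P₁ noeth s) 𝓕D ⟨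
          J · 𝓕P₁ noeth s · 𝓕D             ≈⟨ Ωᴹ.∙-congʳ {𝓕D} {J · 𝓕P₁ noeth s} {1Ω} J·𝓕P₁≈1 ⟩
          1Ω · 𝓕D                          ≈⟨ Ωᴹ.identityˡ 𝓕D ⟩
          𝓕D                               ≈⟨ Fitt-independent {D} fgD fg ⟩
          Fitt noeth D fg ∎
          where open SetoidReasoning Ωᴹ.setoid

      𝓕⟨-2⟩≈𝓕⋆ : (𝓕P₁⁻¹ : Inverse (𝓕P₁ noeth s)) (fg : FinitelyGenerated (M ⋆)) →
        𝓕⟨-2⟩ noeth s 𝓕P₁⁻¹ ≈Ω Fitt noeth (M ⋆) fg
      𝓕⟨-2⟩≈𝓕⋆ = 𝓕⟨-2⟩≈𝓕 (M ⋆) Dual.θ Dual.θ-surjective Dual.θ-vanishes Dual.ker-θ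

proposition4p7 : ∀ {ℓ} (R : CommutativeRing ℓ ℓ) → let open Modules R in
    (S : MultiplicativeSet) → ConsistsOfNonZeroDivisors S → let open Localisation S in
    (noeth : IsNoetherian) → HasExtBound →
    (M : Mod) (M∈𝓒 : 𝓒 M) (s : Coresolution M) (𝓕P₁⁻¹ : Inverse (𝓕P₁ noeth s)) →
    𝓕⟨-2⟩ noeth s 𝓕P₁⁻¹ ≈Ω Fitt noeth (M ⋆) (⋆-FG noeth M (𝓜.fg (𝓒.M∈𝓜 M∈𝓒)))
proposition4p7 R S _ noeth _ M M∈𝓒 s 𝓕P₁⁻¹ = 𝓕⟨-2⟩≈𝓕⋆ R S noeth s 𝓕P₁⁻¹
    (⋆-FG noeth M (𝓜.fg (𝓒.M∈𝓜 M∈𝓒)))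
  where open Modules R ; open Localisation S
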